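{- Let $m$ be a positive integer with $4\mid m$. (i) Every integer $N\ge 28m^3$ can be written as $p_{m+2}(x_1)+p_{m+2}(x_2)+p_{m+2}(x_3)+p_{m+2}(x_4)$ with $x_1,x_2,x_3,x_4\in\mathbb{N}$. (ii) There are infinitely many positive integers that cannot be written as $p_{m+4}(x_1)+p_{m+4}(x_2)+p_{m+4}(x_3)+p_{m+4}(x_4)$ with $x_1,x_2,x_3,x_4\in\mathbb{N}$.
   Context: $\mathbb{N}=\{0,1,2,\dots\}$. For an integer $k\ge 3$ and an integer $n$, the $k$-gonal number is $p_k(n)=(k-2)\binom{n}{2}+n=\frac{(k-2)n^2-(k-4)n}{2}$; in particular $p_{m+2}(n)=m\binom n2+n$. -}

module Defs where

open import Data.Nat using (ℕ; zero; suc; _+_; _*_; _∸_)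
open import Data.Product using (∃-syntax; _×_)
open import Relation.Binary.PropositionalEquality using (_≡_)

choose2 : ℕ → ℕ
choose2 zero    = 0
choose2 (suc n) = choose2 n + n

-- k-gonal number p_k(n) = (k-2) * C(n,2) + n   (used for k ≥ 3)
polygonal : ℕ → ℕ → ℕ
polygonal k n = (k ∸ 2) * choose2 n + n

SumOfFour : ℕ → ℕ → Set
SumOfFour k N = ∃[ x₁ ] ∃[ x₂ ] ∃[ x₃ ] ∃[ x₄ ]
  (polygonal k x₁ + polygonal k x₂ + polygonal k x₃ + polygonal k x₄ ≡ N)

{-# OPTIONS --safe #-}
module Submission where

-- (i) If Σ xᵢ² = a and Σ xᵢ = b then Σ p_{m+2}(xᵢ) = (m/2)(a − b) + b, so N has to be written in this form
-- with b² ≤ 4a and 3a < b² + 2b + 4.  By Cauchy's lemma such a pair (a, b) comes from naturals xᵢ as soon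
-- as 4a − b² is a suitable sum of three squares, and N ≥ 28 m³ leaves a window of 2m consecutive values
-- for b, one of which makes 4a − b² ≡ 3 (mod 8), or a − (b/2)² ≡ 1, 2 (mod 4).
-- The three-square theorem for these residues is obtained by counting: the number of representations of n
-- by x² + y² + z² equals the number of its representations by ab + bc + ca (Selling-reduced binary forms
-- of determinant n), and the latter is positive because of one obvious solution.  Both counts are
-- determined by their convolution with the squares; both convolutions are divisor sums: for four squares
-- by a recursion of Liouville type proved with Zagier's windmills, and for ab + bc + ca + k² by cutting
-- cones of lattice points into pieces on which the quadratic forms coincide.
-- (ii) With l = m/2 + 1, N is a sum of four (m+4)-gonal numbers only if lN + (l − 1)² is a sum of four
-- squares of numbers ≡ (l + 1)/2 (mod l).  For lN + (l − 1)² = (l² + 1)·4^r with 2^r ≡ 1 (mod l) all four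
-- are divisible by 2^r, and the quotients are too large.

-- The classical proof of the three-square theorem constructs a form with the help of a prime in an
-- arithmetic progression. Comparing two counts, one of them visibly nonzero, avoids every
-- construction. The price is that neither count is accessible alone; only after a fourth square is
-- added do both become the divisor sum σ(k). Everything is done for odd k. Then 4k + 1 is not a
-- square, so the windmill argument has no exceptional terms; and the added terms x(x + 1), 2x(x +
-- 1), 2x² are all even, so the odd arguments form a closed system in which the convolution can be
-- inverted. The condition 4 | m enters (i) through the choice of b. The window of length 2m
-- contains two values b and b + m congruent to N modulo m. Passing from one to the other changes a
-- by m - 2 ≡ 2 (mod 4), so for even N one of the two has a ≡ 2 (mod 4); for odd N both a and b are
-- odd anyway. In (ii) the condition makes l odd, so that powers of 2 are invertible modulo l.

module ThreeSquares where

  open import Data.Nat as ℕ using (ℕ; zero; suc; z≤n; s≤s; _≤_; _<_; _≡ᵇ_; _<ᵇ_)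
  import Data.Nat.Properties as ℕₚ
  open import Data.Nat.Induction using (<-rec)
  open import Data.Nat.Tactic.RingSolver using () renaming (solve-∀ to solve-∀ℕ)
  open import Data.Integer as ℤ using (ℤ; 0ℤ; 1ℤ; _+_; _*_; -_; _-_; ∣_∣; +≤+) renaming (+_ to pos; -[1+_] to neg1+)
  import Data.Integer.Properties as ℤₚ
  open import Data.Integer.Tactic.RingSolver using (solve-∀)
  open import Data.Bool using (Bool; true; false; not; _xor_; _∧_; if_then_else_; T)
  open import Data.Bool.Properties using (T-∧)
  open import Data.Vec as Vec using (Vec; []; _∷_)
  open import Data.Vec.Relation.Unary.All using (All; []; _∷_)
  open import Data.List using (List; []; _∷_; map; _++_)
  open import Data.List.Relation.Unary.Any using (Any; here; there)
  open import Data.Maybe using (Maybe; just; nothing)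
  open import Data.Empty using (⊥; ⊥-elim)
  open import Data.Unit using (tt)
  open import Data.Product using (_×_; _,_; proj₁; proj₂; ∃; ∃-syntax)
  open import Data.Sum using (_⊎_; inj₁; inj₂)
  open import Function.Bundles using (Equivalence)
  open import Relation.Nullary using (yes; no)
  open import Relation.Binary.PropositionalEquality
  open ≡-Reasoning

  -- Finite sums over initial segments of ℕ

  Σ< : ℕ → (ℕ → ℤ) → ℤ
  Σ< zero    f = 0ℤ
  Σ< (suc n) f = f 0 + Σ< n (λ x → f (suc x))

  Σ-cong : ∀ n {f g : ℕ → ℤ} → (∀ x → f x ≡ g x) → Σ< n f ≡ Σ< n g
  Σ-cong zero    f≗g = refl
  Σ-cong (suc n) f≗g = cong₂ _+_ (f≗g 0) (Σ-cong n (λ x → f≗g (suc x)))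

  Σ-zero : ∀ n {f : ℕ → ℤ} → (∀ x → f x ≡ 0ℤ) → Σ< n f ≡ 0ℤ
  Σ-zero zero    f≗0 = refl
  Σ-zero (suc n) f≗0 = cong₂ _+_ (f≗0 0) (Σ-zero n (λ x → f≗0 (suc x)))

  private
    interchange : ∀ a b c d → (a + b) + (c + d) ≡ (a + c) + (b + d)
    interchange = solve-∀

  Σ-+ : ∀ n (f g : ℕ → ℤ) → Σ< n (λ x → f x + g x) ≡ Σ< n f + Σ< n g
  Σ-+ zero    f g = refl
  Σ-+ (suc n) f g = trans (cong ((f 0 + g 0) +_) (Σ-+ n _ _)) (interchange (f 0) (g 0) _ _)

  Σ-* : ∀ n (c : ℤ) (f : ℕ → ℤ) → Σ< n (λ x → c * f x) ≡ c * Σ< n f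
  Σ-* zero    c f = sym (ℤₚ.*-zeroʳ c)
  Σ-* (suc n) c f = trans (cong (c * f 0 +_) (Σ-* n c _)) (sym (ℤₚ.*-distribˡ-+ c _ _))

  Σ-comm : ∀ m n (f : ℕ → ℕ → ℤ) →
    Σ< m (λ x → Σ< n (λ y → f x y)) ≡ Σ< n (λ y → Σ< m (λ x → f x y))
  Σ-comm zero    n f = sym (Σ-zero n (λ _ → refl))
  Σ-comm (suc m) n f = trans (cong (Σ< n (f 0) +_) (Σ-comm m n (λ x → f (suc x))))
                             (sym (Σ-+ n (f 0) _))

  -- Stands for finite support: all sums are cut at one bound, and every change of the range is
  -- justified by the terms beyond it being zero.
  Vanishes : ℕ → (ℕ → ℤ) → Set
  Vanishes N f = ∀ x → N ≤ x → f x ≡ 0ℤ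

  Vanishes₂ : ℕ → (ℕ → ℕ → ℤ) → Set
  Vanishes₂ N f = (∀ x y → N ≤ x → f x y ≡ 0ℤ) × (∀ x y → N ≤ y → f x y ≡ 0ℤ)

  Σ-extend : ∀ {M N} {f : ℕ → ℤ} → M ≤ N → Vanishes M f → Σ< N f ≡ Σ< M f
  Σ-extend {N = N} z≤n v = Σ-zero N (λ x → v x z≤n)
  Σ-extend {f = f} (s≤s M≤N) v = cong (f 0 +_) (Σ-extend M≤N (λ x M≤x → v (suc x) (s≤s M≤x)))

  Σ-peel : ∀ N {f : ℕ → ℤ} → Vanishes N f → Σ< N f ≡ f 0 + Σ< N (λ x → f (suc x))
  Σ-peel zero    {f} v = sym (trans (ℤₚ.+-identityʳ (f 0)) (v 0 z≤n))
  Σ-peel (suc N) {f} v = cong (f 0 +_)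
    (sym (Σ-extend (ℕₚ.n≤1+n N) (λ x N≤x → v (suc x) (s≤s N≤x))))

  double : ℕ → ℕ
  double zero    = zero
  double (suc n) = suc (suc (double n))

  double≡2* : ∀ n → double n ≡ 2 ℕ.* n
  double≡2* zero    = refl
  double≡2* (suc n) = cong suc (trans (cong suc (double≡2* n)) (sym (ℕₚ.+-suc n (n ℕ.+ 0))))

  n≤double : ∀ n → n ≤ double n
  n≤double zero    = z≤n
  n≤double (suc n) = s≤s (ℕₚ.m≤n⇒m≤1+n (n≤double n))

  private
    shuffle : ∀ a b c d → a + (b + (c + d)) ≡ (a + c) + (b + d)
    shuffle = solve-∀

  Σ-double : ∀ n (f : ℕ → ℤ) →
    Σ< (double n) f ≡ Σ< n (λ x → f (double x)) + Σ< n (λ x → f (suc (double x)))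
  Σ-double zero    f = refl
  Σ-double (suc n) f = trans (cong (λ s → f 0 + (f 1 + s)) (Σ-double n (λ x → f (suc (suc x)))))
                             (shuffle (f 0) (f 1) _ _)

  Σ-parity : ∀ N {f : ℕ → ℤ} → Vanishes N f →
    Σ< N f ≡ Σ< N (λ x → f (double x)) + Σ< N (λ x → f (suc (double x)))
  Σ-parity N {f} v = trans (sym (Σ-extend (n≤double N) v)) (Σ-double N f)

  private

    -- The range R of the difference z is kept apart from M: the induction removes the first row and
    -- column of the square, while z must still run over its full range.
    Σ-split′ : ∀ M R (g : ℕ → ℕ → ℤ) → M ≤ R → Vanishes₂ M g →
      Σ< M (λ i → Σ< M (g i)) ≡
      Σ< M (λ j → Σ< R (λ z → g (suc (z ℕ.+ j)) j)) + Σ< M (λ i → Σ< R (λ z → g i (z ℕ.+ i)))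
    Σ-split′ zero    R g M≤R v = refl
    Σ-split′ (suc M) R g M<R (vˡ , vʳ) = begin
      (g 0 0 + Σ< M (λ j → g 0 (suc j))) + Σ< M (λ i → g (suc i) 0 + Σ< M (λ j → g (suc i) (suc j)))
        ≡⟨ cong₂ _+_ row (trans (Σ-+ M _ _) (cong₂ _+_ col ih)) ⟩
      Σ< R (λ z → g 0 z) + (Σ< R (λ z → g (suc z) 0) + (A + B))
        ≡⟨ reorder (Σ< R (g 0)) (Σ< R (λ z → g (suc z) 0)) A B ⟩
      (Σ< R (λ z → g (suc z) 0) + A) + (Σ< R (λ z → g 0 z) + B)
        ≡⟨ sym (cong₂ _+_
              (cong₂ _+_ (Σ-cong R (λ z → cong (λ k → g (suc k) 0) (ℕₚ.+-identityʳ z)))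
                         (Σ-cong M λ j → Σ-cong R λ z → cong (λ k → g (suc k) (suc j)) (ℕₚ.+-suc z j)))
              (cong₂ _+_ (Σ-cong R (λ z → cong (g 0) (ℕₚ.+-identityʳ z)))
                         (Σ-cong M λ i → Σ-cong R λ z → cong (g (suc i)) (ℕₚ.+-suc z i)))) ⟩
      _ ∎
      where
      M≤R = ℕₚ.<⇒≤ M<R
      g′ : ℕ → ℕ → ℤ
      g′ i j = g (suc i) (suc j)
      A = Σ< M (λ j → Σ< R (λ z → g′ (suc (z ℕ.+ j)) j))
      B = Σ< M (λ i → Σ< R (λ z → g′ i (z ℕ.+ i)))
      row : Σ< (suc M) (g 0) ≡ Σ< R (g 0)
      row = sym (Σ-extend M<R (λ y → vʳ 0 y))
      col : Σ< M (λ i → g (suc i) 0) ≡ Σ< R (λ z → g (suc z) 0)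
      col = sym (Σ-extend M≤R (λ x M≤x → vˡ (suc x) 0 (s≤s M≤x)))
      ih : Σ< M (λ i → Σ< M (g′ i)) ≡ A + B
      ih = Σ-split′ M R g′ M≤R
        ((λ x y M≤x → vˡ (suc x) (suc y) (s≤s M≤x)) , (λ x y M≤y → vʳ (suc x) (suc y) (s≤s M≤y)))
      reorder : ∀ a b c d → a + (b + (c + d)) ≡ (b + c) + (a + d)
      reorder = solve-∀

  Σ-split : ∀ N {g : ℕ → ℕ → ℤ} → Vanishes₂ N g →
    Σ< N (λ i → Σ< N (g i)) ≡
    Σ< N (λ z → Σ< N (λ j → g (suc (z ℕ.+ j)) j)) + Σ< N (λ z → Σ< N (λ i → g i (z ℕ.+ i)))
  Σ-split N {g} v = trans (Σ-split′ N N g ℕₚ.≤-refl v)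
    (cong₂ _+_ (Σ-comm N N _) (Σ-comm N N _))

  -- Counting the zeros of Q(x) − k in ℕⁿ

  δ : ℕ → ℕ → ℤ
  δ a b = if a ≡ᵇ b then 1ℤ else 0ℤ

  δ-refl : ∀ a → δ a a ≡ 1ℤ
  δ-refl zero    = refl
  δ-refl (suc a) = δ-refl a

  δ-≢ : ∀ a b → a ≢ b → δ a b ≡ 0ℤ
  δ-≢ a b a≢b with a ≡ᵇ b in eq
  ... | false = refl
  ... | true  = ⊥-elim (a≢b (ℕₚ.≡ᵇ⇒≡ a b (subst T (sym eq) tt)))

  δ-> : ∀ {a b} → b < a → δ a b ≡ 0ℤ
  δ-> {a} {b} b<a = δ-≢ a b (λ a≡b → ℕₚ.<-irrefl (sym a≡b) b<a)

  private
    variable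
      n : ℕ

  box : ℕ → ∀ n → (Vec ℕ n → ℤ) → ℤ
  box N zero    f = f []
  box N (suc n) f = Σ< N (λ x → box N n (λ xs → f (x ∷ xs)))

  box-cong : ∀ N n {f g : Vec ℕ n → ℤ} → (∀ xs → f xs ≡ g xs) → box N n f ≡ box N n g
  box-cong N zero    f≗g = f≗g []
  box-cong N (suc n) f≗g = Σ-cong N (λ x → box-cong N n (λ xs → f≗g (x ∷ xs)))

  box-zero : ∀ N n {f : Vec ℕ n → ℤ} → (∀ xs → f xs ≡ 0ℤ) → box N n f ≡ 0ℤ
  box-zero N zero    f≗0 = f≗0 []
  box-zero N (suc n) f≗0 = Σ-zero N (λ x → box-zero N n (λ xs → f≗0 (x ∷ xs)))

  dot : Vec ℕ n → Vec ℕ n → ℕ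
  dot []       []       = 0
  dot (m ∷ ms) (x ∷ xs) = m ℕ.* x ℕ.+ dot ms xs

  -- Natural coefficients make the value nondecreasing in each variable; together with `Grows` this
  -- confines the zeros of Q - k to a box, and `shift`, `shear` and `dilate` stay within such
  -- polynomials. The mixed coefficients of x₀ are stored beside it, so that x₀ = 0 leaves `tail`.
  data Quad : ℕ → Set where
    con  : ℕ → Quad 0
    quad : (s l : ℕ) (ms : Vec ℕ n) (q : Quad n) → Quad (suc n)

  eval : Quad n → Vec ℕ n → ℕ
  eval (con c)         []       = c
  eval (quad s l ms q) (x ∷ xs) = x ℕ.* (s ℕ.* x ℕ.+ l ℕ.+ dot ms xs) ℕ.+ eval q xs

  count : ℕ → Quad n → ℕ → ℤ
  count {n} N q k = box N n (λ xs → δ (eval q xs) k)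

  private
    arith₁ : ∀ k x c d e l s → c ℕ.+ (k ℕ.* x ℕ.+ d) ℕ.+ (x ℕ.* (s ℕ.* x ℕ.+ l ℕ.+ e))
           ≡ x ℕ.* (s ℕ.* x ℕ.+ (k ℕ.+ l) ℕ.+ e) ℕ.+ (c ℕ.+ d)
    arith₁ = solve-∀ℕ
    arith₂ : ∀ x s l d e → x ℕ.* (s ℕ.* x ℕ.+ (l ℕ.+ 2 ℕ.* s) ℕ.+ d) ℕ.+ ((s ℕ.+ l) ℕ.+ d ℕ.+ e)
           ≡ (1 ℕ.+ x) ℕ.* (s ℕ.* (1 ℕ.+ x) ℕ.+ l ℕ.+ d) ℕ.+ e
    arith₂ = solve-∀ℕ
    arith₃ : ∀ z y s l m d s′ l′ d′ e →
      z ℕ.* (s ℕ.* z ℕ.+ l ℕ.+ ((m ℕ.+ 2 ℕ.* s) ℕ.* y ℕ.+ d)) ℕ.+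
        (y ℕ.* ((s′ ℕ.+ (s ℕ.+ m)) ℕ.* y ℕ.+ (l′ ℕ.+ l) ℕ.+ (d′ ℕ.+ d)) ℕ.+ e)
      ≡ (z ℕ.+ y) ℕ.* (s ℕ.* (z ℕ.+ y) ℕ.+ l ℕ.+ (m ℕ.* y ℕ.+ d)) ℕ.+ (y ℕ.* (s′ ℕ.* y ℕ.+ l′ ℕ.+ d′) ℕ.+ e)
    arith₃ = solve-∀ℕ
    arith₄ : ∀ x y s l m d s′ l′ d′ e →
      y ℕ.* (s′ ℕ.* y ℕ.+ l′ ℕ.+ (m ℕ.* x ℕ.+ d′)) ℕ.+ (x ℕ.* (s ℕ.* x ℕ.+ l ℕ.+ d) ℕ.+ e)
      ≡ x ℕ.* (s ℕ.* x ℕ.+ l ℕ.+ (m ℕ.* y ℕ.+ d)) ℕ.+ (y ℕ.* (s′ ℕ.* y ℕ.+ l′ ℕ.+ d′) ℕ.+ e)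
    arith₄ = solve-∀ℕ
    arith₅ : ∀ x s l d e →
      x ℕ.* (4 ℕ.* s ℕ.* x ℕ.+ 2 ℕ.* l ℕ.+ 2 ℕ.* d) ℕ.+ e
      ≡ (2 ℕ.* x) ℕ.* (s ℕ.* (2 ℕ.* x) ℕ.+ l ℕ.+ d) ℕ.+ e
    arith₅ = solve-∀ℕ
    arith₆ : ∀ a b c d x → (a ℕ.+ b) ℕ.* x ℕ.+ (c ℕ.+ d) ≡ a ℕ.* x ℕ.+ c ℕ.+ (b ℕ.* x ℕ.+ d)
    arith₆ = solve-∀ℕ
    arith₇ : ∀ a x c → 2 ℕ.* a ℕ.* x ℕ.+ 2 ℕ.* c ≡ 2 ℕ.* (a ℕ.* x ℕ.+ c)
    arith₇ = solve-∀ℕ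

  dot-+ : (ms ks xs : Vec ℕ n) → dot (Vec.zipWith ℕ._+_ ms ks) xs ≡ dot ms xs ℕ.+ dot ks xs
  dot-+ []       []       []       = refl
  dot-+ (m ∷ ms) (k ∷ ks) (x ∷ xs) =
    trans (cong ((m ℕ.+ k) ℕ.* x ℕ.+_) (dot-+ ms ks xs)) (arith₆ m k (dot ms xs) (dot ks xs) x)

  dot-2* : (ms xs : Vec ℕ n) → dot (Vec.map (2 ℕ.*_) ms) xs ≡ 2 ℕ.* dot ms xs
  dot-2* []       []       = refl
  dot-2* (m ∷ ms) (x ∷ xs) =
    trans (cong (2 ℕ.* m ℕ.* x ℕ.+_) (dot-2* ms xs)) (arith₇ m x (dot ms xs))

  addAffine : ℕ → Vec ℕ n → Quad n → Quad n
  addAffine c []       (con d)         = con (c ℕ.+ d)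
  addAffine c (k ∷ ks) (quad s l ms q) = quad s (k ℕ.+ l) ms (addAffine c ks q)

  eval-addAffine : ∀ c (ks : Vec ℕ n) q xs →
    eval (addAffine c ks q) xs ≡ c ℕ.+ dot ks xs ℕ.+ eval q xs
  eval-addAffine c []       (con d)         []       = cong (ℕ._+ d) (sym (ℕₚ.+-identityʳ c))
  eval-addAffine c (k ∷ ks) (quad s l ms q) (x ∷ xs) = begin
    x ℕ.* (s ℕ.* x ℕ.+ (k ℕ.+ l) ℕ.+ dot ms xs) ℕ.+ eval (addAffine c ks q) xs
      ≡⟨ cong (x ℕ.* (s ℕ.* x ℕ.+ (k ℕ.+ l) ℕ.+ dot ms xs) ℕ.+_) (eval-addAffine c ks q xs) ⟩
    x ℕ.* (s ℕ.* x ℕ.+ (k ℕ.+ l) ℕ.+ dot ms xs) ℕ.+ (c ℕ.+ dot ks xs ℕ.+ eval q xs)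
      ≡⟨ sym (ℕₚ.+-assoc (x ℕ.* (s ℕ.* x ℕ.+ (k ℕ.+ l) ℕ.+ dot ms xs)) (c ℕ.+ dot ks xs) (eval q xs)) ⟩
    x ℕ.* (s ℕ.* x ℕ.+ (k ℕ.+ l) ℕ.+ dot ms xs) ℕ.+ (c ℕ.+ dot ks xs) ℕ.+ eval q xs
      ≡⟨ cong (ℕ._+ eval q xs) (sym (arith₁ k x c (dot ks xs) (dot ms xs) l s)) ⟩
    c ℕ.+ (k ℕ.* x ℕ.+ dot ks xs) ℕ.+ (x ℕ.* (s ℕ.* x ℕ.+ l ℕ.+ dot ms xs)) ℕ.+ eval q xs
      ≡⟨ ℕₚ.+-assoc (c ℕ.+ (k ℕ.* x ℕ.+ dot ks xs)) _ _ ⟩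
    _ ∎

  -- x₀ ↦ x₀ + 1, x₀ ↦ x₀ + x₁, x₀ ↦ 2 x₀ and x₀ ↔ x₁ on polynomials.
  shift : Quad (suc n) → Quad (suc n)
  shift (quad s l ms q) = quad s (l ℕ.+ 2 ℕ.* s) ms (addAffine (s ℕ.+ l) ms q)

  shear : Quad (suc (suc n)) → Quad (suc (suc n))
  shear (quad s l (m ∷ ms) (quad s′ l′ ms′ q)) =
    quad s l (m ℕ.+ 2 ℕ.* s ∷ ms) (quad (s′ ℕ.+ (s ℕ.+ m)) (l′ ℕ.+ l) (Vec.zipWith ℕ._+_ ms′ ms) q)

  dilate : Quad (suc n) → Quad (suc n)
  dilate (quad s l ms q) = quad (4 ℕ.* s) (2 ℕ.* l) (Vec.map (2 ℕ.*_) ms) q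

  swap : Quad (suc (suc n)) → Quad (suc (suc n))
  swap (quad s l (m ∷ ms) (quad s′ l′ ms′ q)) = quad s′ l′ (m ∷ ms′) (quad s l ms q)

  eval-shift : ∀ (q : Quad (suc n)) x xs → eval (shift q) (x ∷ xs) ≡ eval q (suc x ∷ xs)
  eval-shift (quad s l ms q) x xs = trans
    (cong (x ℕ.* (s ℕ.* x ℕ.+ (l ℕ.+ 2 ℕ.* s) ℕ.+ dot ms xs) ℕ.+_) (eval-addAffine (s ℕ.+ l) ms q xs))
    (arith₂ x s l (dot ms xs) (eval q xs))

  eval-shear : ∀ (q : Quad (suc (suc n))) z y xs →
    eval (shear q) (z ∷ y ∷ xs) ≡ eval q (z ℕ.+ y ∷ y ∷ xs)
  eval-shear (quad s l (m ∷ ms) (quad s′ l′ ms′ q)) z y xs = trans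
    (cong (λ d → z ℕ.* (s ℕ.* z ℕ.+ l ℕ.+ ((m ℕ.+ 2 ℕ.* s) ℕ.* y ℕ.+ dot ms xs)) ℕ.+
        (y ℕ.* ((s′ ℕ.+ (s ℕ.+ m)) ℕ.* y ℕ.+ (l′ ℕ.+ l) ℕ.+ d) ℕ.+ eval q xs)) (dot-+ ms′ ms xs))
    (arith₃ z y s l m (dot ms xs) s′ l′ (dot ms′ xs) (eval q xs))

  eval-dilate : ∀ (q : Quad (suc n)) x xs → eval (dilate q) (x ∷ xs) ≡ eval q (double x ∷ xs)
  eval-dilate (quad s l ms q) x xs = begin
    x ℕ.* (4 ℕ.* s ℕ.* x ℕ.+ 2 ℕ.* l ℕ.+ dot (Vec.map (2 ℕ.*_) ms) xs) ℕ.+ eval q xs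
      ≡⟨ cong (λ d → x ℕ.* (4 ℕ.* s ℕ.* x ℕ.+ 2 ℕ.* l ℕ.+ d) ℕ.+ eval q xs) (dot-2* ms xs) ⟩
    x ℕ.* (4 ℕ.* s ℕ.* x ℕ.+ 2 ℕ.* l ℕ.+ 2 ℕ.* dot ms xs) ℕ.+ eval q xs
      ≡⟨ arith₅ x s l (dot ms xs) (eval q xs) ⟩
    eval (quad s l ms q) (2 ℕ.* x ∷ xs)
      ≡⟨ cong (λ y → eval (quad s l ms q) (y ∷ xs)) (sym (double≡2* x)) ⟩
    eval (quad s l ms q) (double x ∷ xs) ∎

  eval-swap : ∀ (q : Quad (suc (suc n))) x y xs → eval (swap q) (y ∷ x ∷ xs) ≡ eval q (x ∷ y ∷ xs)
  eval-swap (quad s l (m ∷ ms) (quad s′ l′ ms′ q)) x y xs =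
    arith₄ x y s l m (dot ms xs) s′ l′ (dot ms′ xs) (eval q xs)

  -- The sum over the box N^n sees every zero of Q(x) − k only if Q(x) ≥ xᵢ, which holds once xᵢ occurs in
  -- Q with a nonzero linear or square coefficient.
  Grows : Quad (suc n) → Set
  Grows (quad s l ms q) = T (0 <ᵇ s ℕ.+ l)

  ≤-eval : ∀ (q : Quad (suc n)) x xs → Grows q → x ≤ eval q (x ∷ xs)
  ≤-eval (quad s l ms q) zero    xs g = z≤n
  ≤-eval (quad s l ms q) (suc x) xs g = ℕₚ.≤-trans (ℕₚ.≤-trans (ℕₚ.≤-reflexive (sym (ℕₚ.*-identityʳ (suc x))))
    (ℕₚ.*-monoʳ-≤ (suc x) (ℕₚ.≤-trans (ℕₚ.<ᵇ⇒< 0 _ g)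
      (ℕₚ.≤-trans (ℕₚ.+-monoˡ-≤ l (ℕₚ.m≤m*n s (suc x))) (ℕₚ.m≤m+n _ (dot ms xs))))))
    (ℕₚ.m≤m+n _ (eval q xs))

  count-vanishes : ∀ {N} (q : Quad (suc n)) k → k < N → Grows q →
    Vanishes N (λ x → box N n (λ xs → δ (eval q (x ∷ xs)) k))
  count-vanishes {n} {N} q k k<N g x N≤x =
    box-zero N n (λ xs → δ-> (ℕₚ.<-≤-trans k<N (ℕₚ.≤-trans N≤x (≤-eval q x xs g))))

  tail : Quad (suc n) → Quad n
  tail (quad s l ms q) = q

  eval-tail : ∀ (q : Quad (suc n)) xs → eval q (0 ∷ xs) ≡ eval (tail q) xs
  eval-tail (quad s l ms q) xs = refl

  count-peel : ∀ {N} (q : Quad (suc n)) k → k < N → Grows q →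
    count N q k ≡ count N (tail q) k + count N (shift q) k
  count-peel {n} {N} q k k<N g = trans (Σ-peel N (count-vanishes q k k<N g)) (cong₂ _+_
    (box-cong N n (λ xs → cong (λ v → δ v k) (eval-tail q xs)))
    (Σ-cong N λ x → box-cong N n λ xs → cong (λ v → δ v k) (sym (eval-shift q x xs))))

  count-parity : ∀ {N} (q : Quad (suc n)) k → k < N → Grows q →
    count N q k ≡ count N (dilate q) k + count N (dilate (shift q)) k
  count-parity {n} {N} q k k<N g = trans (Σ-parity N (count-vanishes q k k<N g)) (cong₂ _+_
    (Σ-cong N λ x → box-cong N n λ xs → cong (λ v → δ v k) (sym (eval-dilate q x xs)))
    (Σ-cong N λ x → box-cong N n λ xs → cong (λ v → δ v k)
      (sym (trans (eval-dilate (shift q) x xs) (eval-shift q (double x) xs)))))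

  count-split : ∀ {N} (q : Quad (suc (suc n))) k → k < N → Grows q → Grows (swap q) →
    count N q k ≡ count N (shift (shear q)) k + count N (shear (swap q)) k
  count-split {n} {N} q k k<N g g′ = trans (Σ-split N v) (cong₂ _+_
    (Σ-cong N λ z → Σ-cong N λ y → box-cong N n λ xs → cong (λ v → δ v k)
      (sym (trans (eval-shift (shear q) z (y ∷ xs)) (eval-shear q (suc z) y xs))))
    (Σ-cong N λ z → Σ-cong N λ y → box-cong N n λ xs → cong (λ v → δ v k)
      (sym (trans (eval-shear (swap q) z y xs) (eval-swap q y (z ℕ.+ y) xs)))))
    where
    v : Vanishes₂ N (λ x y → box N n (λ xs → δ (eval q (x ∷ y ∷ xs)) k))
    v = (λ x y N≤x → box-zero N n (λ xs → δ-> (ℕₚ.<-≤-trans k<N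
            (ℕₚ.≤-trans N≤x (≤-eval q x (y ∷ xs) g)))))
      , (λ x y N≤y → box-zero N n (λ xs → δ-> (ℕₚ.<-≤-trans k<N (ℕₚ.≤-trans N≤y
            (subst (y ≤_) (eval-swap q x y xs) (≤-eval (swap q) y (x ∷ xs) g′))))))

  -- Certificates

  swapVec : ℕ → Vec ℕ n → Vec ℕ n
  swapVec zero    []           = []
  swapVec zero    (x ∷ [])     = x ∷ []
  swapVec zero    (x ∷ y ∷ xs) = y ∷ x ∷ xs
  swapVec (suc i) []           = []
  swapVec (suc i) (x ∷ xs)     = x ∷ swapVec i xs

  swapAt : ℕ → Quad n → Quad n
  swapAt zero    (con c)                         = con c
  swapAt zero    (quad s l [] q)                 = quad s l [] q
  swapAt zero    q@(quad _ _ (_ ∷ _) _)          = swap q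
  swapAt (suc i) (con c)                         = con c
  swapAt (suc i) (quad s l ms q)                 = quad s l (swapVec i ms) (swapAt i q)

  box-swapVec : ∀ N i (f : Vec ℕ n → ℤ) → box N n (λ xs → f (swapVec i xs)) ≡ box N n f
  box-swapVec {zero}        N zero    f = refl
  box-swapVec {suc zero}    N zero    f = refl
  box-swapVec {suc (suc n)} N zero    f = Σ-comm N N _
  box-swapVec {zero}        N (suc i) f = refl
  box-swapVec {suc n}       N (suc i) f = Σ-cong N (λ x → box-swapVec N i (λ xs → f (x ∷ xs)))

  dot-swapVec : ∀ i (ms xs : Vec ℕ n) → dot (swapVec i ms) (swapVec i xs) ≡ dot ms xs
  dot-swapVec zero    []           []           = refl
  dot-swapVec zero    (m ∷ [])     (x ∷ [])     = refl
  dot-swapVec zero    (m ∷ k ∷ ms) (x ∷ y ∷ xs) = begin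
    k ℕ.* y ℕ.+ (m ℕ.* x ℕ.+ dot ms xs) ≡⟨ sym (ℕₚ.+-assoc (k ℕ.* y) (m ℕ.* x) _) ⟩
    k ℕ.* y ℕ.+ m ℕ.* x ℕ.+ dot ms xs   ≡⟨ cong (ℕ._+ dot ms xs) (ℕₚ.+-comm (k ℕ.* y) (m ℕ.* x)) ⟩
    m ℕ.* x ℕ.+ k ℕ.* y ℕ.+ dot ms xs   ≡⟨ ℕₚ.+-assoc (m ℕ.* x) (k ℕ.* y) _ ⟩
    m ℕ.* x ℕ.+ (k ℕ.* y ℕ.+ dot ms xs) ∎
  dot-swapVec (suc i) []       []       = refl
  dot-swapVec (suc i) (m ∷ ms) (x ∷ xs) = cong (m ℕ.* x ℕ.+_) (dot-swapVec i ms xs)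

  eval-swapAt : ∀ i (q : Quad n) xs → eval (swapAt i q) (swapVec i xs) ≡ eval q xs
  eval-swapAt zero    (con c)                  []           = refl
  eval-swapAt zero    (quad s l [] q)          (x ∷ [])     = refl
  eval-swapAt zero    q@(quad _ _ (_ ∷ _) _)   (x ∷ y ∷ xs) = eval-swap q x y xs
  eval-swapAt (suc i) (con c)                  []           = refl
  eval-swapAt (suc i) (quad s l ms q)          (x ∷ xs)     =
    cong₂ (λ d e → x ℕ.* (s ℕ.* x ℕ.+ l ℕ.+ d) ℕ.+ e) (dot-swapVec i ms xs) (eval-swapAt i q xs)

  count-swapAt : ∀ N i (q : Quad n) k → count N (swapAt i q) k ≡ count N q k
  count-swapAt {n} N i q k = trans (sym (box-swapVec N i (λ xs → δ (eval (swapAt i q) xs) k)))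
    (box-cong N n (λ xs → cong (λ v → δ v k) (eval-swapAt i q xs)))

  -- A plain-changes sequence: the adjacent transpositions visit all orderings of the variables.
  plainChanges : ℕ → List ℕ
  plainChanges 2 = 0 ∷ []
  plainChanges 3 = 0 ∷ 1 ∷ 0 ∷ 1 ∷ 0 ∷ []
  plainChanges 4 = 0 ∷ 1 ∷ 2 ∷ 0 ∷ 2 ∷ 1 ∷ 0 ∷ 2 ∷ 0 ∷ 1 ∷ 2 ∷ 0 ∷ 2 ∷ 1 ∷ 0 ∷ 2 ∷ 0 ∷ 1 ∷ 2 ∷ 0 ∷ 2 ∷ 1 ∷ 0 ∷ []
  plainChanges _ = []

  code : Quad n → ℕ
  code (con c)         = c
  code (quad s l ms q) = pack (code q ℕ.* 256 ℕ.+ s) (l ∷ ms)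
    where
    pack : ℕ → ∀ {k} → Vec ℕ k → ℕ
    pack a []       = a
    pack a (m ∷ ms) = pack (a ℕ.* 256 ℕ.+ m) ms

  least : List ℕ → Quad n → Quad n → Quad n
  least []       q best = best
  least (i ∷ is) q best = least is (swapAt i q) (if code (swapAt i q) <ᵇ code best then swapAt i q else best)

  count-least : ∀ N is (q best : Quad n) k → count N q k ≡ count N best k →
    count N (least is q best) k ≡ count N best k
  count-least N []       q best k eq = refl
  count-least N (i ∷ is) q best k eq with code (swapAt i q) <ᵇ code best
  ... | false = count-least N is (swapAt i q) best k (trans (count-swapAt N i q k) eq)
  ... | true  = trans (count-least N is (swapAt i q) (swapAt i q) k refl)
                      (trans (count-swapAt N i q k) eq)

  Form : Set
  Form = ∃ Quad

  # : ℕ → Form → ℕ → ℤ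
  # N (_ , q) k = count N q k

  normalise : Form → Form
  normalise (n , q) = n , least (plainChanges n) q q

  #-normalise : ∀ N p k → # N (normalise p) k ≡ # N p k
  #-normalise N (n , q) k = count-least N (plainChanges n) q q k refl

  eqVec : ∀ {m n} → Vec ℕ m → Vec ℕ n → Bool
  eqVec []       []       = true
  eqVec (x ∷ xs) (y ∷ ys) = (x ≡ᵇ y) ∧ eqVec xs ys
  eqVec _        _        = false

  eqQuad : ∀ {m n} → Quad m → Quad n → Bool
  eqQuad (con c)         (con d)             = c ≡ᵇ d
  eqQuad (quad s l ms p) (quad s′ l′ ms′ q) = (s ≡ᵇ s′) ∧ (l ≡ᵇ l′) ∧ eqVec ms ms′ ∧ eqQuad p q
  eqQuad _               _                   = false

  private
    ∧-elim : ∀ x {y} → T (x ∧ y) → T x × T y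
    ∧-elim x t = Equivalence.to T-∧ t

  eqVec-sound : ∀ {n} (xs ys : Vec ℕ n) → T (eqVec xs ys) → xs ≡ ys
  eqVec-sound []       []       t = refl
  eqVec-sound (x ∷ xs) (y ∷ ys) t with ∧-elim (x ≡ᵇ y) t
  ... | u , v = cong₂ _∷_ (ℕₚ.≡ᵇ⇒≡ x y u) (eqVec-sound xs ys v)

  eqQuad-sound : ∀ {m n} (p : Quad m) (q : Quad n) → T (eqQuad p q) → _≡_ {A = Form} (m , p) (n , q)
  eqQuad-sound (con c)         (con d)             t = cong (λ c → 0 , con c) (ℕₚ.≡ᵇ⇒≡ c d t)
  eqQuad-sound (quad s l ms p) (quad s′ l′ ms′ q) t with ∧-elim (s ≡ᵇ s′) t
  ... | u , t₁ with ∧-elim (l ≡ᵇ l′) t₁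
  ... | v , t₂ with ∧-elim (eqVec ms ms′) t₂
  ... | w , t₃ with ℕₚ.≡ᵇ⇒≡ s s′ u | ℕₚ.≡ᵇ⇒≡ l l′ v | eqQuad-sound p q t₃
  ... | refl | refl | refl = cong (λ ms → _ , quad s l ms p) (eqVec-sound ms ms′ w)

  Combination : Set
  Combination = List (ℤ × Form)

  ⟦_⟧ : Combination → ℕ → ℕ → ℤ
  ⟦ []          ⟧ N k = 0ℤ
  ⟦ (c , p) ∷ t ⟧ N k = c * # N p k + ⟦ t ⟧ N k

  isZero : ℤ → Bool
  isZero (pos zero)    = true
  isZero (pos (suc _)) = false
  isZero (neg1+ _)     = false

  cons : ℤ → Form → Combination → Combination
  cons c p t = if isZero c then t else (c , p) ∷ t

  ⟦cons⟧ : ∀ c p t N k → ⟦ cons c p t ⟧ N k ≡ c * # N p k + ⟦ t ⟧ N k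
  ⟦cons⟧ (pos zero)    p t N k = sym (trans (cong (_+ ⟦ t ⟧ N k) (ℤₚ.*-zeroˡ (# N p k))) (ℤₚ.+-identityˡ _))
  ⟦cons⟧ (pos (suc _)) p t N k = refl
  ⟦cons⟧ (neg1+ _)     p t N k = refl

  add : ℤ → Form → Combination → Combination
  add c p []            = (c , p) ∷ []
  add c p ((d , q) ∷ t) = if eqQuad (proj₂ p) (proj₂ q) then cons (c + d) q t else (d , q) ∷ add c p t

  private
    collect : ∀ c d x y → (c + d) * x + y ≡ c * x + (d * x + y)
    collect = solve-∀
    push : ∀ a b y → a + (b + y) ≡ b + (a + y)
    push = solve-∀

  ⟦add⟧ : ∀ c p t N k → ⟦ add c p t ⟧ N k ≡ c * # N p k + ⟦ t ⟧ N k
  ⟦add⟧ c p []            N k = refl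
  ⟦add⟧ c p ((d , q) ∷ t) N k with eqQuad (proj₂ p) (proj₂ q) in eq
  ... | true  rewrite eqQuad-sound (proj₂ p) (proj₂ q) (subst T (sym eq) tt) =
    trans (⟦cons⟧ (c + d) q t N k) (collect c d (# N q k) (⟦ t ⟧ N k))
  ... | false = trans (cong (d * # N q k +_) (⟦add⟧ c p t N k)) (push (d * # N q k) (c * # N p k) _)

  reduced : Combination → Combination
  reduced []            = []
  reduced ((c , p) ∷ t) = add c (normalise p) (reduced t)

  ⟦reduced⟧ : ∀ t N k → ⟦ reduced t ⟧ N k ≡ ⟦ t ⟧ N k
  ⟦reduced⟧ []            N k = refl
  ⟦reduced⟧ ((c , p) ∷ t) N k = trans (⟦add⟧ c (normalise p) (reduced t) N k)
    (cong₂ (λ x y → c * x + y) (#-normalise N p k) (⟦reduced⟧ t N k))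

  -- Three ways to cut the orthant: x₀ > x₁ against x₀ ≤ x₁, x₀ = 0 against x₀ > 0, and x₀ even
  -- against x₀ odd. Each piece is again parametrised by a full orthant, so both halves are counts
  -- of forms of the same kind.
  data Rule : Set where
    compare peel parity : Rule

  grows : Quad (suc n) → Bool
  grows (quad s l _ _) = 0 <ᵇ s ℕ.+ l

  grows⇒Grows : ∀ (q : Quad (suc n)) → T (grows q) → Grows q
  grows⇒Grows (quad s l ms q) t = t

  refine : Rule → Form → Maybe (Form × Form)
  refine compare (suc (suc n) , q) =
    if grows q ∧ grows (swap q) then just ((_ , shift (shear q)) , (_ , shear (swap q))) else nothing
  refine peel    (suc n , q) = if grows q then just ((_ , tail q) , (_ , shift q)) else nothing
  refine parity  (suc n , q) = if grows q then just ((_ , dilate q) , (_ , dilate (shift q))) else nothing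
  refine _       _           = nothing

  refine-sound : ∀ r p {a b} → refine r p ≡ just (a , b) → ∀ {N} k → k < N →
    # N p k ≡ # N a k + # N b k
  refine-sound compare (suc (suc n) , q) eq k k<N with grows q in g | grows (swap q) in g′
  refine-sound compare (suc (suc n) , q) refl k k<N | true | true =
    count-split q k k<N (grows⇒Grows q (subst T (sym g) tt)) (grows⇒Grows (swap q) (subst T (sym g′) tt))
  refine-sound peel (suc n , q) eq k k<N with grows q in g
  refine-sound peel (suc n , q) refl k k<N | true = count-peel q k k<N (grows⇒Grows q (subst T (sym g) tt))
  refine-sound parity (suc n , q) eq k k<N with grows q in g
  refine-sound parity (suc n , q) refl k k<N | true = count-parity q k k<N (grows⇒Grows q (subst T (sym g) tt))
  refine-sound compare (zero , _) ()
  refine-sound compare (suc zero , _) ()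
  refine-sound peel (zero , _) ()
  refine-sound parity (zero , _) ()

  Step : Set
  Step = ℤ × Rule × Form

  -- A step adds c(a + b - p), whose count is zero, so every list of steps is sound and an
  -- inapplicable step may be skipped. The content of a certificate lies only in the final
  -- cancellation to `[]`.
  apply : Step → Combination → Combination
  apply (c , r , p) t with refine r p
  ... | just (a , b) = add (- c) (normalise p) (add c (normalise a) (add c (normalise b) t))
  ... | nothing      = t

  private
    cancel : ∀ c a b y → - c * (a + b) + (c * a + (c * b + y)) ≡ y
    cancel = solve-∀

  ⟦apply⟧ : ∀ s t {N} k → k < N → ⟦ apply s t ⟧ N k ≡ ⟦ t ⟧ N k
  ⟦apply⟧ (c , r , p) t {N} k k<N with refine r p in eq
  ... | nothing      = refl
  ... | just (a , b) = begin
    ⟦ add (- c) (normalise p) (add c (normalise a) (add c (normalise b) t)) ⟧ N k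
      ≡⟨ ⟦add⟧ (- c) (normalise p) (add c (normalise a) (add c (normalise b) t)) N k ⟩
    - c * # N (normalise p) k + ⟦ add c (normalise a) (add c (normalise b) t) ⟧ N k
      ≡⟨ cong₂ (λ x y → - c * x + y) (trans (#-normalise N p k) (refine-sound r p eq k k<N))
          (trans (⟦add⟧ c (normalise a) (add c (normalise b) t) N k)
            (cong₂ (λ x y → c * x + y) (#-normalise N a k) (trans (⟦add⟧ c (normalise b) t N k)
              (cong (λ x → c * x + ⟦ t ⟧ N k) (#-normalise N b k))))) ⟩
    - c * (# N a k + # N b k) + (c * # N a k + (c * # N b k + ⟦ t ⟧ N k))
      ≡⟨ cancel c (# N a k) (# N b k) (⟦ t ⟧ N k) ⟩
    ⟦ t ⟧ N k ∎

  run : List Step → Combination → Combination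
  run []       t = t
  run (s ∷ ss) t = run ss (apply s t)

  ⟦run⟧ : ∀ ss t {N} k → k < N → ⟦ run ss t ⟧ N k ≡ ⟦ t ⟧ N k
  ⟦run⟧ []       t k k<N = refl
  ⟦run⟧ (s ∷ ss) t k k<N = trans (⟦run⟧ ss (apply s t) k k<N) (⟦apply⟧ s t k k<N)

  certified : ∀ ss t → run ss (reduced t) ≡ [] → ∀ {N} k → k < N → ⟦ t ⟧ N k ≡ 0ℤ
  certified ss t eq {N} k k<N = begin
    ⟦ t ⟧ N k                  ≡⟨ sym (⟦reduced⟧ t N k) ⟩
    ⟦ reduced t ⟧ N k          ≡⟨ sym (⟦run⟧ ss (reduced t) k k<N) ⟩
    ⟦ run ss (reduced t) ⟧ N k ≡⟨ cong (λ u → ⟦ u ⟧ N k) eq ⟩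
    0ℤ                         ∎

  -- Convolutions with the squares

  box-+ : ∀ N n (f g : Vec ℕ n → ℤ) → box N n (λ xs → f xs + g xs) ≡ box N n f + box N n g
  box-+ N zero    f g = refl
  box-+ N (suc n) f g = trans (Σ-cong N (λ x → box-+ N n _ _)) (Σ-+ N _ _)

  box-* : ∀ N n (c : ℤ) (f : Vec ℕ n → ℤ) → box N n (λ xs → c * f xs) ≡ c * box N n f
  box-* N zero    c f = refl
  box-* N (suc n) c f = trans (Σ-cong N (λ x → box-* N n c _)) (Σ-* N c _)

  box-Σ : ∀ N n M (g : ℕ → Vec ℕ n → ℤ) →
    box N n (λ xs → Σ< M (λ j → g j xs)) ≡ Σ< M (λ j → box N n (g j))
  box-Σ N zero    M g = refl
  box-Σ N (suc n) M g = trans (Σ-cong N (λ x → box-Σ N n M _)) (Σ-comm N M _)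

  δ-replace : ∀ {a b} (f : ℕ → ℤ) → δ a b * f a ≡ δ a b * f b
  δ-replace {a} {b} f with a ℕ.≟ b
  ... | yes refl = refl
  ... | no a≢b rewrite δ-≢ a b a≢b = trans (ℤₚ.*-zeroˡ (f a)) (sym (ℤₚ.*-zeroˡ (f b)))

  δ-sym : ∀ a b → δ a b ≡ δ b a
  δ-sym zero    zero    = refl
  δ-sym zero    (suc b) = refl
  δ-sym (suc a) zero    = refl
  δ-sym (suc a) (suc b) = δ-sym a b

  Σ-pick : ∀ N v (f : ℕ → ℤ) → v < N → Σ< N (λ j → δ v j * f j) ≡ f v
  Σ-pick (suc N) zero    f v<N = trans (cong₂ _+_ (ℤₚ.*-identityˡ (f 0))
    (Σ-zero N (λ x → ℤₚ.*-zeroˡ (f (suc x))))) (ℤₚ.+-identityʳ (f 0))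
  Σ-pick (suc N) (suc v) f (s≤s v<N) = trans (cong₂ _+_ (ℤₚ.*-zeroˡ (f 0)) (Σ-pick N v (λ x → f (suc x)) v<N))
    (ℤₚ.+-identityˡ (f (suc v)))

  Σ-pick≥ : ∀ N v (f : ℕ → ℤ) → N ≤ v → Σ< N (λ j → δ v j * f j) ≡ 0ℤ
  Σ-pick≥ zero    v       f N≤v = refl
  Σ-pick≥ (suc N) (suc v) f (s≤s N≤v) =
    cong₂ _+_ (ℤₚ.*-zeroˡ (f 0)) (Σ-pick≥ N v (λ x → f (suc x)) N≤v)

  δ-through : ∀ {N} e v k → k < N → δ (e ℕ.+ v) k ≡ Σ< N (λ j → δ v j * δ (e ℕ.+ j) k)
  δ-through {N} e v k k<N with v ℕ.<? N
  ... | yes v<N = sym (Σ-pick N v (λ j → δ (e ℕ.+ j) k) v<N)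
  ... | no v≮N = trans (δ-> (ℕₚ.<-≤-trans k<N (ℕₚ.≤-trans (ℕₚ.≮⇒≥ v≮N) (ℕₚ.m≤n+m v e))))
                       (sym (Σ-pick≥ N v _ (ℕₚ.≮⇒≥ v≮N)))

  -- Σ_{e(x) + j = k} w(x) f(j)
  conv : ℕ → (ℕ → ℕ) → (ℕ → ℤ) → (ℕ → ℤ) → ℕ → ℤ
  conv N e w f k = Σ< N (λ x → Σ< N (λ j → δ (e x ℕ.+ j) k * (w x * f j)))

  box-conv : ∀ {N} n (r : Vec ℕ n → ℕ) (g : Vec ℕ n → ℤ) e k → k < N →
    box N n (λ xs → δ (e ℕ.+ r xs) k * g xs) ≡
    Σ< N (λ j → δ (e ℕ.+ j) k * box N n (λ xs → δ (r xs) j * g xs))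
  box-conv {N} n r g e k k<N = begin
    box N n (λ xs → δ (e ℕ.+ r xs) k * g xs)
      ≡⟨ box-cong N n (λ xs → begin
           δ (e ℕ.+ r xs) k * g xs
             ≡⟨ cong (_* g xs) (δ-through e (r xs) k k<N) ⟩
           Σ< N (λ j → δ (r xs) j * δ (e ℕ.+ j) k) * g xs
             ≡⟨ ℤₚ.*-comm _ (g xs) ⟩
           g xs * Σ< N (λ j → δ (r xs) j * δ (e ℕ.+ j) k)
             ≡⟨ sym (Σ-* N (g xs) _) ⟩
           Σ< N (λ j → g xs * (δ (r xs) j * δ (e ℕ.+ j) k))
             ≡⟨ Σ-cong N (λ j → rearrange (g xs) (δ (r xs) j) (δ (e ℕ.+ j) k)) ⟩
           Σ< N (λ j → δ (e ℕ.+ j) k * (δ (r xs) j * g xs)) ∎) ⟩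
    box N n (λ xs → Σ< N (λ j → δ (e ℕ.+ j) k * (δ (r xs) j * g xs)))
      ≡⟨ box-Σ N n N _ ⟩
    Σ< N (λ j → box N n (λ xs → δ (e ℕ.+ j) k * (δ (r xs) j * g xs)))
      ≡⟨ Σ-cong N (λ j → box-* N n (δ (e ℕ.+ j) k) _) ⟩
    Σ< N (λ j → δ (e ℕ.+ j) k * box N n (λ xs → δ (r xs) j * g xs)) ∎
    where
    rearrange : ∀ a b c → a * (b * c) ≡ c * (b * a)
    rearrange = solve-∀

  -- A separate variable in Q = e(x) + R turns the count into a convolution.
  count-conv : ∀ {N} (q : Quad (suc n)) (r : Quad n) (e : ℕ → ℕ) → (∀ x xs → eval q (x ∷ xs) ≡ e x ℕ.+ eval r xs) →
    ∀ k → k < N → count N q k ≡ conv N e (λ _ → 1ℤ) (count N r) k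
  count-conv {n} {N} q r e split k k<N = Σ-cong N (λ x → begin
    box N n (λ xs → δ (eval q (x ∷ xs)) k)
      ≡⟨ box-cong N n (λ xs → trans (cong (λ v → δ v k) (split x xs)) (sym (ℤₚ.*-identityʳ _))) ⟩
    box N n (λ xs → δ (e x ℕ.+ eval r xs) k * 1ℤ)
      ≡⟨ box-conv n (eval r) (λ _ → 1ℤ) (e x) k k<N ⟩
    Σ< N (λ j → δ (e x ℕ.+ j) k * box N n (λ xs → δ (eval r xs) j * 1ℤ))
      ≡⟨ Σ-cong N (λ j → cong (δ (e x ℕ.+ j) k *_) (trans
           (box-cong N n (λ xs → ℤₚ.*-identityʳ _)) (sym (ℤₚ.*-identityˡ (count N r j))))) ⟩
    Σ< N (λ j → δ (e x ℕ.+ j) k * (1ℤ * count N r j)) ∎)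

  conv-+ : ∀ N e w f g k → conv N e w (λ j → f j + g j) k ≡ conv N e w f k + conv N e w g k
  conv-+ N e w f g k = trans (Σ-cong N (λ x → trans (Σ-cong N (λ j → dist (δ (e x ℕ.+ j) k) (w x) (f j) (g j))) (Σ-+ N _ _)))
    (Σ-+ N _ _)
    where
    dist : ∀ d w a b → d * (w * (a + b)) ≡ d * (w * a) + d * (w * b)
    dist = solve-∀

  conv-* : ∀ N e w c f k → conv N e w (λ j → c * f j) k ≡ c * conv N e w f k
  conv-* N e w c f k = trans (Σ-cong N (λ x → trans (Σ-cong N (λ j → move (δ (e x ℕ.+ j) k) (w x) c (f j))) (Σ-* N c _)))
    (Σ-* N c _)
    where
    move : ∀ d w c a → d * (w * (c * a)) ≡ c * (d * (w * a))
    move = solve-∀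

  conv-cong : ∀ N e w {f g : ℕ → ℤ} k → (∀ x j → e x ℕ.+ j ≡ k → f j ≡ g j) → conv N e w f k ≡ conv N e w g k
  conv-cong N e w {f} {g} k f≗g = Σ-cong N (λ x → Σ-cong N (λ j → pointwise x j))
    where
    pointwise : ∀ x j → δ (e x ℕ.+ j) k * (w x * f j) ≡ δ (e x ℕ.+ j) k * (w x * g j)
    pointwise x j with e x ℕ.+ j ℕ.≟ k
    ... | yes eq = cong (λ v → δ (e x ℕ.+ j) k * (w x * v)) (f≗g x j eq)
    ... | no neq rewrite δ-≢ (e x ℕ.+ j) k neq =
      trans (ℤₚ.*-zeroˡ (w x * f j)) (sym (ℤₚ.*-zeroˡ (w x * g j)))

  odd : ℕ → Bool
  odd zero    = false
  odd (suc n) = not (odd n)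

  odd-double : ∀ n → odd (double n) ≡ false
  odd-double zero    = refl
  odd-double (suc n) rewrite odd-double n = refl

  odd-+ : ∀ m n → odd (m ℕ.+ n) ≡ odd m xor odd n
  odd-+ zero    n = refl
  odd-+ (suc m) n rewrite odd-+ m n with odd m | odd n
  ... | true  | true  = refl
  ... | true  | false = refl
  ... | false | true  = refl
  ... | false | false = refl

  odd-rest : ∀ e j {k} → odd e ≡ false → e ℕ.+ j ≡ k → odd k ≡ true → odd j ≡ true
  odd-rest e j even refl o = trans (sym (trans (odd-+ e j) (cong (_xor odd j) even))) o

  -- Division of power series: the term x = 0 of the convolution determines h(k) from its earlier values.
  conv-determines : ∀ {N} (e : ℕ → ℕ) (w w′ : ℕ → ℕ → ℤ) (h : ℕ → ℤ) →
    e 0 ≡ 0 → (∀ x → 0 < e (suc x)) → (∀ x → odd (e x) ≡ false) →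
    (∀ k → odd k ≡ true → k < N → w k 0 ≡ 0ℤ → h k ≡ 0ℤ) →
    (∀ k → odd k ≡ true → k < N →
      conv N e (w k) h k + conv N (λ x → e (suc x)) (w′ k) h k ≡ 0ℤ) →
    ∀ k → odd k ≡ true → k < N → h k ≡ 0ℤ
  conv-determines {N} e w w′ h e0 epos even base hyp = <-rec _ go
    where
    go : ∀ k → (∀ {j} → j < k → odd j ≡ true → j < N → h j ≡ 0ℤ) → odd k ≡ true → k < N → h k ≡ 0ℤ
    -- The leading coefficient may vanish, as 4k - 4 does for `weight` at k = 1; there the equation
    -- says nothing about h k, and `base` has to supply it.
    go k ih ok k<N = conclude (ℤₚ.i*j≡0⇒i≡0∨j≡0 (w k 0) {h k} leading)
      where
      conclude : w k 0 ≡ 0ℤ ⊎ h k ≡ 0ℤ → h k ≡ 0ℤ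
      conclude (inj₁ w≡0) = base k ok k<N w≡0
      conclude (inj₂ h≡0) = h≡0
      zero-term : ∀ (c : ℤ) x j → δ (e (suc x) ℕ.+ j) k * (c * h j) ≡ 0ℤ
      zero-term c x j with e (suc x) ℕ.+ j ℕ.≟ k
      ... | no neq rewrite δ-≢ _ k neq = ℤₚ.*-zeroˡ (c * h j)
      ... | yes eq = trans (cong (λ v → δ (e (suc x) ℕ.+ j) k * (c * v))
          (ih j<k (odd-rest (e (suc x)) j (even (suc x)) eq ok) (ℕₚ.<-trans j<k k<N)))
        (trans (cong (δ (e (suc x) ℕ.+ j) k *_) (ℤₚ.*-zeroʳ c)) (ℤₚ.*-zeroʳ (δ (e (suc x) ℕ.+ j) k)))
        where
        j<k : j < k
        j<k = subst (j <_) eq (ℕₚ.m<n+m j (epos x))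
      tail-zero : ∀ M (c : ℕ → ℤ) → Σ< M (λ x → Σ< N (λ j → δ (e (suc x) ℕ.+ j) k * (c x * h j))) ≡ 0ℤ
      tail-zero M c = Σ-zero M (λ x → Σ-zero N (zero-term (c x) x))
      head : ∀ M → k < M → Σ< M (λ x → Σ< N (λ j → δ (e x ℕ.+ j) k * (w k x * h j))) ≡ w k 0 * h k
      head (suc M) _ = begin
        Σ< N (λ j → δ (e 0 ℕ.+ j) k * (w k 0 * h j)) + Σ< M _
          ≡⟨ cong₂ _+_ (Σ-cong N (λ j → cong (_* (w k 0 * h j))
               (trans (cong (λ v → δ (v ℕ.+ j) k) e0) (δ-sym j k)))) (tail-zero M (λ x → w k (suc x))) ⟩
        Σ< N (λ j → δ k j * (w k 0 * h j)) + 0ℤ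
          ≡⟨ ℤₚ.+-identityʳ _ ⟩
        Σ< N (λ j → δ k j * (w k 0 * h j))
          ≡⟨ Σ-pick N k (λ j → w k 0 * h j) k<N ⟩
        w k 0 * h k ∎
      leading : w k 0 * h k ≡ 0ℤ
      leading = begin
        w k 0 * h k                                        ≡⟨ sym (ℤₚ.+-identityʳ _) ⟩
        w k 0 * h k + 0ℤ                                   ≡⟨ sym (cong₂ _+_ (head N k<N) (tail-zero N (w′ k))) ⟩
        conv N e (w k) h k + conv N (λ x → e (suc x)) (w′ k) h k ≡⟨ hyp k ok k<N ⟩
        0ℤ ∎

  -- Windmills

  odd-* : ∀ m n → odd (m ℕ.* n) ≡ odd m ∧ odd n
  odd-* zero    n = refl
  odd-* (suc m) n rewrite odd-+ n (m ℕ.* n) | odd-* m n with odd m | odd n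
  ... | true  | true  = refl
  ... | true  | false = refl
  ... | false | true  = refl
  ... | false | false = refl

  δ-shift : ∀ a b c → δ (a ℕ.+ c) (b ℕ.+ c) ≡ δ a b
  δ-shift a b zero    = cong₂ δ (ℕₚ.+-identityʳ a) (ℕₚ.+-identityʳ b)
  δ-shift a b (suc c) = trans (cong₂ δ (ℕₚ.+-suc a c) (ℕₚ.+-suc b c)) (δ-shift a b c)

  -- Zagier's windmills 4uv + y² = L: the reflection of the proof is the exchange v ↔ w in the coordinates
  -- y = v − w − u, where 4uv + y² = (u + v + w)² − 4vw, under which (u + v)(u + y)(v − y) changes sign.
  module Windmill (L M : ℕ) (L<M : L < M)
                  (odd-L : odd L ≡ true) (L≢□ : ∀ a → a ℕ.* a ≢ L) where

    F H : ℕ → ℕ → ℕ → ℤ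
    F u v y = δ (4 ℕ.* u ℕ.* v ℕ.+ y ℕ.* y) L * (pos (u ℕ.+ v) * pos (u ℕ.+ y) * (pos v - pos y))
    H u v w = δ ((u ℕ.+ v ℕ.+ w) ℕ.* (u ℕ.+ v ℕ.+ w)) (L ℕ.+ 4 ℕ.* v ℕ.* w) *
              (pos (u ℕ.+ v) * pos (u ℕ.+ w) * (pos v - pos w))

    Σ³ : (ℕ → ℕ → ℕ → ℤ) → ℤ
    Σ³ f = Σ< M (λ x → Σ< M (λ y → Σ< M (λ z → f x y z)))

    Σ³-cong : ∀ {f g} → (∀ x y z → f x y z ≡ g x y z) → Σ³ f ≡ Σ³ g
    Σ³-cong eq = Σ-cong M (λ x → Σ-cong M (λ y → Σ-cong M (λ z → eq x y z)))

    Σ³-swapʳ : ∀ f → Σ³ f ≡ Σ³ (λ x z y → f x y z)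
    Σ³-swapʳ f = Σ-cong M (λ x → Σ-comm M M (f x))

    Σ³-swapˡ : ∀ f → Σ³ f ≡ Σ³ (λ y x z → f x y z)
    Σ³-swapˡ f = Σ-comm M M (λ x y → Σ< M (λ z → f x y z))

    Σ³-split : ∀ f → (∀ x → Vanishes₂ M (f x)) →
      Σ³ f ≡ Σ³ (λ x z j → f x (suc (z ℕ.+ j)) j) + Σ³ (λ x z i → f x i (z ℕ.+ i))
    Σ³-split f v = trans (Σ-cong M (λ x → Σ-split M (v x))) (Σ-+ M _ _)

    private
      zero* : ∀ {a b} (c : ℤ) → a ≢ b → δ a b * c ≡ 0ℤ
      zero* {a} {b} c a≢b rewrite δ-≢ a b a≢b = ℤₚ.*-zeroˡ c

      big : ∀ {a b x} (c : ℤ) → M ≤ x → x ≤ a → b ≤ L → δ a b * c ≡ 0ℤ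
      big c M≤x x≤a b≤L = zero* c (λ a≡b → ℕₚ.<⇒≢
        (ℕₚ.<-≤-trans (ℕₚ.≤-<-trans b≤L L<M) (ℕₚ.≤-trans M≤x x≤a)) (sym a≡b))

      x≤suc : ∀ {x y} → suc x ≤ y → x ≤ y
      x≤suc p = ℕₚ.≤-trans (ℕₚ.n≤1+n _) p

      F-u : ∀ u v y → M ≤ u → F (suc u) (suc v) y ≡ 0ℤ
      F-u u v y M≤u = big _ M≤u (x≤suc (ℕₚ.≤-trans (ℕₚ.≤-trans (ℕₚ.m≤n*m (suc u) 4) (ℕₚ.m≤m*n (4 ℕ.* suc u) (suc v)))
        (ℕₚ.m≤m+n _ _))) ℕₚ.≤-refl

      F-v : ∀ u v y → M ≤ v → F (suc u) (suc v) y ≡ 0ℤ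
      F-v u v y M≤v = big _ M≤v (x≤suc (ℕₚ.≤-trans (ℕₚ.m≤n*m (suc v) (4 ℕ.* suc u)) (ℕₚ.m≤m+n _ _))) ℕₚ.≤-refl

      F-y : ∀ u v y → M ≤ y → F u v (suc y) ≡ 0ℤ
      F-y u v y M≤y = big _ M≤y (x≤suc (ℕₚ.≤-trans (ℕₚ.m≤m*n (suc y) (suc y)) (ℕₚ.m≤n+m _ (4 ℕ.* u ℕ.* v)))) ℕₚ.≤-refl

      -- (u + v + w)² = 4vw + L forces u ≤ L and, unless u = 0, also v ≤ L and w ≤ L.
      H-zero : ∀ u v w → (u ℕ.+ v ℕ.+ w) ℕ.* (u ℕ.+ v ℕ.+ w) ≢ L ℕ.+ 4 ℕ.* v ℕ.* w → H u v w ≡ 0ℤ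
      H-zero u v w ne = zero* _ ne

      sq-le : ∀ v w → 4 ℕ.* v ℕ.* w ≤ (v ℕ.+ w) ℕ.* (v ℕ.+ w)
      sq-le v w with ℕₚ.≤-total v w
      ... | inj₁ v≤w with ℕₚ.m≤n⇒∃[o]m+o≡n v≤w
      ... | d , refl = ℕₚ.≤-trans (ℕₚ.m≤m+n _ (d ℕ.* d)) (ℕₚ.≤-reflexive (e v d))
        where
        e : ∀ v d → 4 ℕ.* v ℕ.* (v ℕ.+ d) ℕ.+ d ℕ.* d ≡ (v ℕ.+ (v ℕ.+ d)) ℕ.* (v ℕ.+ (v ℕ.+ d))
        e = solve-∀ℕ
      sq-le v w | inj₂ w≤v with ℕₚ.m≤n⇒∃[o]m+o≡n w≤v
      ... | d , refl = ℕₚ.≤-trans (ℕₚ.m≤m+n _ (d ℕ.* d)) (ℕₚ.≤-reflexive (e w d))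
        where
        e : ∀ w d → 4 ℕ.* (w ℕ.+ d) ℕ.* w ℕ.+ d ℕ.* d ≡ ((w ℕ.+ d) ℕ.+ w) ℕ.* ((w ℕ.+ d) ℕ.+ w)
        e = solve-∀ℕ

      H-bound : ∀ u v w → (u ℕ.+ v ℕ.+ w) ℕ.* (u ℕ.+ v ℕ.+ w) ≡ L ℕ.+ 4 ℕ.* v ℕ.* w → u ℕ.* (u ℕ.+ 2 ℕ.* (v ℕ.+ w)) ≤ L
      H-bound u v w eq = ℕₚ.+-cancelʳ-≤ (4 ℕ.* v ℕ.* w) _ L 
        (ℕₚ.≤-trans (ℕₚ.+-monoʳ-≤ (u ℕ.* (u ℕ.+ 2 ℕ.* (v ℕ.+ w))) (sq-le v w)) (ℕₚ.≤-reflexive (trans (e u v w) eq)))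
        where
        e : ∀ u v w → u ℕ.* (u ℕ.+ 2 ℕ.* (v ℕ.+ w)) ℕ.+ (v ℕ.+ w) ℕ.* (v ℕ.+ w) ≡ (u ℕ.+ v ℕ.+ w) ℕ.* (u ℕ.+ v ℕ.+ w)
        e = solve-∀ℕ

      H-big : ∀ u v w x → x ≤ suc u ℕ.* (suc u ℕ.+ 2 ℕ.* (v ℕ.+ w)) → M ≤ x → H (suc u) v w ≡ 0ℤ
      H-big u v w x x≤ M≤x = H-zero (suc u) v w (λ eq →
        ℕₚ.<-irrefl refl (ℕₚ.<-≤-trans L<M (ℕₚ.≤-trans M≤x (ℕₚ.≤-trans x≤ (H-bound (suc u) v w eq)))))

      factor : ∀ u v w → suc u ℕ.+ 2 ℕ.* (v ℕ.+ w) ≤ suc u ℕ.* (suc u ℕ.+ 2 ℕ.* (v ℕ.+ w))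
      factor u v w = ℕₚ.m≤n*m (suc u ℕ.+ 2 ℕ.* (v ℕ.+ w)) (suc u)

      H-u : ∀ u v w → M ≤ u → H (suc u) v w ≡ 0ℤ
      H-u u v w = H-big u v w u (x≤suc (ℕₚ.≤-trans (ℕₚ.m≤m+n (suc u) _) (factor u v w)))

      H-v : ∀ u v w → M ≤ v → H (suc u) v w ≡ 0ℤ
      H-v u v w = H-big u v w v (ℕₚ.≤-trans (ℕₚ.≤-trans (ℕₚ.m≤m+n v w) (ℕₚ.≤-trans (ℕₚ.m≤n*m (v ℕ.+ w) 2)
        (ℕₚ.m≤n+m _ (suc u)))) (factor u v w))

      H-w : ∀ u v w → M ≤ w → H (suc u) v w ≡ 0ℤ
      H-w u v w = H-big u v w w (ℕₚ.≤-trans (ℕₚ.≤-trans (ℕₚ.m≤n+m w v) (ℕₚ.≤-trans (ℕₚ.m≤n*m (v ℕ.+ w) 2)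
        (ℕₚ.m≤n+m _ (suc u)))) (factor u v w))

      match : ∀ {a b c d e x y} → a ℕ.+ c ≡ d → b ℕ.+ c ≡ e → x ≡ y → δ a b * x ≡ δ d e * y
      match {a} {b} {c} refl refl refl = cong (_* _) (sym (δ-shift a b c))

      -- The change of variables in two charts: (u, v, y) ↦ (u, v, v - u - y) where v > u + y, and
      -- (u, v, y) ↦ (v, u, u + y - v) where v < u + y. The second chart is cut once more at u = v,
      -- because for an image (u, v, w) the condition y = w + u - v > 0 is automatic when u > v and
      -- a restriction on w when u ≤ v. This gives the three regions of `A`, `B` and `C`, which are
      -- those of Zagier's involution.
      F≡H₁ : ∀ u y w → F u (u ℕ.+ y ℕ.+ w) y ≡ H u (u ℕ.+ y ℕ.+ w) w
      F≡H₁ u y w = match {c = 4 ℕ.* (u ℕ.+ y ℕ.+ w) ℕ.* w} (e u y w) refl (g (pos u) (pos y) (pos w))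
        where
        e : ∀ u y w → 4 ℕ.* u ℕ.* (u ℕ.+ y ℕ.+ w) ℕ.+ y ℕ.* y ℕ.+ 4 ℕ.* (u ℕ.+ y ℕ.+ w) ℕ.* w
          ≡ (u ℕ.+ (u ℕ.+ y ℕ.+ w) ℕ.+ w) ℕ.* (u ℕ.+ (u ℕ.+ y ℕ.+ w) ℕ.+ w)
        e = solve-∀ℕ
        g : ∀ u y w → (u + (u + y + w)) * (u + y) * (u + y + w - y) ≡ (u + (u + y + w)) * (u + w) * (u + y + w - w)
        g = solve-∀

      F≡H₂ : ∀ u t w → F u (u ℕ.+ t) (t ℕ.+ w) ≡ H (u ℕ.+ t) u w
      F≡H₂ u t w = match {c = 4 ℕ.* u ℕ.* w} (e u t w) refl (g (pos u) (pos t) (pos w))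
        where
        e : ∀ u t w → 4 ℕ.* u ℕ.* (u ℕ.+ t) ℕ.+ (t ℕ.+ w) ℕ.* (t ℕ.+ w) ℕ.+ 4 ℕ.* u ℕ.* w
          ≡ (u ℕ.+ t ℕ.+ u ℕ.+ w) ℕ.* (u ℕ.+ t ℕ.+ u ℕ.+ w)
        e = solve-∀ℕ
        g : ∀ u t w → (u + (u + t)) * (u + (t + w)) * (u + t - (t + w)) ≡ (u + t + u) * (u + t + w) * (u - w)
        g = solve-∀

      F≡H₃ : ∀ u s y → F (u ℕ.+ s) u y ≡ H u (u ℕ.+ s) (s ℕ.+ y)
      F≡H₃ u s y = match {c = 4 ℕ.* (u ℕ.+ s) ℕ.* (s ℕ.+ y)} (e u s y) refl (g (pos u) (pos s) (pos y))
        where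
        e : ∀ u s y → 4 ℕ.* (u ℕ.+ s) ℕ.* u ℕ.+ y ℕ.* y ℕ.+ 4 ℕ.* (u ℕ.+ s) ℕ.* (s ℕ.+ y)
          ≡ (u ℕ.+ (u ℕ.+ s) ℕ.+ (s ℕ.+ y)) ℕ.* (u ℕ.+ (u ℕ.+ s) ℕ.+ (s ℕ.+ y))
        e = solve-∀ℕ
        g : ∀ u s y → (u + s + u) * (u + s + y) * (u - y) ≡ (u + (u + s)) * (u + (s + y)) * (u + s - (s + y))
        g = solve-∀

      -- y = v − u would make L a square.
      F-degenerate : ∀ u t → F u (u ℕ.+ t) t ≡ 0ℤ
      F-degenerate u t = zero* _ (λ eq → L≢□ (2 ℕ.* u ℕ.+ t) (trans (e u t) eq))
        where
        e : ∀ u t → (2 ℕ.* u ℕ.+ t) ℕ.* (2 ℕ.* u ℕ.+ t) ≡ 4 ℕ.* u ℕ.* (u ℕ.+ t) ℕ.+ t ℕ.* t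
        e = solve-∀ℕ

      -- v = u + w makes both squares even, but L is odd.
      H-degenerate : ∀ u w → H u (u ℕ.+ w) w ≡ 0ℤ
      H-degenerate u w = H-zero u (u ℕ.+ w) w (λ eq → false≢true (begin
        false                                     ≡⟨ sym (trans (odd-* 4 (u ℕ.* u ℕ.+ 2 ℕ.* u ℕ.* w ℕ.+ w ℕ.* w)) refl) ⟩
        odd (4 ℕ.* (u ℕ.* u ℕ.+ 2 ℕ.* u ℕ.* w ℕ.+ w ℕ.* w)) ≡⟨ cong odd (trans (e u w) eq) ⟩
        odd (L ℕ.+ 4 ℕ.* (u ℕ.+ w) ℕ.* w)         ≡⟨ odd-+ L _ ⟩
        odd L xor odd (4 ℕ.* (u ℕ.+ w) ℕ.* w)     ≡⟨ cong₂ _xor_ odd-L (trans (cong odd (ℕₚ.*-assoc 4 (u ℕ.+ w) w)) (odd-* 4 ((u ℕ.+ w) ℕ.* w))) ⟩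
        true ∎))
        where
        false≢true : false ≡ true → ⊥
        false≢true ()
        e : ∀ u w → 4 ℕ.* (u ℕ.* u ℕ.+ 2 ℕ.* u ℕ.* w ℕ.+ w ℕ.* w) ≡ (u ℕ.+ (u ℕ.+ w) ℕ.+ w) ℕ.* (u ℕ.+ (u ℕ.+ w) ℕ.+ w)
        e = solve-∀ℕ

    F-vanishes : ∀ u v → Vanishes M (λ y → F u v (suc y))
    F-vanishes = F-y

    A B C : ℤ
    A = Σ³ (λ u y w → F (suc u) (suc u ℕ.+ suc y ℕ.+ suc w) (suc y))
    B = Σ³ (λ u t w → F (suc u) (suc u ℕ.+ suc t) (suc t ℕ.+ suc w))
    C = Σ³ (λ u s y → F (suc u ℕ.+ s) (suc u) (suc y))

    Σ³-peel : ∀ f → (∀ x z y → M ≤ z → f x z y ≡ 0ℤ) → (∀ x y → f x 0 y ≡ 0ℤ) →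
      Σ³ f ≡ Σ³ (λ x z y → f x (suc z) y)
    Σ³-peel f v f0 = Σ-cong M (λ x → trans (Σ-peel M (λ z M≤z → Σ-zero M (λ y → v x z y M≤z)))
      (trans (cong (_+ Σ< M (λ z → Σ< M (f x (suc z)))) (Σ-zero M (f0 x))) (ℤₚ.+-identityˡ _)))

    ΣF : ℤ
    ΣF = Σ³ (λ u v y → F (suc u) (suc v) (suc y))

    ΣH : ℤ
    ΣH = Σ³ (λ u v w → H (suc u) (suc v) (suc w))

    M≤+ : ∀ {z} t → M ≤ z → M ≤ z ℕ.+ t
    M≤+ t p = ℕₚ.≤-trans p (ℕₚ.m≤m+n _ t)

    private
      ar₁ : ∀ z y u → suc (suc (suc (z ℕ.+ y) ℕ.+ u)) ≡ suc u ℕ.+ suc y ℕ.+ suc z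
      ar₁ = solve-∀ℕ
      ar₂ : ∀ t u → suc (suc (t ℕ.+ u)) ≡ suc u ℕ.+ suc t
      ar₂ = solve-∀ℕ
      ar₃ : ∀ z t → suc (suc z ℕ.+ t) ≡ suc t ℕ.+ suc z
      ar₃ = solve-∀ℕ
      ar₄ : ∀ z t → suc (z ℕ.+ t) ≡ suc t ℕ.+ z
      ar₄ = solve-∀ℕ
      ar₅ : ∀ z w u → suc (suc z ℕ.+ suc w ℕ.+ u) ≡ suc u ℕ.+ suc z ℕ.+ suc w
      ar₅ = solve-∀ℕ

    ΣF≡ : ΣF ≡ A + B + C
    ΣF≡ = begin
      Σ³ (λ u v y → F (suc u) (suc v) (suc y))
        ≡⟨ trans (Σ³-swapʳ _) (trans (Σ³-swapˡ _) (Σ³-swapʳ _)) ⟩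
      Σ³ (λ y v u → F (suc u) (suc v) (suc y))
        ≡⟨ Σ³-split _ (λ y → (λ v u → F-v u v (suc y)) , (λ v u → F-u u v (suc y))) ⟩
      Σ³ (λ y t u → F (suc u) (suc (suc (t ℕ.+ u))) (suc y)) + Σ³ (λ y s v → F (suc (s ℕ.+ v)) (suc v) (suc y))
        ≡⟨ cong₂ _+_ (trans (Σ³-swapʳ _) (trans (Σ³-swapˡ _) (Σ³-swapʳ _)))
                     (trans (Σ³-swapʳ _) (trans (Σ³-swapˡ _) (Σ³-swapʳ _))) ⟩
      Σ³ (λ u t y → F (suc u) (suc (suc (t ℕ.+ u))) (suc y)) + Σ³ (λ v s y → F (suc (s ℕ.+ v)) (suc v) (suc y))
        ≡⟨ cong₂ _+_ (trans (Σ³-split _ (λ u → (λ t y M≤t → F-v u (suc (t ℕ.+ u)) (suc y) (ℕₚ.≤-trans M≤t (ℕₚ.≤-trans (ℕₚ.m≤m+n t u) (ℕₚ.n≤1+n _))))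
                                           , (λ t y → F-y (suc u) (suc (suc (t ℕ.+ u))) y)))
                       -- The splitting puts the diagonal y = v - u into the second half; it is the
                       -- layer z = 0, which is peeled off because it vanishes.
                       (cong₂ _+_ (Σ³-swapʳ _) (Σ³-peel _ (λ u z t M≤z → F-y (suc u) (suc (suc (t ℕ.+ u))) (z ℕ.+ t) (M≤+ t M≤z))
                          (λ u t → trans (cong (λ v → F (suc u) v (suc t)) (ar₂ t u)) (F-degenerate (suc u) (suc t))))))
                     (Σ³-cong (λ v s y → cong (λ x → F x (suc v) (suc y)) (ar₄ s v))) ⟩
      Σ³ (λ u y z → F (suc u) (suc (suc (suc (z ℕ.+ y) ℕ.+ u))) (suc y)) +
        Σ³ (λ u z t → F (suc u) (suc (suc (t ℕ.+ u))) (suc (suc z ℕ.+ t))) + C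
        ≡⟨ cong (_+ C) (cong₂ _+_ (Σ³-cong (λ u y z → cong (λ v → F (suc u) v (suc y)) (ar₁ z y u)))
             (trans (Σ³-swapʳ _) (Σ³-cong (λ u t z → cong₂ (F (suc u)) (ar₂ t u) (ar₃ z t))))) ⟩
      A + B + C ∎

    ΣH≡ : ΣH ≡ A + B + C
    ΣH≡ = begin
      Σ³ (λ u v w → H (suc u) (suc v) (suc w))
        ≡⟨ trans (Σ³-swapʳ _) (trans (Σ³-swapˡ _) (Σ³-swapʳ _)) ⟩
      Σ³ (λ w v u → H (suc u) (suc v) (suc w))
        ≡⟨ trans (Σ³-swapʳ _) (Σ³-split _ (λ w → (λ u v → H-u u (suc v) (suc w)) , (λ u v M≤v → H-v u (suc v) (suc w) (ℕₚ.m≤n⇒m≤1+n M≤v)))) ⟩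
      Σ³ (λ w t v → H (suc (suc (t ℕ.+ v))) (suc v) (suc w)) + Σ³ (λ w s u → H (suc u) (suc (s ℕ.+ u)) (suc w))
        ≡⟨ cong₂ _+_ (trans (Σ³-swapʳ _) (trans (Σ³-swapˡ _) (Σ³-swapʳ _)))
                     (trans (Σ³-swapʳ _) (trans (Σ³-swapˡ _) (Σ³-swapʳ _))) ⟩
      Σ³ (λ v t w → H (suc (suc (t ℕ.+ v))) (suc v) (suc w)) + Σ³ (λ u s w → H (suc u) (suc (s ℕ.+ u)) (suc w))
        ≡⟨ cong₂ _+_ (Σ³-cong (λ v t w → trans (cong (λ x → H x (suc v) (suc w)) (ar₂ t v)) (sym (F≡H₂ (suc v) (suc t) (suc w)))))
             (trans (Σ³-split _ (λ u → (λ s w M≤s → H-v u (suc (s ℕ.+ u)) (suc w) (ℕₚ.m≤n⇒m≤1+n (M≤+ u M≤s)))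
                                     , (λ s w M≤w → H-w u (suc (s ℕ.+ u)) (suc w) (ℕₚ.m≤n⇒m≤1+n M≤w))))
               (cong₂ _+_
                 (trans (trans (Σ³-cong (λ u z w → cong (λ s → H (suc u) (suc (s ℕ.+ u)) (suc w)) (sym (ℕₚ.+-suc z w))))
                          (Σ³-peel _ (λ u z w M≤z → H-v u (suc (z ℕ.+ suc w ℕ.+ u)) (suc w)
                                       (ℕₚ.m≤n⇒m≤1+n (M≤+ u (M≤+ (suc w) M≤z))))
                                     (λ u w → trans (cong (λ v → H (suc u) v (suc w)) (ar₄ (suc w) u)) (H-degenerate (suc u) (suc w)))))
                        (Σ³-cong (λ u z w → trans (cong (λ v → H (suc u) v (suc w)) (ar₅ z w u)) (sym (F≡H₁ (suc u) (suc z) (suc w))))))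
                 (trans (Σ³-swapʳ _) (Σ³-cong (λ u s z → trans (cong₂ (H (suc u)) (ar₄ s u) (trans (ar₄ z s) (sym (ℕₚ.+-suc s z))))
                                                 (sym (F≡H₃ (suc u) s (suc z)))))))) ⟩
      B + (A + C)
        ≡⟨ rotate B A C ⟩
      A + B + C ∎
      where
      rotate : ∀ b a c → b + (a + c) ≡ a + b + c
      rotate = solve-∀

    ΣH≡0 : ΣH ≡ 0ℤ
    ΣH≡0 = self-negative ΣH (begin
      ΣH                                              ≡⟨ Σ³-swapʳ _ ⟩
      Σ³ (λ u w v → H (suc u) (suc v) (suc w))        ≡⟨ Σ³-cong (λ u w v → antisym (suc u) (suc v) (suc w)) ⟩
      Σ³ (λ u w v → - 1ℤ * H (suc u) (suc w) (suc v)) ≡⟨ Σ-cong M (λ u → Σ-cong M (λ w → Σ-* M (- 1ℤ) _)) ⟩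
      Σ< M (λ u → Σ< M (λ w → - 1ℤ * Σ< M (λ v → H (suc u) (suc w) (suc v)))) ≡⟨ Σ-cong M (λ u → Σ-* M (- 1ℤ) _) ⟩
      Σ< M (λ u → - 1ℤ * Σ< M (λ w → Σ< M (λ v → H (suc u) (suc w) (suc v)))) ≡⟨ Σ-* M (- 1ℤ) _ ⟩
      - 1ℤ * ΣH ∎)
      where
      antisym : ∀ u v w → H u v w ≡ - 1ℤ * H u w v
      antisym u v w = trans (cong₂ (λ a b → δ (a ℕ.* a) (L ℕ.+ b) * (pos (u ℕ.+ v) * pos (u ℕ.+ w) * (pos v - pos w)))
          (e₁ u v w) (e₂ v w)) (e₃ (δ ((u ℕ.+ w ℕ.+ v) ℕ.* (u ℕ.+ w ℕ.+ v)) (L ℕ.+ 4 ℕ.* w ℕ.* v)) (pos (u ℕ.+ v)) (pos (u ℕ.+ w)) (pos v) (pos w))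
        where
        e₁ : ∀ u v w → u ℕ.+ v ℕ.+ w ≡ u ℕ.+ w ℕ.+ v
        e₁ = solve-∀ℕ
        e₂ : ∀ v w → 4 ℕ.* v ℕ.* w ≡ 4 ℕ.* w ℕ.* v
        e₂ = solve-∀ℕ
        e₃ : ∀ d x y v w → d * (x * y * (v - w)) ≡ - 1ℤ * (d * (y * x * (w - v)))
        e₃ = solve-∀
      self-negative : ∀ x → x ≡ - 1ℤ * x → x ≡ 0ℤ
      self-negative (pos zero)    eq = refl
      self-negative (pos (suc n)) ()
      self-negative (neg1+ n)     ()

    ΣF≡0 : ΣF ≡ 0ℤ
    ΣF≡0 = trans ΣF≡ (trans (sym ΣH≡) ΣH≡0)

  -- A recursion of Liouville type for the divisor sum

  halve : ∀ a → ∃[ b ] (a ≡ double b ⊎ a ≡ suc (double b))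
  halve zero    = 0 , inj₁ refl
  halve (suc a) with halve a
  ... | b , inj₁ refl = b , inj₂ refl
  ... | b , inj₂ refl = suc b , inj₁ refl

  odd-≢ : ∀ {a b} → odd a ≡ false → odd b ≡ true → a ≢ b
  odd-≢ ea ob refl with trans (sym ea) ob
  ... | ()

  δ-odd : ∀ {a b} (c : ℤ) → odd a ≡ false → odd b ≡ true → δ a b * c ≡ 0ℤ
  δ-odd {a} {b} c ea ob rewrite δ-≢ a b (odd-≢ ea ob) = ℤₚ.*-zeroˡ c

  δ-affine : ∀ a b → δ (suc (4 ℕ.* a)) (suc (4 ℕ.* b)) ≡ δ a b
  δ-affine a b with a ℕ.≟ b
  ... | yes refl = trans (δ-refl (4 ℕ.* a)) (sym (δ-refl a))
  ... | no a≢b = trans (δ-≢ _ _ (λ eq → a≢b (ℕₚ.*-cancelˡ-≡ a b 4 (ℕₚ.suc-injective eq)))) (sym (δ-≢ a b a≢b))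

  -- s x² + l x, in the shape in which eval produces it.
  term : ℕ → ℕ → ℕ → ℕ
  term s l x = x ℕ.* (s ℕ.* x ℕ.+ l ℕ.+ 0)

  pronic : ℕ → ℕ
  pronic = term 1 1

  pronic≡ : ∀ x → pronic x ≡ x ℕ.* suc x
  pronic≡ = expanded
    where
    expanded : ∀ x → x ℕ.* (1 ℕ.* x ℕ.+ 1 ℕ.+ 0) ≡ x ℕ.* suc x
    expanded = solve-∀ℕ

  odd-pronic : ∀ x → odd (pronic x) ≡ false
  odd-pronic x rewrite pronic≡ x | odd-* x (suc x) with odd x
  ... | true  = refl
  ... | false = refl

  x≤pronic : ∀ x → x ≤ pronic x
  x≤pronic x = subst (x ≤_) (sym (pronic≡ x)) (ℕₚ.m≤m*n x (suc x))

  side : ℕ → ℕ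
  side x = suc (double x)

  side² : ∀ x → side x ℕ.* side x ≡ suc (4 ℕ.* pronic x)
  side² x rewrite double≡2* x = e x
    where
    e : ∀ x → suc (2 ℕ.* x) ℕ.* suc (2 ℕ.* x) ≡ suc (4 ℕ.* (x ℕ.* (1 ℕ.* x ℕ.+ 1 ℕ.+ 0)))
    e = solve-∀ℕ

  -- The logarithmic derivative of ψ⁴ = (Σ q^{x(x+1)/2})⁴ gives the recursion with these weights.
  weight : ℕ → ℕ → ℤ
  weight k x = pos (suc (4 ℕ.* k)) - pos 5 * pos (side x ℕ.* side x)

  σ : ℕ → ℕ → ℤ
  σ N k = Σ< N (λ u → Σ< N (λ v → δ (suc u ℕ.* suc v) k * pos (suc v)))

  -- An odd square is 4b(b + 1) + 1, and b(b + 1) is even.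
  ¬square : ∀ k → odd k ≡ true → ∀ a → a ℕ.* a ≢ suc (4 ℕ.* k)
  ¬square k ok a eq with halve a
  ... | b , inj₁ refl = odd-≢ (trans (odd-* (double b) (double b)) (cong (_∧ odd (double b)) (odd-double b)))
          (cong not (odd-* 4 k)) eq
  ... | b , inj₂ refl = odd-≢ (odd-pronic b) ok
          (ℕₚ.*-cancelˡ-≡ (pronic b) k 4 (ℕₚ.suc-injective (trans (sym (side² b)) eq)))

  conv-flatten : ∀ {N} e w (g : ℕ → ℕ → ℕ) (c : ℕ → ℕ → ℤ) k → k < N →
    conv N e w (λ j → Σ< N (λ u → Σ< N (λ v → δ (g u v) j * c u v))) k ≡
    Σ< N (λ x → Σ< N (λ u → Σ< N (λ v → δ (e x ℕ.+ g u v) k * (w x * c u v))))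
  conv-flatten {N} e w g c k k<N = Σ-cong N (λ x → begin
    Σ< N (λ j → δ (e x ℕ.+ j) k * (w x * b j))
      ≡⟨ Σ-cong N (λ j → e₁ (δ (e x ℕ.+ j) k) (w x) (b j)) ⟩
    Σ< N (λ j → w x * (δ (e x ℕ.+ j) k * b j))
      ≡⟨ Σ-* N (w x) _ ⟩
    w x * Σ< N (λ j → δ (e x ℕ.+ j) k * b j)
      ≡⟨ cong (w x *_) (sym (box-conv 2 (λ { (u ∷ v ∷ []) → g u v }) (λ { (u ∷ v ∷ []) → c u v }) (e x) k k<N)) ⟩
    w x * Σ< N (λ u → Σ< N (λ v → δ (e x ℕ.+ g u v) k * c u v))
      ≡⟨ sym (Σ-* N (w x) _) ⟩
    Σ< N (λ u → w x * Σ< N (λ v → δ (e x ℕ.+ g u v) k * c u v))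
      ≡⟨ Σ-cong N (λ u → trans (sym (Σ-* N (w x) _)) (Σ-cong N (λ v → e₁ (w x) (δ (e x ℕ.+ g u v) k) (c u v)))) ⟩
    Σ< N (λ u → Σ< N (λ v → δ (e x ℕ.+ g u v) k * (w x * c u v))) ∎)
    where
    b : ℕ → ℤ
    b j = Σ< N (λ u → Σ< N (λ v → δ (g u v) j * c u v))
    e₁ : ∀ a b c → a * (b * c) ≡ b * (a * c)
    e₁ = solve-∀

  module _ {N k : ℕ} (k<N : k < N) (odd-k : odd k ≡ true) where

    private
      L M : ℕ
      L = suc (4 ℕ.* k)
      -- Exceeds L, as the windmills require, and is at least N, so that the sums over N extend to
      -- it.
      M = N ℕ.+ suc L

      odd-L : odd L ≡ true
      odd-L = cong not (odd-* 4 k)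

      N≤M : N ≤ M
      N≤M = ℕₚ.m≤m+n N (suc L)

      open Windmill L M (ℕₚ.m≤n+m (suc L) N) odd-L (¬square k odd-k)

      D : ℕ → ℕ → ℕ → ℤ
      D x u v = δ (pronic x ℕ.+ suc u ℕ.* suc v) k

      G : ℕ → ℕ → ℕ → ℤ
      G u v y = pos (suc u ℕ.+ suc v) * pos (suc u ℕ.+ y) * (pos (suc v) - pos y)

      D-zero : ∀ x u v (c : ℤ) z → N ≤ z → z ≤ pronic x ℕ.+ suc u ℕ.* suc v → D x u v * c ≡ 0ℤ
      D-zero x u v c z N≤z z≤ = trans (cong (_* c) (δ-> (ℕₚ.<-≤-trans k<N (ℕₚ.≤-trans N≤z z≤)))) (ℤₚ.*-zeroˡ c)

      D-x : ∀ x u v c → N ≤ x → D x u v * c ≡ 0ℤ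
      D-x x u v c p = D-zero x u v c x p (ℕₚ.≤-trans (x≤pronic x) (ℕₚ.m≤m+n _ _))

      D-u : ∀ x u v c → N ≤ u → D x u v * c ≡ 0ℤ
      D-u x u v c p = D-zero x u v c u p (ℕₚ.≤-trans (ℕₚ.n≤1+n u) (ℕₚ.≤-trans (ℕₚ.m≤m*n (suc u) (suc v)) (ℕₚ.m≤n+m _ (pronic x))))

      D-v : ∀ x u v c → N ≤ v → D x u v * c ≡ 0ℤ
      D-v x u v c p = D-zero x u v c v p (ℕₚ.≤-trans (ℕₚ.n≤1+n v) (ℕₚ.≤-trans (ℕₚ.m≤n*m (suc v) (suc u)) (ℕₚ.m≤n+m _ (pronic x))))

      F-odd : ∀ x u v → F (suc u) (suc v) (side x) ≡ D x u v * G u v (side x)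
      F-odd x u v = cong (_* G u v (side x)) (trans (cong (λ z → δ z L) (trans (cong (4 ℕ.* suc u ℕ.* suc v ℕ.+_) (side² x))
        (e (suc u) (suc v) (pronic x)))) (δ-affine (pronic x ℕ.+ suc u ℕ.* suc v) k))
        where
        e : ∀ u v p → 4 ℕ.* u ℕ.* v ℕ.+ suc (4 ℕ.* p) ≡ suc (4 ℕ.* (p ℕ.+ u ℕ.* v))
        e = solve-∀ℕ

      F-even : ∀ x u v → F (suc u) (suc v) (suc (side x)) ≡ 0ℤ
      F-even x u v = δ-odd {4 ℕ.* suc u ℕ.* suc v ℕ.+ suc (side x) ℕ.* suc (side x)} {L} (G u v (suc (side x)))
        (trans (odd-+ (4 ℕ.* suc u ℕ.* suc v) (suc (side x) ℕ.* suc (side x))) (cong₂ _xor_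
          (trans (cong odd (ℕₚ.*-assoc 4 (suc u) (suc v))) (odd-* 4 (suc u ℕ.* suc v)))
          (trans (odd-* (suc (side x)) (suc (side x))) (cong (_∧ odd (suc (side x))) (odd-double (suc x)))))) odd-L

      S : ℤ
      S = Σ< N (λ x → Σ< N (λ u → Σ< N (λ v → D x u v * G u v (side x))))

      -- In 4uv + y² = 4k + 1 every y is odd. With y = 2x + 1 the equation becomes uv + x(x + 1) =
      -- k, so this is the windmill sum with the empty terms of even y discarded.
      S≡0 : S ≡ 0ℤ
      S≡0 = begin
        S ≡⟨ Σ-comm N N _ ⟩
        Σ< N (λ u → Σ< N (λ x → Σ< N (λ v → D x u v * G u v (side x))))
          ≡⟨ Σ-cong N (λ u → Σ-comm N N _) ⟩
        Σ< N (λ u → Σ< N (λ v → Σ< N (λ x → D x u v * G u v (side x))))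
          ≡⟨ Σ-cong N (λ u → Σ-cong N (λ v → sym (Σ-extend N≤M (λ x p → D-x x u v _ p)))) ⟩
        Σ< N (λ u → Σ< N (λ v → Σ< M (λ x → D x u v * G u v (side x))))
          ≡⟨ Σ-cong N (λ u → sym (Σ-extend N≤M (λ v p → Σ-zero M (λ x → D-v x u v _ p)))) ⟩
        Σ< N (λ u → Σ< M (λ v → Σ< M (λ x → D x u v * G u v (side x))))
          ≡⟨ sym (Σ-extend N≤M (λ u p → Σ-zero M (λ v → Σ-zero M (λ x → D-u x u v _ p)))) ⟩
        Σ< M (λ u → Σ< M (λ v → Σ< M (λ x → D x u v * G u v (side x))))
          ≡⟨ Σ-cong M (λ u → Σ-cong M (λ v → sym (begin
               Σ< M (λ y → F (suc u) (suc v) (suc y))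
                 ≡⟨ Σ-parity M (λ y p → F-vanishes (suc u) (suc v) y p) ⟩
               Σ< M (λ x → F (suc u) (suc v) (side x)) + Σ< M (λ x → F (suc u) (suc v) (suc (side x)))
                 ≡⟨ cong₂ _+_ (Σ-cong M (λ x → F-odd x u v)) (Σ-zero M (λ x → F-even x u v)) ⟩
               Σ< M (λ x → D x u v * G u v (side x)) + 0ℤ
                 ≡⟨ ℤₚ.+-identityʳ _ ⟩
               Σ< M (λ x → D x u v * G u v (side x)) ∎))) ⟩
        ΣF ≡⟨ ΣF≡0 ⟩
        0ℤ ∎

      Σ³N : (ℕ → ℕ → ℕ → ℤ) → ℤ
      Σ³N f = Σ< N (λ x → Σ< N (λ u → Σ< N (λ v → f x u v)))

      Σ³N-cong : ∀ {f g} → (∀ x u v → f x u v ≡ g x u v) → Σ³N f ≡ Σ³N g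
      Σ³N-cong eq = Σ-cong N (λ x → Σ-cong N (λ u → Σ-cong N (λ v → eq x u v)))

      Σ³N-+ : ∀ f g → Σ³N (λ x u v → f x u v + g x u v) ≡ Σ³N f + Σ³N g
      Σ³N-+ f g = trans (Σ-cong N (λ x → trans (Σ-cong N (λ u → Σ-+ N _ _)) (Σ-+ N _ _))) (Σ-+ N _ _)

      Σ³N-swap : ∀ f → Σ³N f ≡ Σ³N (λ x v u → f x u v)
      Σ³N-swap f = Σ-cong N (λ x → Σ-comm N N (f x))

      D-sym : ∀ x u v → D x u v ≡ D x v u
      D-sym x u v = cong (λ z → δ (pronic x ℕ.+ z) k) (ℕₚ.*-comm (suc u) (suc v))

      V : ℤ
      V = Σ³N (λ x u v → D x u v * (weight k x * pos (suc v)))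

      -- On the support 4k + 1 = 4uv + y² with y = `side x`, which turns 4k + 1 - 5y² into 4(uv -
      -- y²).
      V≡ : V ≡ Σ³N (λ x u v → D x u v * (pos 4 * (pos (suc u) * pos (suc v) - pos (side x ℕ.* side x)) * pos (suc v)))
      V≡ = Σ³N-cong (λ x u v → trans
        (sym (δ-replace {pronic x ℕ.+ suc u ℕ.* suc v} {k} (λ j → weight j x * pos (suc v))))
        (cong (λ z → D x u v * (z * pos (suc v))) (weight≡ x u v)))
        where
        e : ∀ s u v → 1ℤ + pos 4 * s + pos 4 * (u * v) - pos 5 * (1ℤ + pos 4 * s) ≡ pos 4 * (u * v - (1ℤ + pos 4 * s))
        e = solve-∀
        weight≡ : ∀ x u v → weight (pronic x ℕ.+ suc u ℕ.* suc v) x ≡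
          pos 4 * (pos (suc u) * pos (suc v) - pos (side x ℕ.* side x))
        weight≡ x u v = begin
          pos (suc (4 ℕ.* (pronic x ℕ.+ suc u ℕ.* suc v))) - pos 5 * pos (side x ℕ.* side x)
            ≡⟨ cong₂ (λ a b → pos a - pos 5 * pos b) (cong suc (ℕₚ.*-distribˡ-+ 4 (pronic x) (suc u ℕ.* suc v))) (side² x) ⟩
          1ℤ + pos (4 ℕ.* pronic x) + pos (4 ℕ.* (suc u ℕ.* suc v)) - pos 5 * (1ℤ + pos (4 ℕ.* pronic x))
            ≡⟨ cong₂ (λ a b → 1ℤ + a + b - pos 5 * (1ℤ + a)) (ℤₚ.pos-* 4 (pronic x))
                 (trans (ℤₚ.pos-* 4 (suc u ℕ.* suc v)) (cong (pos 4 *_) (ℤₚ.pos-* (suc u) (suc v)))) ⟩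
          1ℤ + pos 4 * pos (pronic x) + pos 4 * (pos (suc u) * pos (suc v)) - pos 5 * (1ℤ + pos 4 * pos (pronic x))
            ≡⟨ e (pos (pronic x)) (pos (suc u)) (pos (suc v)) ⟩
          pos 4 * (pos (suc u) * pos (suc v) - (1ℤ + pos 4 * pos (pronic x)))
            ≡⟨ cong (λ z → pos 4 * (pos (suc u) * pos (suc v) - z)) (trans (cong (1ℤ +_) (sym (ℤₚ.pos-* 4 (pronic x)))) (cong pos (sym (side² x)))) ⟩
          pos 4 * (pos (suc u) * pos (suc v) - pos (side x ℕ.* side x)) ∎

      -- Symmetrising in u and v: (u + v)(u + y)(v - y) + (v + u)(v + y)(u - y) = 2(u + v)(uv - y²).
      -- The factor u + v splits into two halves that are equal by symmetry, and one of them is the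
      -- divisor sum.
      double-V : V + V ≡ (S + S) + (S + S)
      double-V = begin
        V + V
          ≡⟨ cong₂ _+_ V≡ (trans V≡ (Σ³N-swap _)) ⟩
        Σ³N (λ x u v → D x u v * (pos 4 * (pos (suc u) * pos (suc v) - pos (side x ℕ.* side x)) * pos (suc v))) +
        Σ³N (λ x v u → D x u v * (pos 4 * (pos (suc u) * pos (suc v) - pos (side x ℕ.* side x)) * pos (suc v)))
          ≡⟨ sym (Σ³N-+ _ _) ⟩
        Σ³N (λ x u v → D x u v * (pos 4 * (pos (suc u) * pos (suc v) - pos (side x ℕ.* side x)) * pos (suc v)) +
                       D x v u * (pos 4 * (pos (suc v) * pos (suc u) - pos (side x ℕ.* side x)) * pos (suc u)))
          ≡⟨ Σ³N-cong (λ x u v → trans (cong₂ (λ d s → D x u v * (pos 4 * (pos (suc u) * pos (suc v) - s) * pos (suc v)) +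
                 d * (pos 4 * (pos (suc v) * pos (suc u) - s) * pos (suc u))) (sym (D-sym x u v)) (ℤₚ.pos-* (side x) (side x)))
               (trans (e (D x u v) (pos (suc u)) (pos (suc v)) (pos (side x)))
                      (cong (λ d → (D x u v * G u v (side x) + D x u v * G u v (side x)) + (d * G v u (side x) + d * G v u (side x))) (D-sym x u v)))) ⟩
        Σ³N (λ x u v → (D x u v * G u v (side x) + D x u v * G u v (side x)) + (D x v u * G v u (side x) + D x v u * G v u (side x)))
          ≡⟨ Σ³N-+ _ _ ⟩
        Σ³N (λ x u v → D x u v * G u v (side x) + D x u v * G u v (side x)) + Σ³N (λ x u v → D x v u * G v u (side x) + D x v u * G v u (side x))
          ≡⟨ cong₂ _+_ (Σ³N-+ _ _) (trans (Σ³N-+ _ _) (cong₂ _+_ (Σ³N-swap _) (Σ³N-swap _))) ⟩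
        (S + S) + (S + S) ∎
        where
        e : ∀ d u v y → d * (pos 4 * (u * v - y * y) * v) + d * (pos 4 * (v * u - y * y) * u) ≡
          (d * ((u + v) * (u + y) * (v - y)) + d * ((u + v) * (u + y) * (v - y))) +
          (d * ((v + u) * (v + y) * (u - y)) + d * ((v + u) * (v + y) * (u - y)))
        e = solve-∀

      V≡0 : V ≡ 0ℤ
      V≡0 = half (trans double-V (cong (λ s → (s + s) + (s + s)) S≡0))
        where
        half : ∀ {v} → v + v ≡ 0ℤ → v ≡ 0ℤ
        half {pos zero}    eq = refl
        half {pos (suc _)} ()
        half {neg1+ _}     ()

    σ-recursion : conv N pronic (weight k) (σ N) k ≡ 0ℤ
    σ-recursion = trans (conv-flatten pronic (weight k) (λ u v → suc u ℕ.* suc v) (λ u v → pos (suc v)) k k<N) V≡0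

  -- The divisor sum as a count of lattice points

  staircase : ∀ M R (G : ℕ → ℤ) → M ≤ R → Vanishes M G →
    Σ< M (λ y → pos y * G y) ≡ Σ< M (λ j → Σ< R (λ z → G (suc (z ℕ.+ j))))
  staircase zero    R G M≤R v = refl
  staircase (suc M) R G M<R v = begin
    0ℤ * G 0 + Σ< M (λ y → pos (suc y) * G (suc y))
      ≡⟨ trans (cong (_+ Σ< M (λ y → pos (suc y) * G (suc y))) (ℤₚ.*-zeroˡ (G 0))) (ℤₚ.+-identityˡ _) ⟩
    Σ< M (λ y → pos (suc y) * G (suc y))
      ≡⟨ trans (Σ-cong M (λ y → e (pos y) (G (suc y)))) (Σ-+ M _ _) ⟩
    Σ< M (λ y → G (suc y)) + Σ< M (λ y → pos y * G (suc y))
      ≡⟨ cong₂ _+_ (sym (Σ-extend (ℕₚ.<⇒≤ M<R) v′)) (staircase M R (λ y → G (suc y)) (ℕₚ.<⇒≤ M<R) v′) ⟩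
    Σ< R (λ z → G (suc z)) + Σ< M (λ j → Σ< R (λ z → G (suc (suc (z ℕ.+ j)))))
      ≡⟨ sym (cong₂ _+_ (Σ-cong R (λ z → cong (λ w → G (suc w)) (ℕₚ.+-identityʳ z)))
                        (Σ-cong M (λ j → Σ-cong R (λ z → cong (λ w → G (suc w)) (ℕₚ.+-suc z j))))) ⟩
    Σ< (suc M) (λ j → Σ< R (λ z → G (suc (z ℕ.+ j)))) ∎
    where
    v′ : Vanishes M (λ y → G (suc y))
    v′ y p = v (suc y) (s≤s p)
    e : ∀ y g → (1ℤ + y) * g ≡ g + y * g
    e = solve-∀

  -- (2x + 1)(2y + 1) and (2x + 1)(2y + 2z + 3)
  rectangle : Quad 2
  rectangle = quad 0 2 (4 ∷ []) (quad 0 2 [] (con 1))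

  staircases : Quad 3
  staircases = quad 0 6 (4 ∷ 4 ∷ []) (quad 0 2 (0 ∷ []) (quad 0 2 [] (con 3)))

  eval-rectangle : ∀ x y → eval rectangle (x ∷ y ∷ []) ≡ side x ℕ.* side y
  eval-rectangle x y rewrite double≡2* x | double≡2* y = e x y
    where
    e : ∀ x y → x ℕ.* (0 ℕ.* x ℕ.+ 2 ℕ.+ (4 ℕ.* y ℕ.+ 0)) ℕ.+ (y ℕ.* (0 ℕ.* y ℕ.+ 2 ℕ.+ 0) ℕ.+ 1)
      ≡ suc (2 ℕ.* x) ℕ.* suc (2 ℕ.* y)
    e = solve-∀ℕ

  eval-staircases : ∀ x y z → eval staircases (x ∷ y ∷ z ∷ []) ≡ side x ℕ.* side (suc (z ℕ.+ y))
  eval-staircases x y z rewrite double≡2* x | double≡2* (z ℕ.+ y) = e x y z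
    where
    e : ∀ x y z → x ℕ.* (0 ℕ.* x ℕ.+ 6 ℕ.+ (4 ℕ.* y ℕ.+ (4 ℕ.* z ℕ.+ 0))) ℕ.+
         (y ℕ.* (0 ℕ.* y ℕ.+ 2 ℕ.+ (0 ℕ.* z ℕ.+ 0)) ℕ.+ (z ℕ.* (0 ℕ.* z ℕ.+ 2 ℕ.+ 0) ℕ.+ 3))
      ≡ suc (2 ℕ.* x) ℕ.* suc (suc (suc (2 ℕ.* (z ℕ.+ y))))
    e = solve-∀ℕ

  divisorSum : ℕ → ℕ → ℤ
  divisorSum N k = count N rectangle k + pos 2 * count N staircases k

  -- Certificates handle only unweighted counts, so the weight of a divisor has to become a number
  -- of points. Divisors of an odd k are odd, and 2y + 1 is 1 plus twice the number of pairs (j, z)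
  -- with j + z + 1 = y.
  σ≡divisorSum : ∀ {N} k → k < N → odd k ≡ true → σ N k ≡ divisorSum N k
  σ≡divisorSum {N} k k<N odd-k = begin
    Σ< N (λ u → Σ< N (λ v → f (suc u) (suc v)))
      ≡⟨ Σ-parity N (λ u p → Σ-zero N (λ v → f-big (suc u) (suc v) u p (ℕₚ.≤-trans (ℕₚ.n≤1+n u) (ℕₚ.m≤m*n (suc u) (suc v))))) ⟩
    Σ< N (λ x → Σ< N (λ v → f (side x) (suc v))) + Σ< N (λ x → Σ< N (λ v → f (suc (side x)) (suc v)))
      ≡⟨ trans (cong₂ _+_ (Σ-cong N row) (Σ-zero N (λ x → Σ-zero N (λ v → f-even (suc (side x)) (suc v)
           (trans (odd-* (suc (side x)) (suc v)) (cong (_∧ odd (suc v)) (odd-double (suc x))))))))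
         (ℤₚ.+-identityʳ _) ⟩
    Σ< N (λ x → Σ< N (λ y → δ (eval rectangle (x ∷ y ∷ [])) k) +
                pos 2 * Σ< N (λ y → Σ< N (λ z → δ (eval staircases (x ∷ y ∷ z ∷ [])) k)))
      ≡⟨ trans (Σ-+ N _ _) (cong (count N rectangle k +_) (Σ-* N (pos 2) _)) ⟩
    divisorSum N k ∎
    where
    f : ℕ → ℕ → ℤ
    f a b = δ (a ℕ.* b) k * pos b
    f-big : ∀ a b z → N ≤ z → z ≤ a ℕ.* b → f a b ≡ 0ℤ
    f-big a b z N≤z z≤ = trans (cong (_* pos b) (δ-> (ℕₚ.<-≤-trans k<N (ℕₚ.≤-trans N≤z z≤)))) (ℤₚ.*-zeroˡ (pos b))
    f-even : ∀ a b → odd (a ℕ.* b) ≡ false → f a b ≡ 0ℤ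
    f-even a b ev = δ-odd {a ℕ.* b} {k} (pos b) ev odd-k
    g : ℕ → ℕ → ℤ
    g x y = δ (side x ℕ.* side y) k
    expand : ∀ x y → f (side x) (side y) ≡ g x y + pos 2 * (pos y * g x y)
    expand x y = trans (cong (λ z → g x y * (1ℤ + pos z)) (double≡2* y))
      (trans (cong (λ z → g x y * (1ℤ + z)) (ℤₚ.pos-* 2 y)) (e (g x y) (pos y)))
      where
      e : ∀ g y → g * (1ℤ + pos 2 * y) ≡ g + pos 2 * (y * g)
      e = solve-∀
    row : ∀ x → Σ< N (λ v → f (side x) (suc v)) ≡ Σ< N (λ y → δ (eval rectangle (x ∷ y ∷ [])) k) +
                pos 2 * Σ< N (λ y → Σ< N (λ z → δ (eval staircases (x ∷ y ∷ z ∷ [])) k))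
    row x = begin
      Σ< N (λ v → f (side x) (suc v))
        ≡⟨ Σ-parity N (λ v p → f-big (side x) (suc v) v p (ℕₚ.≤-trans (ℕₚ.n≤1+n v) (ℕₚ.m≤n*m (suc v) (side x)))) ⟩
      Σ< N (λ y → f (side x) (side y)) + Σ< N (λ y → f (side x) (suc (side y)))
        ≡⟨ trans (cong₂ _+_ (Σ-cong N (expand x)) (Σ-zero N (λ y → f-even (side x) (suc (side y))
             (trans (odd-* (side x) (suc (side y))) (trans (cong (odd (side x) ∧_) (odd-double (suc y))) (∧-false (odd (side x))))))))
           (ℤₚ.+-identityʳ _) ⟩
      Σ< N (λ y → g x y + pos 2 * (pos y * g x y))
        ≡⟨ trans (Σ-+ N _ _) (cong (Σ< N (g x) +_) (Σ-* N (pos 2) _)) ⟩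
      Σ< N (g x) + pos 2 * Σ< N (λ y → pos y * g x y)
        ≡⟨ cong₂ (λ a b → a + pos 2 * b) (Σ-cong N (λ y → cong (λ v → δ v k) (sym (eval-rectangle x y))))
             (trans (staircase N N (g x) ℕₚ.≤-refl (λ y p → δ-> (ℕₚ.<-≤-trans k<N (ℕₚ.≤-trans p
                (ℕₚ.≤-trans (n≤double y) (ℕₚ.≤-trans (ℕₚ.n≤1+n _) (ℕₚ.m≤n*m (side y) (side x))))))))
               (Σ-cong N (λ j → Σ-cong N (λ z → cong (λ v → δ v k) (sym (eval-staircases x j z)))))) ⟩
      _ ∎
      where
      ∧-false : ∀ b → b ∧ false ≡ false
      ∧-false true  = refl
      ∧-false false = refl

  -- Sums of four odd squares

  fourPronics : Quad 4
  fourPronics = quad 1 1 (0 ∷ 0 ∷ 0 ∷ []) (quad 1 1 (0 ∷ 0 ∷ []) (quad 1 1 (0 ∷ []) (quad 1 1 [] (con 1))))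

  total : ∀ {n} → Vec ℕ n → ℕ
  total []       = 1
  total (x ∷ xs) = pronic x ℕ.+ total xs

  -- With the convolution variable there are five odd squares, whose sum on the support is 4k + 1.
  -- So the weight 4k + 1 - 5a² equals b² + c² + d² + e² - 4a², which sums to zero because the five
  -- variables are interchangeable.
  fourPronics-recursion : ∀ {N} k → k < N → conv N pronic (weight k) (count N fourPronics) k ≡ 0ℤ
  fourPronics-recursion {N} k k<N = begin
    conv N pronic (weight k) (count N fourPronics) k
      ≡⟨ Σ-cong N (λ x → begin
           Σ< N (λ j → δ (pronic x ℕ.+ j) k * (weight k x * count N fourPronics j))
             ≡⟨ Σ-cong N (λ j → cong (δ (pronic x ℕ.+ j) k *_) (trans (sym (box-* N 4 (weight k x) (λ xs → δ (eval fourPronics xs) j)))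
                  (box-cong N 4 (λ xs → ℤₚ.*-comm (weight k x) (δ (eval fourPronics xs) j))))) ⟩
           Σ< N (λ j → δ (pronic x ℕ.+ j) k * box N 4 (λ xs → δ (eval fourPronics xs) j * weight k x))
             ≡⟨ sym (box-conv 4 (eval fourPronics) (λ _ → weight k x) (pronic x) k k<N) ⟩
           box N 4 (λ xs → δ (pronic x ℕ.+ eval fourPronics xs) k * weight k x) ∎) ⟩
    box N 5 lhs
      ≡⟨ box-cong N 5 balance ⟩
    box N 5 (λ xs → (f 1 xs + f 2 xs) + (f 3 xs + f 4 xs) + - pos 4 * f 0 xs)
      ≡⟨ trans (box-+ N 5 (λ xs → (f 1 xs + f 2 xs) + (f 3 xs + f 4 xs)) (λ xs → - pos 4 * f 0 xs)) (cong₂ _+_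
           (trans (box-+ N 5 (λ xs → f 1 xs + f 2 xs) (λ xs → f 3 xs + f 4 xs)) (cong₂ _+_ (box-+ N 5 (f 1) (f 2)) (box-+ N 5 (f 3) (f 4))))
           (box-* N 5 (- pos 4) (f 0))) ⟩
    (U 1 + U 2) + (U 3 + U 4) + - pos 4 * U 0
      ≡⟨ cong₂ (λ a b → a + b + - pos 4 * U 0) (cong₂ _+_ u₁ u₂) (cong₂ _+_ u₃ u₄) ⟩
    (U 0 + U 0) + (U 0 + U 0) + - pos 4 * U 0
      ≡⟨ e (U 0) ⟩
    0ℤ ∎
    where
    e : ∀ u → (u + u) + (u + u) + - pos 4 * u ≡ 0ℤ
    e = solve-∀
    lhs : Vec ℕ 5 → ℤ
    lhs (x ∷ xs) = δ (pronic x ℕ.+ eval fourPronics xs) k * weight k x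
    at : ∀ {n} → ℕ → Vec ℕ n → ℕ
    at _       []       = 0
    at zero    (x ∷ xs) = side x ℕ.* side x
    at (suc i) (x ∷ xs) = at i xs
    f : ℕ → Vec ℕ 5 → ℤ
    f i xs = δ (total xs) k * pos (at i xs)
    U : ℕ → ℤ
    U i = box N 5 (f i)
    total-swap : ∀ {n} i (xs : Vec ℕ n) → total (swapVec i xs) ≡ total xs
    total-swap zero    []           = refl
    total-swap zero    (x ∷ [])     = refl
    total-swap zero    (x ∷ y ∷ xs) = begin
      pronic y ℕ.+ (pronic x ℕ.+ total xs) ≡⟨ sym (ℕₚ.+-assoc (pronic y) (pronic x) (total xs)) ⟩
      pronic y ℕ.+ pronic x ℕ.+ total xs   ≡⟨ cong (ℕ._+ total xs) (ℕₚ.+-comm (pronic y) (pronic x)) ⟩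
      pronic x ℕ.+ pronic y ℕ.+ total xs   ≡⟨ ℕₚ.+-assoc (pronic x) (pronic y) (total xs) ⟩
      pronic x ℕ.+ (pronic y ℕ.+ total xs) ∎
    total-swap (suc i) []       = refl
    total-swap (suc i) (x ∷ xs) = cong (pronic x ℕ.+_) (total-swap i xs)
    step : ∀ i → (∀ xs → at (suc i) (swapVec i xs) ≡ at i xs) → U (suc i) ≡ U i
    step i eq = trans (sym (box-swapVec N i (f (suc i))))
      (box-cong N 5 (λ xs → cong₂ (λ t s → δ t k * pos s) (total-swap i xs) (eq xs)))
    u₁ : U 1 ≡ U 0
    u₁ = step 0 (λ { (a ∷ b ∷ c ∷ d ∷ e ∷ []) → refl })
    u₂ : U 2 ≡ U 0
    u₂ = trans (step 1 (λ { (a ∷ b ∷ c ∷ d ∷ e ∷ []) → refl })) u₁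
    u₃ : U 3 ≡ U 0
    u₃ = trans (step 2 (λ { (a ∷ b ∷ c ∷ d ∷ e ∷ []) → refl })) u₂
    u₄ : U 4 ≡ U 0
    u₄ = trans (step 3 (λ { (a ∷ b ∷ c ∷ d ∷ e ∷ []) → refl })) u₃
    balance : ∀ xs → lhs xs
      ≡ (f 1 xs + f 2 xs) + (f 3 xs + f 4 xs) + - pos 4 * f 0 xs
    balance xs@(a ∷ b ∷ c ∷ d ∷ e ∷ []) = begin
      δ (total xs) k * weight k a            ≡⟨ sym (δ-replace {total xs} {k} (λ j → weight j a)) ⟩
      δ (total xs) k * weight (total xs) a   ≡⟨ cong (λ s → δ (total xs) k * (pos s - pos 5 * pos (at 0 xs))) squares ⟩
      δ (total xs) k * (pos (at 0 xs) + pos (at 1 xs) + pos (at 2 xs) + pos (at 3 xs) + pos (at 4 xs) - pos 5 * pos (at 0 xs))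
        ≡⟨ dist (δ (total xs) k) (pos (at 0 xs)) (pos (at 1 xs)) (pos (at 2 xs)) (pos (at 3 xs)) (pos (at 4 xs)) ⟩
      _ ∎
      where
      dist : ∀ d a b c x y → d * (a + b + c + x + y - pos 5 * a) ≡
        (d * b + d * c) + (d * x + d * y) + - pos 4 * (d * a)
      dist = solve-∀
      squares : suc (4 ℕ.* total xs) ≡ side a ℕ.* side a ℕ.+ side b ℕ.* side b ℕ.+ side c ℕ.* side c ℕ.+ side d ℕ.* side d ℕ.+ side e ℕ.* side e
      squares = trans (q (pronic a) (pronic b) (pronic c) (pronic d) (pronic e))
        (sym (cong₂ ℕ._+_ (cong₂ ℕ._+_ (cong₂ ℕ._+_ (cong₂ ℕ._+_ (side² a) (side² b)) (side² c)) (side² d)) (side² e)))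
        where
        q : ∀ a b c d e → suc (4 ℕ.* (a ℕ.+ (b ℕ.+ (c ℕ.+ (d ℕ.+ (e ℕ.+ 1)))))) ≡
          suc (4 ℕ.* a) ℕ.+ suc (4 ℕ.* b) ℕ.+ suc (4 ℕ.* c) ℕ.+ suc (4 ℕ.* d) ℕ.+ suc (4 ℕ.* e)
        q = solve-∀ℕ

  constant : ∀ {n} → Quad n → ℕ
  constant (con c)        = c
  constant (quad _ _ _ q) = constant q

  constant≤eval : ∀ {n} (q : Quad n) xs → constant q ≤ eval q xs
  constant≤eval (con c)         []       = ℕₚ.≤-refl
  constant≤eval (quad s l ms q) (x ∷ xs) = ℕₚ.≤-trans (constant≤eval q xs) (ℕₚ.m≤n+m _ _)

  -- Points with x₀ ≥ 1 have a value of at least the constant term of the shifted form, which is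
  -- beyond k.
  count-origin : ∀ {N n} (q : Quad (suc n)) k → k < N → Grows q → k < constant (shift q) →
    count N q k ≡ count N (tail q) k
  count-origin {N} {n} q k k<N g k<c = trans (count-peel q k k<N g)
    (trans (cong (count N (tail q) k +_) (box-zero N (suc n) (λ xs → δ-> (ℕₚ.<-≤-trans k<c (constant≤eval (shift q) xs)))))
           (ℤₚ.+-identityʳ _))

  fourPronics-1 : ∀ {N} → 1 < N → count N fourPronics 1 ≡ 1ℤ
  fourPronics-1 {N} 1<N = trans (count-origin fourPronics 1 1<N tt 1<3) (trans (count-origin (tail fourPronics) 1 1<N tt 1<3)
    (trans (count-origin (tail (tail fourPronics)) 1 1<N tt 1<3) (count-origin (tail (tail (tail fourPronics))) 1 1<N tt 1<3)))
    where
    1<3 : 1 < 3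
    1<3 = s≤s (s≤s z≤n)

  divisorSum-1 : ∀ {N} → 1 < N → divisorSum N 1 ≡ 1ℤ
  divisorSum-1 {N} 1<N = cong₂ (λ a b → a + pos 2 * b)
    (trans (count-origin rectangle 1 1<N tt 1<3) (count-origin (tail rectangle) 1 1<N tt 1<3))
    (box-zero N 3 (λ xs → δ-> (ℕₚ.<-≤-trans 1<3 (constant≤eval staircases xs))))
    where
    1<3 : 1 < 3
    1<3 = s≤s (s≤s z≤n)

  -- Jacobi's theorem for odd k: 4k is a sum of squares of four positive odd numbers in σ(k) ways.
  -- Both sides satisfy the same recursion, and at k = 1, where its leading coefficient vanishes,
  -- both equal 1.
  fourPronics≡divisorSum : ∀ {N} k → odd k ≡ true → k < N → count N fourPronics k ≡ divisorSum N k
  fourPronics≡divisorSum {N} k odd-k k<N = difference (conv-determines pronic weight (λ _ _ → 0ℤ) h refl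
      (λ x → ℕₚ.<-≤-trans (s≤s z≤n) (x≤pronic (suc x))) odd-pronic base recursion k odd-k k<N)
    where
    h : ℕ → ℤ
    h j = count N fourPronics j + - 1ℤ * divisorSum N j
    difference : ∀ {a b} → a + - 1ℤ * b ≡ 0ℤ → a ≡ b
    difference {a} {b} eq = trans (e a b) (trans (cong (_+ b) eq) (ℤₚ.+-identityˡ b))
      where
      e : ∀ a b → a ≡ a + - 1ℤ * b + b
      e = solve-∀
    base : ∀ k → odd k ≡ true → k < N → weight k 0 ≡ 0ℤ → h k ≡ 0ℤ
    base (suc zero)    ok k<N w = cong₂ (λ a b → a + - 1ℤ * b) (fourPronics-1 k<N) (divisorSum-1 k<N)
    base (suc (suc k)) ok k<N w = ⊥-elim (positive k (trans (sym (cong (λ z → pos (suc z) - pos 5) (ℕₚ.*-distribˡ-+ 4 2 k))) w))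
      where
      positive : ∀ k → pos (suc (8 ℕ.+ 4 ℕ.* k)) - pos 5 ≡ 0ℤ → ⊥
      positive k ()
    recursion : ∀ k → odd k ≡ true → k < N →
      conv N pronic (weight k) h k + conv N (λ x → pronic (suc x)) (λ _ → 0ℤ) h k ≡ 0ℤ
    recursion k ok k<N = cong₂ _+_
      (begin
        conv N pronic (weight k) h k
          ≡⟨ conv-+ N pronic (weight k) _ _ k ⟩
        conv N pronic (weight k) (count N fourPronics) k + conv N pronic (weight k) (λ j → - 1ℤ * divisorSum N j) k
          ≡⟨ cong₂ _+_ (fourPronics-recursion k k<N) (trans (conv-* N pronic (weight k) (- 1ℤ) _ k) (cong (- 1ℤ *_)
               (trans (sym (conv-cong N pronic (weight k) k (λ x j eq → σ≡divisorSum j (ℕₚ.≤-<-trans (subst (j ≤_) eq (ℕₚ.m≤n+m j _)) k<N)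
                         (odd-rest (pronic x) j (odd-pronic x) eq ok)))) (σ-recursion k<N ok)))) ⟩
        0ℤ ∎)
      (Σ-zero N (λ x → Σ-zero N (λ j → trans (cong (δ (pronic (suc x) ℕ.+ j) k *_) (ℤₚ.*-zeroˡ (h j))) (ℤₚ.*-zeroʳ (δ (pronic (suc x) ℕ.+ j) k)))))

  -- Certificates for the convolved counts

  form₂ : ℕ → ℕ → ℕ → ℕ → ℕ → ℕ → Form
  form₂ c l₀ l₁ s₀ s₁ m₀₁ = 2 , quad s₀ l₀ (m₀₁ ∷ []) (quad s₁ l₁ [] (con c))
  form₃ : ℕ → ℕ → ℕ → ℕ → ℕ → ℕ → ℕ → ℕ → ℕ → ℕ → Form
  form₃ c l₀ l₁ l₂ s₀ s₁ s₂ m₀₁ m₀₂ m₁₂ =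
    3 , quad s₀ l₀ (m₀₁ ∷ m₀₂ ∷ []) (quad s₁ l₁ (m₁₂ ∷ []) (quad s₂ l₂ [] (con c)))
  form₄ : ℕ → ℕ → ℕ → ℕ → ℕ → ℕ → ℕ → ℕ → ℕ → ℕ → ℕ → ℕ → ℕ → ℕ → ℕ → Form
  form₄ c l₀ l₁ l₂ l₃ s₀ s₁ s₂ s₃ m₀₁ m₀₂ m₀₃ m₁₂ m₁₃ m₂₃ =
    4 , quad s₀ l₀ (m₀₁ ∷ m₀₂ ∷ m₀₃ ∷ []) (quad s₁ l₁ (m₁₂ ∷ m₁₃ ∷ [])
          (quad s₂ l₂ (m₂₃ ∷ []) (quad s₃ l₃ [] (con c))))

  -- The certificates were found by computer: integral linear algebra on formal sums of normalised forms,
  -- with the three rules as relations.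
  oddClassSteps : List Step
  oddClassSteps =
    (pos 1 , parity , form₄ 7 1 6 6 6 1 0 0 0 0 0 0 4 4 4) ∷
    (pos 1 , compare , form₄ 9 6 6 6 6 0 0 0 4 4 4 0 4 0 0) ∷
    (pos 1 , compare , form₄ 9 6 6 6 12 4 0 0 4 0 0 0 4 8 4) ∷
    (pos 1 , compare , form₄ 19 20 12 6 14 4 4 0 4 8 4 8 4 0 0) ∷
    (neg1+ 0 , compare , form₄ 19 6 6 14 32 0 0 4 16 4 0 8 0 8 8) ∷
    (pos 1 , compare , form₄ 25 24 16 6 14 4 4 0 4 8 4 8 4 0 0) ∷
    (pos 1 , compare , form₄ 15 6 10 6 16 4 0 0 4 0 0 0 4 8 4) ∷
    (neg1+ 0 , parity , form₄ 7 8 2 2 10 4 0 0 4 4 4 4 4 0 0) ∷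
    (neg1+ 0 , parity , form₄ 23 16 6 18 20 4 0 4 4 4 4 8 0 4 8) ∷
    (pos 1 , compare , form₄ 7 12 4 2 10 4 4 0 4 8 4 8 4 0 0) ∷
    (neg1+ 0 , compare , form₄ 7 2 2 10 16 0 0 4 16 4 0 8 0 8 8) ∷
    (pos 1 , compare , form₄ 1 2 2 2 4 4 0 0 4 0 0 0 4 8 4) ∷
    (neg1+ 0 , compare , form₄ 11 8 4 2 14 4 0 0 4 0 4 4 0 4 0) ∷
    (neg1+ 0 , compare , form₄ 11 2 4 12 14 0 0 4 4 0 4 0 0 4 8) ∷
    (neg1+ 0 , parity , form₄ 29 20 6 18 24 4 0 4 4 4 4 8 0 4 8) ∷
    (pos 1 , compare , form₄ 9 16 8 2 10 4 4 0 4 8 4 8 4 0 0) ∷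
    (pos 1 , compare , form₄ 3 2 6 2 8 4 0 0 4 0 0 0 4 8 4) ∷
    (pos 1 , compare , form₄ 1 2 2 2 2 0 0 0 4 4 4 0 4 0 0) ∷
    (pos 1 , parity , form₄ 1 1 2 2 2 1 0 0 0 0 0 0 4 4 4) ∷
    (neg1+ 0 , compare , form₄ 13 12 4 2 14 4 0 0 4 0 4 4 0 4 0) ∷
    (neg1+ 0 , compare , form₄ 13 4 2 14 16 0 0 4 4 0 4 0 0 4 8) ∷
    (pos 1 , compare , form₄ 11 6 6 4 14 0 0 0 4 4 0 4 0 4 4) ∷
    (pos 2 , compare , form₄ 3 6 2 2 2 4 0 0 0 0 4 0 0 4 0) ∷
    (neg1+ 0 , compare , form₄ 7 6 2 2 10 0 0 0 4 4 0 4 4 0 0) ∷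
    (pos 1 , compare , form₄ 11 2 4 8 14 0 0 4 4 0 4 0 0 4 4) ∷
    (neg1+ 0 , compare , form₄ 11 2 6 4 14 0 0 0 4 4 0 0 0 4 4) ∷
    (neg1+ 0 , compare , form₄ 7 4 2 2 10 0 0 0 4 0 0 4 4 0 0) ∷
    (pos 1 , compare , form₄ 3 4 2 2 2 0 0 0 0 4 0 0 0 0 4) ∷
    (pos 1 , compare , form₄ 9 12 12 6 6 4 4 0 0 8 8 4 0 4 4) ∷
    (neg1+ 0 , compare , form₄ 25 10 10 14 40 0 0 0 16 4 4 8 4 8 8) ∷
    (pos 1 , compare , form₄ 15 16 16 6 10 4 4 0 0 8 4 8 4 0 4) ∷
    (pos 1 , peel , form₄ 9 6 6 12 24 0 0 4 16 4 0 8 4 8 16) ∷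
    (neg1+ 0 , parity , form₄ 3 8 2 4 6 4 0 4 0 4 8 4 0 4 4) ∷
    (pos 1 , peel , form₄ 1 2 2 4 8 0 0 4 16 4 0 8 4 8 16) ∷
    (pos 1 , compare , form₄ 1 4 4 2 2 4 4 0 0 8 8 4 0 4 4) ∷
    (neg1+ 0 , compare , form₄ 3 4 4 2 6 0 4 0 0 0 4 0 0 4 4) ∷
    (pos 2 , peel , form₄ 3 2 2 2 8 0 0 0 4 0 4 0 0 4 4) ∷
    (neg1+ 1 , compare , form₃ 3 6 2 2 0 0 0 4 4 0) ∷
    (neg1+ 0 , compare , form₄ 3 2 4 2 4 0 0 0 4 0 0 4 4 0 0) ∷
    (neg1+ 0 , compare , form₄ 3 2 2 2 4 0 0 0 0 4 0 0 0 0 4) ∷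
    (neg1+ 0 , compare , form₄ 5 4 2 2 8 0 0 0 4 0 4 0 0 4 0) ∷
    (pos 1 , peel , form₄ 15 10 6 16 32 0 0 4 16 4 0 8 4 8 16) ∷
    (neg1+ 0 , compare , form₃ 9 6 6 24 0 0 16 4 8 8) ∷
    (neg1+ 1 , parity , form₃ 9 12 6 6 4 0 0 4 4 4) ∷
    (pos 1 , peel , form₄ 25 14 10 10 40 0 0 0 16 4 4 8 4 8 8) ∷
    (pos 1 , peel , form₃ 1 8 2 2 16 0 0 8 8 4) ∷
    (neg1+ 0 , compare , form₃ 1 2 2 8 0 0 16 4 8 8) ∷
    (neg1+ 0 , parity , form₄ 9 12 6 6 8 4 0 0 4 4 4 8 4 0 4) ∷
    (pos 1 , peel , form₄ 3 6 2 8 16 0 0 4 16 4 0 8 4 8 16) ∷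
    (neg1+ 0 , compare , form₄ 9 4 8 6 6 0 4 0 0 0 0 4 4 0 4) ∷
    (pos 1 , compare , form₄ 3 8 8 2 6 4 4 0 0 8 4 8 4 0 4) ∷
    (neg1+ 0 , compare , form₄ 9 6 6 10 24 0 0 0 16 4 4 8 4 8 8) ∷
    (pos 1 , peel , form₄ 9 10 6 6 24 0 0 0 16 4 4 8 4 8 8) ∷
    (neg1+ 0 , parity , form₄ 19 16 10 10 10 4 0 0 0 4 4 4 4 4 4) ∷
    (pos 2 , compare , form₄ 7 2 10 2 4 0 4 0 0 0 4 0 0 4 0) ∷
    (neg1+ 1 , compare , form₄ 5 2 2 8 10 0 0 4 4 0 4 0 0 4 8) ∷
    (pos 1 , compare , form₄ 7 6 6 2 6 0 0 4 0 4 0 4 0 4 0) ∷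
    (pos 1 , compare , form₄ 7 2 6 6 12 4 0 0 4 0 0 0 4 8 4) ∷
    (pos 1 , compare , form₄ 13 16 12 6 10 4 4 0 4 8 4 8 4 0 0) ∷
    (neg1+ 0 , compare , form₄ 13 6 6 10 28 0 0 4 16 4 0 8 0 8 8) ∷
    (pos 1 , compare , form₄ 19 20 16 6 10 4 4 0 4 8 4 8 4 0 0) ∷
    (pos 1 , compare , form₄ 13 2 10 6 16 4 0 0 4 0 0 0 4 8 4) ∷
    (neg1+ 0 , parity , form₄ 21 18 6 14 20 4 0 4 4 4 4 8 0 4 8) ∷
    (neg1+ 0 , parity , form₄ 3 6 2 2 6 4 0 0 4 4 4 4 4 0 0) ∷
    (neg1+ 0 , parity , form₄ 15 14 6 14 16 4 0 4 4 4 4 8 0 4 8) ∷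
    (neg1+ 0 , compare , form₄ 5 6 2 2 10 4 0 0 4 0 4 4 0 4 0) ∷
    (pos 1 , compare , form₄ 3 8 4 2 6 4 4 0 4 8 4 8 4 0 0) ∷
    (neg1+ 0 , compare , form₄ 3 2 2 6 12 0 0 4 16 4 0 8 0 8 8) ∷
    (pos 1 , compare , form₄ 5 12 8 2 6 4 4 0 4 8 4 8 4 0 0) ∷
    (pos 1 , compare , form₄ 3 2 2 6 8 0 0 4 4 4 0 4 0 4 8) ∷
    (pos 1 , compare , form₄ 3 2 6 2 2 0 4 0 0 0 4 4 0 0 4) ∷
    (pos 1 , compare , form₄ 13 12 16 6 10 4 4 0 0 8 4 0 4 8 4) ∷
    (neg1+ 0 , parity , form₄ 11 14 6 6 12 4 0 0 4 4 4 8 4 0 4) ∷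
    (neg1+ 0 , compare , form₄ 7 6 6 6 20 0 0 0 16 4 4 8 4 8 8) ∷
    (pos 1 , compare , form₄ 7 8 12 6 6 4 4 0 0 8 0 4 8 4 4) ∷
    (neg1+ 0 , parity , form₄ 5 10 2 6 8 4 0 0 4 4 4 8 4 0 4) ∷
    (neg1+ 0 , peel , form₄ 5 6 2 8 10 0 0 4 4 4 4 4 0 4 8) ∷
    (pos 1 , peel , form₄ 5 2 2 8 10 0 0 4 4 0 4 0 0 4 8) ∷
    (neg1+ 0 , compare , form₄ 7 10 2 2 10 4 0 0 4 0 4 4 0 4 0) ∷
    (neg1+ 0 , parity , form₄ 7 10 6 6 6 4 0 0 0 4 4 4 4 4 4) ∷
    (neg1+ 0 , compare , form₄ 7 4 6 6 6 0 0 0 0 4 0 0 4 4 4) ∷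
    (pos 1 , compare , form₄ 7 6 6 4 6 0 0 0 0 4 0 4 0 4 4) ∷
    (neg1+ 0 , compare , form₄ 7 8 4 6 6 4 0 0 0 0 4 4 0 4 4) ∷
    (pos 1 , compare , form₄ 19 10 10 10 16 0 0 0 4 4 4 4 4 4 4) ∷
    (neg1+ 0 , compare , form₄ 13 12 4 6 10 4 0 0 0 0 4 4 0 4 4) ∷
    (pos 1 , compare , form₄ 11 10 18 6 6 0 8 0 0 8 4 4 4 4 4) ∷
    (pos 1 , compare , form₄ 5 6 8 2 6 0 4 0 0 4 4 4 0 4 4) ∷
    (pos 1 , compare , form₄ 5 6 14 2 8 0 8 0 4 8 4 4 4 12 0) ∷
    (neg1+ 0 , compare , form₄ 5 6 8 2 20 0 4 0 16 4 4 8 0 16 8) ∷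
    (neg1+ 0 , compare , form₄ 3 2 2 2 6 0 0 0 4 0 0 4 4 0 0) ∷
    (neg1+ 0 , compare , form₄ 3 4 2 2 6 0 0 0 4 4 0 4 4 0 0) ∷
    (neg1+ 0 , compare , form₄ 5 4 2 2 10 0 0 0 4 4 0 4 0 0 4) ∷
    (pos 1 , compare , form₄ 7 2 2 10 10 0 0 4 4 0 0 4 4 0 4) ∷
    (neg1+ 1 , compare , form₄ 5 4 10 2 8 0 4 0 4 4 0 4 4 8 0) ∷
    (pos 2 , compare , form₄ 5 6 8 2 10 0 4 0 4 4 4 4 0 8 4) ∷
    (neg1+ 1 , compare , form₄ 11 4 14 6 6 0 4 0 0 4 0 0 4 4 4) ∷
    (pos 2 , compare , form₄ 9 6 12 2 4 0 4 0 0 4 4 0 0 4 0) ∷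
    []

  classSteps₁ : List Step
  classSteps₁ =
    (pos 1 , parity , form₄ 11 6 2 10 10 0 2 0 0 0 4 4 0 0 8) ∷
    (pos 1 , parity , form₄ 5 6 2 6 6 0 2 0 0 0 4 4 0 0 8) ∷
    (pos 1 , parity , form₄ 5 2 6 6 12 2 0 0 0 0 0 0 8 8 8) ∷
    (pos 1 , parity , form₄ 17 2 12 14 14 2 0 0 0 0 0 0 8 8 8) ∷
    (neg1+ 0 , peel , form₄ 5 12 4 6 6 0 8 0 0 0 8 8 0 0 8) ∷
    (neg1+ 0 , peel , form₄ 9 12 6 6 12 0 0 0 8 8 8 0 8 0 0) ∷
    (pos 1 , peel , form₄ 9 6 6 6 12 0 0 0 8 0 0 8 8 0 0) ∷
    (neg1+ 0 , compare , form₄ 9 6 6 6 6 0 0 0 0 8 0 0 0 0 8) ∷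
    (neg1+ 1 , compare , form₄ 9 6 6 6 12 0 0 0 8 0 0 8 8 0 0) ∷
    (neg1+ 1 , compare , form₄ 9 12 6 6 12 0 0 0 8 8 0 8 8 0 0) ∷
    (pos 2 , compare , form₄ 5 6 6 4 12 0 0 8 0 8 0 8 0 8 0) ∷
    (pos 2 , compare , form₄ 5 12 4 6 12 0 8 0 8 0 8 16 0 0 8) ∷
    (pos 2 , compare , form₄ 17 16 28 12 14 8 8 0 0 16 0 8 16 8 8) ∷
    (neg1+ 1 , compare , form₄ 17 14 14 12 44 0 0 0 32 8 8 16 8 16 16) ∷
    (pos 2 , compare , form₄ 31 24 36 14 20 8 8 0 0 16 8 0 8 16 8) ∷
    (pos 2 , compare , form₄ 11 20 4 6 20 0 8 0 8 0 8 16 0 0 8) ∷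
    (neg1+ 1 , parity , form₄ 25 30 12 14 24 8 0 0 8 8 8 16 8 0 8) ∷
    (neg1+ 1 , parity , form₄ 11 22 4 14 16 8 0 0 8 8 8 16 8 0 8) ∷
    (neg1+ 1 , parity , form₄ 17 22 12 14 14 8 0 0 0 8 8 8 8 8 8) ∷
    (pos 2 , compare , form₄ 25 22 38 12 14 0 16 0 0 16 8 8 8 8 8) ∷
    (neg1+ 1 , compare , form₄ 25 24 14 12 60 8 0 0 32 8 0 32 8 16 16) ∷
    (pos 2 , compare , form₄ 11 30 14 4 16 16 0 0 8 16 8 24 8 8 0) ∷
    (pos 2 , compare , form₄ 11 14 16 4 14 0 8 0 0 8 8 8 0 8 8) ∷
    (neg1+ 1 , compare , form₄ 5 12 2 6 6 0 0 0 0 8 8 8 0 0 8) ∷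
    (pos 2 , compare , form₄ 7 4 12 6 6 0 8 0 0 0 8 8 0 0 8) ∷
    (pos 2 , parity , form₄ 3 2 4 6 6 2 0 0 0 0 0 0 8 8 8) ∷
    (pos 1 , parity , form₄ 3 2 2 6 6 0 2 0 0 0 4 4 0 0 8) ∷
    (pos 1 , parity , form₄ 1 2 2 2 2 0 0 0 2 4 4 0 8 0 0) ∷
    (pos 2 , compare , form₄ 5 8 6 2 6 0 0 0 0 8 8 0 0 8 0) ∷
    (pos 2 , compare , form₄ 5 2 6 2 6 0 0 0 0 0 8 0 0 8 0) ∷
    (pos 2 , compare , form₄ 7 10 2 6 8 0 0 0 0 8 0 8 0 0 8) ∷
    (neg1+ 1 , compare , form₄ 11 6 4 8 20 0 0 0 8 0 8 0 0 8 8) ∷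
    (pos 2 , compare , form₄ 3 8 4 2 4 0 0 0 0 8 8 0 0 8 0) ∷
    (neg1+ 1 , compare , form₄ 5 2 6 4 6 0 0 8 0 0 8 0 0 8 0) ∷
    (pos 1 , peel , form₄ 5 2 4 6 6 0 8 0 0 8 0 0 0 0 8) ∷
    (neg1+ 0 , compare , form₄ 5 2 2 6 6 0 0 0 0 8 0 0 0 0 8) ∷
    (neg1+ 1 , compare , form₄ 7 4 8 6 8 0 0 0 0 8 0 0 0 8 8) ∷
    (neg1+ 1 , compare , form₄ 5 8 6 4 6 0 0 8 0 8 8 0 0 8 0) ∷
    (pos 2 , compare , form₄ 7 6 8 8 12 0 0 0 8 8 0 0 8 8 8) ∷
    (neg1+ 3 , compare , form₄ 7 8 8 6 12 0 0 0 8 8 0 8 8 8 0) ∷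
    (neg1+ 1 , compare , form₄ 13 12 10 6 8 0 0 0 0 8 8 0 0 8 0) ∷
    (pos 2 , compare , form₄ 11 14 8 4 8 0 0 0 0 8 8 0 0 8 0) ∷
    (pos 2 , compare , form₄ 7 4 4 6 8 0 0 0 0 0 8 0 0 8 0) ∷
    (neg1+ 1 , compare , form₄ 7 6 4 4 8 0 0 0 0 0 8 0 0 8 0) ∷
    (pos 2 , compare , form₄ 3 4 4 2 4 0 0 0 0 0 8 0 0 8 0) ∷
    (neg1+ 1 , compare , form₄ 3 2 4 4 4 0 0 0 0 0 0 8 8 0 0) ∷
    (neg1+ 1 , compare , form₄ 5 4 2 6 12 0 0 0 0 0 8 0 0 8 8) ∷
    (neg1+ 1 , compare , form₄ 3 4 4 4 6 0 0 0 0 8 0 0 0 8 8) ∷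
    (neg1+ 1 , compare , form₄ 3 6 4 4 8 0 0 0 8 8 8 8 0 8 0) ∷
    (neg1+ 1 , parity , form₄ 9 18 6 12 16 8 0 0 8 8 8 16 8 8 0) ∷
    (pos 2 , compare , form₄ 35 12 20 14 68 8 0 0 32 0 0 16 8 16 16) ∷
    (neg1+ 1 , parity , form₄ 21 26 6 20 32 8 0 8 8 8 8 16 0 8 16) ∷
    (pos 2 , compare , form₄ 9 4 12 6 36 8 0 0 32 0 0 16 8 16 16) ∷
    (neg1+ 1 , compare , form₄ 21 6 26 6 20 0 8 0 8 0 0 8 8 8 0) ∷
    (neg1+ 1 , compare , form₄ 15 6 12 6 20 0 0 0 8 8 0 0 0 8 8) ∷
    (pos 2 , compare , form₄ 15 6 6 18 20 0 0 8 8 0 8 0 0 8 8) ∷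
    (pos 2 , compare , form₄ 11 24 20 4 6 8 8 8 0 16 16 8 0 8 0) ∷
    (neg1+ 1 , compare , form₄ 5 6 6 4 28 0 0 8 32 8 0 16 0 16 16) ∷
    (pos 2 , compare , form₄ 5 16 12 4 6 8 8 8 0 16 16 8 0 8 0) ∷
    (neg1+ 1 , parity , form₄ 5 14 4 6 6 8 8 0 0 8 8 8 0 0 8) ∷
    (neg1+ 1 , parity , form₄ 13 22 6 12 24 8 0 8 8 8 8 16 0 8 16) ∷
    (neg1+ 1 , compare , form₄ 7 6 8 12 16 0 0 8 8 8 0 8 8 8 16) ∷
    (pos 2 , compare , form₄ 7 8 8 12 14 0 0 8 8 8 8 8 8 8 8) ∷
    (neg1+ 1 , compare , form₄ 7 8 6 12 16 0 0 8 8 8 8 8 0 8 16) ∷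
    (neg1+ 1 , parity , form₄ 7 14 6 12 16 8 0 8 8 8 8 16 0 8 16) ∷
    (neg1+ 1 , compare , form₄ 27 14 14 12 60 0 0 8 32 8 0 16 0 16 16) ∷
    (pos 2 , compare , form₄ 7 12 16 6 12 8 8 0 8 16 8 0 8 16 0) ∷
    (pos 2 , compare , form₄ 13 20 24 6 12 8 8 0 8 16 8 0 8 16 0) ∷
    (pos 2 , compare , form₄ 7 6 6 12 16 0 0 8 8 8 0 8 0 8 16) ∷
    (pos 2 , compare , form₄ 15 20 32 6 12 0 16 0 8 16 8 0 8 16 0) ∷
    (neg1+ 1 , compare , form₄ 9 6 18 12 36 0 8 8 32 8 0 16 16 32 16) ∷
    (pos 2 , compare , form₄ 9 12 24 12 18 0 16 8 8 16 0 8 16 24 16) ∷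
    (pos 2 , compare , form₄ 9 6 18 12 12 0 8 0 8 8 8 0 8 16 0) ∷
    (pos 2 , compare , form₄ 9 6 12 6 12 0 8 0 0 0 8 8 0 0 8) ∷
    (neg1+ 1 , compare , form₄ 21 14 12 12 52 0 8 0 32 0 8 16 0 16 16) ∷
    (pos 2 , compare , form₄ 15 20 32 6 18 0 16 0 8 16 8 8 8 24 0) ∷
    (pos 2 , compare , form₄ 15 14 18 6 20 0 8 0 0 8 8 8 0 8 8) ∷
    (pos 2 , compare , form₄ 29 28 40 14 14 0 16 0 0 16 8 8 8 8 8) ∷
    (neg1+ 1 , compare , form₄ 15 14 18 6 52 0 8 0 32 8 8 16 0 32 16) ∷
    (neg1+ 1 , compare , form₄ 9 6 12 6 36 0 8 0 32 0 8 16 0 16 16) ∷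
    (neg1+ 1 , parity , form₄ 9 18 6 6 12 8 0 0 8 8 8 8 8 0 0) ∷
    (neg1+ 1 , parity , form₄ 23 26 14 14 20 8 0 0 0 8 8 8 8 8 8) ∷
    (neg1+ 1 , compare , form₄ 9 14 4 6 12 0 0 0 0 8 8 8 0 0 8) ∷
    (neg1+ 1 , compare , form₄ 23 20 14 14 52 0 0 0 32 8 8 16 8 16 16) ∷
    (pos 2 , compare , form₄ 9 26 10 6 12 8 8 0 0 16 16 8 0 8 8) ∷
    (pos 2 , compare , form₄ 9 14 22 6 18 0 16 0 8 16 8 16 8 16 8) ∷
    (neg1+ 1 , compare , form₄ 9 4 18 6 36 8 8 0 32 0 0 16 8 32 16) ∷
    (pos 2 , compare , form₄ 21 14 38 6 20 0 16 0 8 16 8 0 8 16 0) ∷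
    (pos 2 , compare , form₄ 9 4 18 6 14 8 8 0 0 0 0 0 8 16 8) ∷
    (pos 2 , compare , form₄ 3 6 4 4 6 0 0 8 0 8 0 8 0 8 0) ∷
    (pos 2 , compare , form₄ 3 6 4 4 10 0 8 0 8 0 8 16 0 0 8) ∷
    (neg1+ 1 , compare , form₄ 9 12 6 4 36 0 0 8 32 8 0 16 0 16 16) ∷
    (pos 2 , compare , form₄ 3 10 10 4 4 8 8 0 8 16 8 0 8 16 0) ∷
    (neg1+ 1 , compare , form₄ 3 6 4 4 20 0 8 0 32 0 8 16 0 16 16) ∷
    (pos 2 , compare , form₄ 21 12 12 14 52 8 0 0 32 0 0 16 8 16 16) ∷
    (neg1+ 1 , parity , form₄ 3 10 4 6 8 8 0 0 8 8 8 16 8 0 8) ∷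
    (pos 2 , compare , form₄ 3 4 4 6 20 8 0 0 32 0 0 16 8 16 16) ∷
    (neg1+ 1 , parity , form₄ 15 18 6 20 24 8 0 8 8 8 8 16 0 8 16) ∷
    (neg1+ 1 , compare , form₄ 15 6 18 6 20 0 8 0 8 0 0 8 8 8 0) ∷
    (pos 2 , peel , form₄ 21 6 6 24 28 0 0 8 8 0 8 0 0 8 16) ∷
    (neg1+ 1 , compare , form₃ 5 8 4 6 8 0 0 0 0 8) ∷
    (neg1+ 1 , compare , form₃ 5 4 12 6 0 8 0 0 8 8) ∷
    (pos 2 , peel , form₄ 5 2 6 12 16 0 0 8 8 0 0 8 8 16 16) ∷
    (pos 2 , compare , form₄ 5 6 6 2 16 0 0 0 8 8 0 0 0 16 8) ∷
    (neg1+ 1 , compare , form₄ 11 10 6 2 20 8 0 0 8 0 8 8 0 8 0) ∷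
    (neg1+ 1 , parity , form₄ 29 26 10 28 32 8 0 8 8 8 8 16 0 8 16) ∷
    (pos 2 , compare , form₄ 23 32 20 10 20 8 8 0 8 16 8 16 8 0 0) ∷
    (neg1+ 1 , compare , form₄ 23 10 10 20 52 0 0 8 32 8 0 16 0 16 16) ∷
    (pos 2 , compare , form₄ 33 40 28 10 20 8 8 0 8 16 8 16 8 0 0) ∷
    (pos 2 , compare , form₄ 11 4 12 10 20 8 0 0 8 0 0 0 8 16 8) ∷
    (pos 2 , compare , form₄ 5 16 4 2 12 8 8 0 8 16 8 16 8 0 0) ∷
    (pos 2 , parity , form₄ 11 2 10 10 12 2 0 0 0 0 0 0 8 8 8) ∷
    (pos 2 , compare , form₄ 11 10 10 4 12 0 0 8 0 8 0 8 0 8 0) ∷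
    (pos 2 , compare , form₄ 21 4 20 10 28 8 0 0 8 0 0 0 8 16 8) ∷
    (neg1+ 1 , peel , form₄ 5 10 4 6 8 0 0 0 8 8 0 8 8 0 0) ∷
    (neg1+ 1 , parity , form₄ 23 26 10 10 20 8 0 0 8 8 8 8 8 0 0) ∷
    (pos 2 , peel , form₄ 5 20 2 2 12 32 0 0 8 16 16 16 8 0 0) ∷
    (neg1+ 1 , compare , form₄ 5 2 2 12 20 0 0 8 32 8 0 16 0 16 16) ∷
    (neg1+ 1 , compare , form₄ 13 10 8 2 20 0 0 0 8 8 8 0 0 8 0) ∷
    (neg1+ 1 , compare , form₄ 11 2 6 2 20 0 0 0 8 0 8 0 0 8 0) ∷
    (neg1+ 1 , compare , form₄ 11 8 2 6 20 0 0 0 8 8 0 8 0 0 8) ∷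
    (pos 2 , compare , form₄ 13 6 2 18 20 0 0 8 8 0 0 8 8 0 8) ∷
    (neg1+ 0 , compare , form₄ 5 6 6 2 2 0 0 0 0 8 0 0 0 0 8) ∷
    (neg1+ 0 , peel , form₄ 5 6 2 2 12 0 0 0 8 0 0 8 8 0 0) ∷
    (neg1+ 0 , peel , form₄ 5 4 2 2 12 0 0 0 8 8 8 0 8 0 0) ∷
    (pos 1 , parity , form₄ 5 2 4 10 10 2 0 0 0 0 0 0 8 8 8) ∷
    (pos 1 , parity , form₄ 1 2 2 2 4 2 0 0 0 0 0 0 8 8 8) ∷
    (neg1+ 0 , peel , form₄ 1 4 2 2 4 0 0 0 8 8 8 0 8 0 0) ∷
    (pos 2 , compare , form₄ 1 2 4 2 4 0 8 0 0 0 8 8 0 0 8) ∷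
    (pos 2 , compare , form₄ 1 2 6 4 4 0 8 0 8 8 8 0 8 16 0) ∷
    (pos 2 , compare , form₄ 1 4 8 4 6 0 16 8 8 16 0 8 16 24 16) ∷
    (neg1+ 1 , compare , form₄ 5 10 4 4 28 0 8 0 32 0 8 16 0 16 16) ∷
    (pos 2 , compare , form₄ 3 12 16 2 6 0 16 0 8 16 8 8 8 24 0) ∷
    (pos 2 , compare , form₄ 3 10 6 2 12 0 8 0 0 8 8 8 0 8 8) ∷
    (pos 2 , compare , form₄ 13 20 24 10 10 0 16 0 0 16 8 8 8 8 8) ∷
    (neg1+ 1 , compare , form₄ 3 10 6 2 28 0 8 0 32 8 8 16 0 32 16) ∷
    (neg1+ 1 , parity , form₄ 33 30 18 18 20 8 0 0 0 8 8 8 8 8 8) ∷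
    (pos 2 , peel , form₄ 45 26 18 20 76 0 0 0 32 8 8 16 8 16 16) ∷
    (neg1+ 1 , compare , form₄ 1 2 6 4 12 0 8 8 32 8 0 16 16 32 16) ∷
    (pos 2 , compare , form₄ 3 12 16 2 4 0 16 0 8 16 8 0 8 16 0) ∷
    (neg1+ 1 , compare , form₄ 1 2 4 2 12 0 8 0 32 0 8 16 0 16 16) ∷
    (pos 2 , compare , form₄ 33 18 20 18 30 0 0 0 8 8 8 8 8 8 8) ∷
    (neg1+ 1 , compare , form₄ 21 22 8 10 18 8 0 0 0 0 8 8 0 8 8) ∷
    (pos 2 , compare , form₄ 11 10 12 8 10 0 0 0 0 8 0 8 0 8 8) ∷
    (neg1+ 1 , compare , form₄ 11 14 8 10 12 8 0 0 0 0 8 8 8 0 8) ∷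
    (neg1+ 1 , compare , form₄ 11 2 12 8 10 0 0 0 0 8 0 0 0 8 8) ∷
    (neg1+ 1 , compare , form₄ 13 8 2 10 22 0 0 0 8 0 8 0 0 8 8) ∷
    (pos 2 , peel , form₄ 3 10 2 2 14 0 0 0 8 0 8 8 0 8 8) ∷
    (pos 2 , compare , form₄ 25 20 40 10 18 0 16 0 0 16 8 8 8 8 8) ∷
    (neg1+ 1 , compare , form₄ 15 10 22 10 44 0 8 0 32 8 8 16 0 32 16) ∷
    (pos 2 , compare , form₄ 15 12 32 10 22 0 16 0 8 16 8 8 8 24 0) ∷
    (pos 2 , compare , form₄ 15 10 22 10 12 0 8 0 0 8 8 8 0 8 8) ∷
    (pos 2 , compare , form₄ 15 12 10 10 12 8 0 0 0 0 0 0 8 8 8) ∷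
    (pos 2 , compare , form₄ 5 4 4 10 28 8 0 0 32 0 0 16 8 16 16) ∷
    (pos 2 , compare , form₄ 1 2 2 4 12 0 0 8 32 8 0 16 0 16 16) ∷
    (pos 1 , peel , form₄ 1 2 2 2 4 0 0 0 8 0 0 8 8 0 0) ∷
    (neg1+ 0 , compare , form₄ 1 2 2 2 2 0 0 0 0 8 0 0 0 0 8) ∷
    (pos 1 , compare , form₄ 1 2 2 2 2 0 0 0 0 0 0 8 8 0 0) ∷
    (pos 1 , peel , form₄ 1 2 2 2 4 0 0 0 0 0 8 0 0 8 8) ∷
    (pos 2 , compare , form₄ 3 4 10 2 2 0 0 0 0 8 0 8 8 0 0) ∷
    (neg1+ 1 , compare , form₄ 1 2 2 2 4 0 0 0 8 0 8 0 0 8 0) ∷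
    (neg1+ 1 , compare , form₄ 3 10 4 2 4 0 0 0 8 8 8 0 0 8 0) ∷
    (neg1+ 1 , parity , form₄ 13 22 4 10 10 8 8 0 0 8 8 8 0 0 8) ∷
    (neg1+ 1 , compare , form₄ 43 18 18 12 76 0 0 8 32 8 0 16 0 16 16) ∷
    (neg1+ 1 , compare , form₄ 13 10 10 4 44 0 0 8 32 8 0 16 0 16 16) ∷
    (pos 2 , peel , form₄ 1 4 2 4 12 8 0 8 32 8 0 32 0 16 16) ∷
    (neg1+ 1 , peel , form₄ 1 8 2 4 12 8 0 8 32 8 16 32 0 16 16) ∷
    (pos 2 , peel , form₄ 3 12 2 4 28 8 0 8 32 8 0 32 0 16 16) ∷
    (neg1+ 1 , parity , form₄ 1 6 2 4 8 8 0 8 8 8 8 16 0 8 16) ∷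
    (neg1+ 1 , compare , form₄ 1 2 6 2 4 0 8 0 8 0 0 8 8 8 0) ∷
    (neg1+ 1 , compare , form₄ 1 4 2 2 4 0 0 0 8 8 0 8 0 0 8) ∷
    (pos 2 , compare , form₄ 3 2 2 4 14 0 0 8 8 0 8 0 0 8 8) ∷
    (neg1+ 1 , compare , form₄ 3 2 14 2 4 0 8 0 8 0 0 8 8 8 0) ∷
    (neg1+ 1 , compare , form₄ 5 2 2 12 16 0 0 8 8 0 8 0 0 8 16) ∷
    (pos 2 , compare , form₄ 3 4 4 2 12 0 0 0 8 8 0 8 0 8 8) ∷
    (neg1+ 1 , compare , form₄ 3 2 2 8 12 0 0 8 8 0 8 0 0 8 16) ∷
    (neg1+ 3 , compare , form₄ 5 2 4 12 16 0 0 8 8 0 0 8 8 8 16) ∷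
    (pos 4 , compare , form₄ 5 4 12 4 6 0 8 0 0 0 0 8 8 8 0) ∷
    (pos 4 , compare , form₄ 5 8 4 4 6 8 0 0 0 0 8 0 0 8 0) ∷
    (neg1+ 3 , compare , form₄ 21 6 6 24 28 0 0 8 8 0 8 0 0 8 16) ∷
    (neg1+ 3 , compare , form₄ 5 4 6 4 8 0 0 0 8 0 0 8 8 0 0) ∷
    (neg1+ 3 , compare , form₄ 9 10 4 4 16 0 0 0 8 0 8 8 0 8 0) ∷
    (pos 2 , peel , form₄ 9 10 4 14 16 0 0 0 8 8 0 8 8 0 16) ∷
    (neg1+ 1 , parity , form₄ 3 14 2 4 16 8 0 8 8 8 8 16 0 8 16) ∷
    (neg1+ 1 , peel , form₄ 3 16 2 4 28 8 0 8 32 8 16 32 0 16 16) ∷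
    (pos 2 , compare , form₄ 15 4 12 10 44 8 0 0 32 0 0 16 8 16 16) ∷
    (neg1+ 1 , parity , form₄ 5 14 4 8 10 8 0 8 0 8 16 8 0 8 8) ∷
    (pos 2 , compare , form₄ 27 12 12 18 60 8 0 0 32 0 0 16 8 16 16) ∷
    (neg1+ 1 , compare , form₄ 27 12 18 12 60 8 0 0 32 0 0 16 8 16 16) ∷
    (neg1+ 1 , peel , form₄ 15 24 10 12 44 8 0 8 32 8 16 32 0 16 16) ∷
    (pos 2 , peel , form₄ 15 20 10 12 44 8 0 8 32 8 0 32 0 16 16) ∷
    (pos 2 , compare , form₄ 15 10 10 12 44 0 0 8 32 8 0 16 0 16 16) ∷
    (neg1+ 1 , compare , form₄ 15 12 10 10 44 8 0 0 32 0 0 16 8 16 16) ∷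
    (pos 2 , peel , form₄ 25 28 10 12 60 8 0 8 32 8 0 32 0 16 16) ∷
    (neg1+ 1 , peel , form₄ 25 32 10 12 60 8 0 8 32 8 16 32 0 16 16) ∷
    (pos 1 , peel , form₃ 1 2 2 4 0 0 0 0 8 8) ∷
    (neg1+ 0 , parity , form₂ 1 2 2 0 0 4) ∷
    (neg1+ 1 , parity , form₃ 3 6 2 2 0 0 0 4 4 0) ∷
    (pos 1 , peel , form₃ 3 6 4 6 0 0 0 8 0 8) ∷
    (neg1+ 1 , compare , form₃ 3 12 2 2 0 0 0 8 8 0) ∷
    (neg1+ 1 , parity , form₃ 15 22 10 12 8 0 0 8 8 8) ∷
    (pos 2 , peel , form₄ 15 16 10 12 44 8 0 0 32 8 0 32 8 16 16) ∷
    (neg1+ 1 , parity , form₄ 39 34 10 28 40 8 0 8 8 8 8 16 0 8 16) ∷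
    (pos 2 , compare , form₄ 7 24 12 2 12 8 8 0 8 16 8 16 8 0 0) ∷
    (pos 2 , compare , form₄ 5 2 2 12 16 0 0 8 8 8 0 8 0 8 16) ∷
    (neg1+ 1 , compare , form₄ 13 18 6 2 20 8 0 0 8 0 8 8 0 8 0) ∷
    (pos 2 , compare , form₄ 7 6 6 2 24 0 0 0 8 8 0 0 0 16 8) ∷
    (pos 2 , compare , form₄ 5 4 12 2 2 0 8 0 0 0 8 8 0 0 8) ∷
    (pos 2 , compare , form₄ 21 24 28 10 20 8 8 0 0 16 8 0 8 16 8) ∷
    (neg1+ 1 , parity , form₄ 19 26 10 12 24 8 0 0 8 8 8 16 8 8 0) ∷
    (neg1+ 1 , compare , form₄ 19 14 12 10 24 0 0 0 8 8 0 16 8 0 8) ∷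
    (neg1+ 1 , compare , form₄ 11 10 10 12 36 0 0 0 32 8 8 16 8 16 16) ∷
    (pos 2 , compare , form₄ 11 16 20 10 12 8 8 0 0 16 8 0 8 16 8) ∷
    (neg1+ 1 , parity , form₄ 9 18 4 10 16 8 0 0 8 8 8 16 8 0 8) ∷
    (neg1+ 1 , compare , form₄ 9 14 4 10 16 0 0 0 8 8 0 16 8 0 8) ∷
    (pos 2 , compare , form₄ 5 10 6 2 6 8 0 0 0 0 8 8 0 8 0) ∷
    (neg1+ 1 , parity , form₄ 11 18 10 10 12 8 0 0 0 8 8 8 8 8 8) ∷
    (neg1+ 1 , compare , form₄ 11 8 10 10 12 0 0 0 0 8 0 0 8 8 8) ∷
    (pos 2 , compare , form₄ 19 18 34 10 12 0 16 0 0 16 8 8 8 8 8) ∷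
    (pos 2 , compare , form₄ 9 10 16 4 10 0 8 0 0 8 8 8 0 8 8) ∷
    (neg1+ 1 , compare , form₄ 19 24 10 12 52 8 0 0 32 8 0 32 8 16 16) ∷
    (pos 2 , compare , form₄ 9 26 10 4 16 16 0 0 8 16 8 24 8 8 0) ∷
    (pos 2 , compare , form₄ 7 12 6 2 8 0 0 0 0 8 8 0 0 8 0) ∷
    (neg1+ 1 , compare , form₄ 5 2 6 6 10 0 0 0 8 0 0 8 8 0 8) ∷
    (neg1+ 1 , compare , form₄ 5 10 6 6 8 8 0 0 0 0 8 8 8 0 8) ∷
    (pos 2 , compare , form₄ 23 10 16 14 32 0 0 0 8 8 0 8 8 8 16) ∷
    (pos 2 , compare , form₄ 5 8 8 6 6 0 0 0 0 8 0 8 0 8 8) ∷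
    (neg1+ 1 , compare , form₄ 7 6 2 6 24 0 0 0 8 0 8 0 0 8 16) ∷
    (pos 2 , compare , form₄ 7 16 8 2 6 0 0 0 0 8 8 8 0 8 0) ∷
    (pos 2 , compare , form₄ 5 2 6 6 8 0 0 0 0 0 0 8 8 0 8) ∷
    (pos 1 , compare , form₄ 9 6 6 6 6 0 0 0 0 0 0 8 8 0 0) ∷
    (pos 1 , peel , form₄ 9 6 6 6 12 0 0 0 0 0 8 0 0 8 8) ∷
    (neg1+ 1 , compare , form₄ 9 6 8 4 6 0 0 0 0 0 8 0 0 8 0) ∷
    (pos 2 , compare , form₄ 5 4 2 6 8 0 0 0 0 0 8 0 0 8 0) ∷
    (neg1+ 1 , compare , form₄ 5 8 6 2 4 0 0 0 0 0 8 0 0 8 0) ∷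
    (pos 1 , peel , form₄ 3 2 4 6 6 0 0 0 0 0 0 8 8 8 0) ∷
    (pos 1 , compare , form₄ 3 2 2 6 6 0 0 0 0 0 0 8 8 0 0) ∷
    (pos 3 , compare , form₄ 9 4 6 6 8 0 0 0 0 0 8 0 0 8 0) ∷
    (neg1+ 2 , compare , form₄ 3 6 2 2 6 0 0 0 0 0 8 0 0 8 0) ∷
    (pos 2 , compare , form₄ 3 6 6 2 2 0 0 0 0 0 0 8 8 0 0) ∷
    (pos 2 , peel , form₄ 3 6 2 2 12 0 0 0 0 0 8 0 0 8 8) ∷
    (pos 4 , compare , form₄ 9 2 6 10 12 0 0 0 0 0 0 8 8 0 8) ∷
    (pos 4 , compare , form₄ 9 12 8 6 10 0 0 0 0 8 0 8 0 8 8) ∷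
    (pos 4 , compare , form₄ 9 6 10 8 20 0 0 0 8 8 0 0 8 16 8) ∷
    (pos 4 , compare , form₄ 21 6 18 12 28 0 0 0 8 8 0 0 8 16 8) ∷
    (neg1+ 3 , compare , form₄ 9 12 8 10 16 0 0 0 8 8 8 8 8 8 8) ∷
    (neg1+ 3 , compare , form₄ 9 2 8 8 12 0 0 0 0 0 0 8 8 0 8) ∷
    (neg1+ 2 , peel , form₄ 3 4 2 2 12 0 0 0 0 0 8 0 0 8 8) ∷
    (neg1+ 2 , compare , form₄ 3 8 4 2 2 0 0 0 0 0 8 0 0 8 0) ∷
    (pos 3 , peel , form₄ 5 2 4 4 10 0 0 0 0 0 8 0 0 8 8) ∷
    (pos 1 , compare , form₄ 9 2 8 4 8 0 0 0 0 0 8 0 0 8 0) ∷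
    (pos 1 , compare , form₄ 9 4 8 8 10 0 0 0 0 0 0 8 8 0 8) ∷
    (neg1+ 0 , compare , form₄ 9 4 8 2 8 0 0 0 0 0 8 0 0 8 0) ∷
    (pos 1 , compare , form₄ 5 8 2 4 4 0 0 0 0 0 8 0 0 8 0) ∷
    (neg1+ 0 , compare , form₄ 5 2 4 4 8 0 0 0 0 0 8 0 0 8 0) ∷
    (neg1+ 2 , compare , form₄ 7 2 6 4 8 0 0 0 0 0 8 0 0 8 0) ∷
    (pos 3 , compare , form₄ 7 4 8 2 6 0 0 0 0 0 8 0 0 8 0) ∷
    (neg1+ 2 , peel , form₄ 5 6 4 4 10 0 0 0 0 0 8 0 0 8 8) ∷
    (neg1+ 2 , compare , form₄ 9 8 8 10 12 0 0 0 0 8 0 0 8 8 8) ∷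
    (neg1+ 0 , compare , form₄ 9 4 4 10 12 0 0 0 0 0 8 0 0 8 8) ∷
    (neg1+ 0 , compare , form₄ 9 4 12 8 10 0 0 0 0 8 0 0 8 8 8) ∷
    (pos 1 , compare , form₄ 13 14 10 4 8 0 0 0 0 8 8 0 0 8 0) ∷
    (neg1+ 0 , compare , form₄ 5 4 6 4 4 0 0 0 0 0 0 8 8 0 0) ∷
    (pos 1 , compare , form₄ 5 4 4 4 6 0 0 0 0 0 8 0 0 8 0) ∷
    (neg1+ 0 , compare , form₄ 9 6 6 4 8 0 0 0 0 0 8 0 0 8 0) ∷
    (neg1+ 0 , compare , form₄ 15 12 12 6 8 0 0 0 0 8 8 0 0 8 0) ∷
    (pos 1 , compare , form₄ 7 8 8 4 6 0 0 0 0 8 8 0 0 8 0) ∷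
    (neg1+ 3 , compare , form₄ 7 4 4 6 16 0 0 0 8 0 8 0 0 8 8) ∷
    (neg1+ 1 , compare , form₄ 11 14 8 4 16 0 0 0 8 8 8 8 0 8 0) ∷
    (pos 2 , compare , form₄ 11 8 8 4 22 0 0 0 8 8 0 8 0 8 8) ∷
    (neg1+ 1 , compare , form₄ 11 8 14 4 16 0 0 0 8 8 0 8 8 8 0) ∷
    (pos 3 , compare , form₄ 3 4 4 6 8 0 0 0 0 8 0 0 8 8 8) ∷
    (neg1+ 2 , compare , form₄ 3 2 6 4 8 0 0 0 0 8 0 0 8 8 8) ∷
    (neg1+ 2 , compare , form₄ 3 2 2 6 8 0 0 0 0 0 0 8 8 0 8) ∷
    (pos 3 , compare , form₄ 3 2 4 4 8 0 0 0 0 0 0 8 8 0 8) ∷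
    (pos 3 , compare , form₄ 3 2 2 4 8 0 0 0 0 0 8 0 0 8 0) ∷
    (pos 3 , compare , form₄ 5 12 4 2 8 0 0 0 0 8 8 0 0 8 0) ∷
    (pos 2 , compare , form₄ 5 10 4 4 6 0 0 0 0 8 8 0 0 0 8) ∷
    (neg1+ 1 , compare , form₄ 15 16 6 10 12 8 0 0 0 0 8 0 0 8 8) ∷
    (neg1+ 1 , parity , form₄ 39 38 12 18 32 8 0 0 8 8 8 16 8 0 8) ∷
    (pos 2 , compare , form₄ 65 20 28 18 92 0 8 0 32 0 8 16 0 16 16) ∷
    (pos 2 , compare , form₄ 5 4 6 4 14 0 0 0 8 0 0 8 8 0 8) ∷
    (neg1+ 1 , compare , form₄ 5 4 10 2 4 0 0 0 0 8 8 0 0 8 0) ∷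
    (neg1+ 1 , peel , form₄ 5 2 4 10 14 0 0 0 8 0 0 8 8 8 8) ∷
    (neg1+ 1 , compare , form₄ 5 8 6 4 10 8 0 0 0 0 0 8 8 0 8) ∷
    (pos 2 , peel , form₄ 5 8 4 10 14 8 0 0 8 0 8 16 8 8 8) ∷
    (neg1+ 1 , compare , form₄ 3 4 10 4 8 0 8 0 8 8 0 8 8 16 0) ∷
    (pos 2 , compare , form₄ 3 6 8 4 10 0 8 0 8 8 8 8 0 16 8) ∷
    (neg1+ 1 , compare , form₄ 9 4 18 6 12 0 8 0 0 8 0 0 8 8 8) ∷
    (pos 2 , compare , form₄ 7 6 16 4 4 0 8 0 0 8 0 8 8 0 0) ∷
    (pos 2 , compare , form₄ 35 10 38 12 28 0 8 0 8 8 8 0 8 16 0) ∷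
    (pos 2 , compare , form₄ 35 12 48 28 38 0 16 8 8 16 0 8 16 24 16) ∷
    (neg1+ 1 , compare , form₄ 35 10 38 28 60 0 8 8 32 8 0 16 16 32 16) ∷
    (pos 2 , compare , form₄ 45 20 56 10 28 0 16 0 8 16 8 0 8 16 0) ∷
    []

  classSteps₂ : List Step
  classSteps₂ =
    (pos 1 , parity , form₄ 9 6 4 6 10 0 2 0 0 0 4 4 0 0 8) ∷
    (neg1+ 0 , peel , form₄ 13 0 10 12 14 2 0 0 0 0 0 0 8 8 8) ∷
    (pos 1 , parity , form₄ 7 6 0 6 10 0 2 0 0 0 4 4 0 0 8) ∷
    (neg1+ 0 , peel , form₄ 7 0 6 10 12 2 0 0 0 0 0 0 8 8 8) ∷
    (neg1+ 0 , parity , form₂ 1 2 2 0 0 4) ∷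
    (neg1+ 0 , peel , form₃ 1 6 2 4 0 0 0 8 8 8) ∷
    (neg1+ 0 , peel , form₃ 3 10 4 6 0 0 0 8 8 8) ∷
    (pos 1 , parity , form₄ 3 2 2 4 6 0 0 2 0 4 0 4 0 8 0) ∷
    (neg1+ 0 , peel , form₄ 3 0 4 6 10 2 0 0 0 0 0 0 8 8 8) ∷
    (neg1+ 0 , peel , form₄ 1 0 2 4 6 2 0 0 0 0 0 0 8 8 8) ∷
    (pos 1 , parity , form₄ 1 2 0 2 6 0 2 0 0 0 4 4 0 0 8) ∷
    (pos 2 , parity , form₄ 3 0 4 6 10 2 0 0 0 0 0 0 8 8 8) ∷
    (neg1+ 1 , parity , form₃ 3 6 2 2 0 0 0 4 4 0) ∷
    (neg1+ 1 , compare , form₃ 9 12 6 6 0 0 0 8 8 0) ∷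
    (pos 2 , peel , form₄ 9 10 6 6 18 0 0 0 8 0 8 8 0 8 8) ∷
    (neg1+ 1 , compare , form₄ 19 20 6 10 14 0 0 0 0 8 8 8 0 0 8) ∷
    (pos 2 , peel , form₄ 13 18 10 12 14 8 0 0 0 8 8 8 8 8 8) ∷
    (pos 2 , compare , form₄ 3 6 4 2 6 0 0 0 0 8 8 0 0 8 0) ∷
    (neg1+ 1 , compare , form₄ 13 6 4 12 14 0 0 0 0 0 8 0 0 8 8) ∷
    (neg1+ 1 , compare , form₄ 13 4 14 10 12 0 0 0 0 8 0 0 8 8 8) ∷
    (neg1+ 1 , compare , form₄ 7 6 8 4 4 0 0 0 0 0 0 8 8 0 0) ∷
    (pos 2 , compare , form₄ 7 8 4 4 6 0 0 0 0 0 8 0 0 8 0) ∷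
    (neg1+ 1 , compare , form₄ 3 4 2 4 4 0 0 0 0 0 8 0 0 8 0) ∷
    (neg1+ 1 , compare , form₄ 3 4 6 2 4 0 0 0 0 8 8 0 0 8 0) ∷
    (neg1+ 1 , peel , form₄ 7 10 4 4 18 0 0 0 8 0 8 8 0 8 8) ∷
    (pos 2 , peel , form₄ 3 10 0 4 6 0 8 0 0 0 8 8 0 0 8) ∷
    (pos 2 , parity , form₄ 13 0 10 12 14 2 0 0 0 0 0 0 8 8 8) ∷
    (pos 2 , peel , form₄ 5 10 4 6 8 0 0 0 8 8 8 0 8 0 0) ∷
    (pos 4 , compare , form₄ 13 10 12 0 14 0 0 8 0 8 0 8 0 8 0) ∷
    (pos 4 , compare , form₄ 13 0 22 12 14 8 8 0 0 0 0 0 8 16 8) ∷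
    (neg1+ 3 , compare , form₄ 13 10 12 14 22 0 0 0 16 8 8 8 8 8 16) ∷
    (pos 4 , compare , form₄ 23 0 30 10 22 8 8 0 0 0 0 0 8 16 8) ∷
    (pos 4 , compare , form₄ 31 22 46 10 16 0 16 0 8 16 8 0 8 16 0) ∷
    (neg1+ 3 , compare , form₄ 21 10 28 16 52 0 8 8 32 8 0 16 16 32 16) ∷
    (pos 4 , compare , form₄ 21 12 16 38 52 0 8 16 32 0 8 16 16 16 48) ∷
    (pos 4 , compare , form₄ 21 14 38 12 16 0 16 0 8 16 8 0 8 16 0) ∷
    (neg1+ 1 , compare , form₄ 7 8 4 4 14 0 0 0 0 8 0 0 0 8 8) ∷
    (neg1+ 1 , compare , form₄ 15 8 4 14 20 0 0 0 8 0 0 8 8 0 8) ∷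
    (neg1+ 1 , compare , form₄ 15 12 14 4 20 0 0 0 8 8 0 8 8 8 0) ∷
    (pos 2 , peel , form₄ 7 12 4 4 18 8 0 0 8 0 8 16 0 8 8) ∷
    (neg1+ 1 , compare , form₄ 7 14 4 4 12 0 0 0 8 8 8 8 0 8 0) ∷
    (pos 2 , peel , form₄ 21 20 12 14 26 8 0 0 8 0 8 16 8 8 8) ∷
    (neg1+ 1 , peel , form₄ 15 26 4 14 20 8 0 0 8 8 8 16 8 0 8) ∷
    (pos 2 , peel , form₃ 3 4 4 6 8 0 0 0 8 8) ∷
    (pos 2 , compare , form₃ 3 0 4 6 8 0 0 0 0 8) ∷
    (pos 2 , compare , form₄ 11 12 8 6 8 0 0 0 0 8 8 0 0 8 0) ∷
    (pos 2 , compare , form₄ 11 8 8 6 20 0 0 0 8 8 0 8 0 8 8) ∷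
    (pos 2 , peel , form₄ 11 8 6 16 20 0 0 8 8 0 8 8 0 8 16) ∷
    (neg1+ 3 , compare , form₄ 13 6 2 20 24 0 0 8 8 0 8 0 0 8 16) ∷
    (neg1+ 3 , compare , form₄ 11 2 18 6 16 0 8 0 8 0 0 8 8 8 0) ∷
    (neg1+ 3 , parity , form₄ 11 18 6 16 20 8 0 8 8 8 8 16 0 8 16) ∷
    (neg1+ 3 , peel , form₄ 11 36 6 16 20 32 0 8 8 16 16 32 0 8 16) ∷
    (pos 4 , compare , form₄ 9 20 16 6 8 8 8 0 8 16 8 16 8 0 0) ∷
    (neg1+ 3 , compare , form₄ 9 10 6 8 36 0 0 8 32 8 0 16 0 16 16) ∷
    (pos 4 , compare , form₄ 19 28 24 8 10 8 8 8 0 16 16 8 0 8 0) ∷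
    (neg1+ 3 , parity , form₄ 21 26 10 16 28 8 0 8 8 8 8 16 0 8 16) ∷
    (pos 4 , compare , form₄ 9 10 6 8 20 0 0 8 8 8 0 8 0 8 16) ∷
    (neg1+ 3 , compare , form₄ 5 6 4 2 16 0 0 0 8 8 0 0 0 8 8) ∷
    (pos 4 , compare , form₄ 3 2 2 8 10 0 0 8 8 0 8 0 0 8 8) ∷
    (neg1+ 3 , compare , form₄ 3 10 2 2 8 8 0 0 8 0 8 8 0 8 0) ∷
    (neg1+ 3 , compare , form₄ 3 6 4 2 8 0 0 0 8 8 8 0 0 8 0) ∷
    (neg1+ 3 , compare , form₄ 3 2 2 6 8 0 0 0 8 0 0 8 8 0 0) ∷
    (neg1+ 3 , parity , form₄ 9 18 6 8 10 8 0 8 0 8 8 8 0 8 0) ∷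
    (neg1+ 3 , peel , form₄ 35 18 14 16 68 0 0 8 32 8 0 16 0 16 16) ∷
    (pos 4 , peel , form₄ 35 20 14 16 68 0 0 8 32 8 0 16 0 16 16) ∷
    (pos 4 , compare , form₄ 55 16 20 22 84 8 0 0 32 0 0 16 8 16 16) ∷
    (neg1+ 3 , parity , form₄ 21 26 12 14 20 8 0 0 8 8 8 16 8 0 8) ∷
    (pos 4 , compare , form₄ 7 14 22 4 12 0 16 0 8 16 8 8 8 24 0) ∷
    (neg1+ 3 , parity , form₄ 7 18 4 12 22 8 0 8 16 8 16 24 0 8 24) ∷
    (neg1+ 3 , compare , form₄ 7 4 18 4 12 0 8 0 8 8 0 8 8 16 0) ∷
    (pos 4 , compare , form₄ 7 10 12 4 14 0 8 0 0 8 8 8 0 8 8) ∷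
    (pos 4 , compare , form₄ 17 22 30 10 12 0 16 0 0 16 8 8 8 8 8) ∷
    (neg1+ 3 , parity , form₄ 13 18 10 12 14 8 0 0 0 8 8 8 8 8 8) ∷
    (pos 4 , compare , form₄ 13 22 14 10 12 16 0 0 0 16 8 8 8 8 8) ∷
    (neg1+ 3 , parity , form₄ 17 26 10 12 30 8 0 0 16 8 8 24 8 8 8) ∷
    (neg1+ 3 , compare , form₄ 17 4 26 10 12 0 8 0 0 8 0 0 8 8 8) ∷
    (pos 4 , compare , form₄ 11 10 20 4 4 0 8 0 0 8 0 8 8 0 0) ∷
    (pos 2 , compare , form₄ 5 6 2 4 8 0 0 0 0 0 8 0 0 8 0) ∷
    (neg1+ 3 , compare , form₄ 3 2 2 8 12 0 0 8 8 0 8 0 0 8 16) ∷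
    (pos 4 , compare , form₄ 5 8 4 2 16 0 0 0 8 8 0 8 0 8 8) ∷
    (pos 2 , compare , form₄ 5 8 8 2 4 0 0 0 0 8 8 0 0 8 0) ∷
    (pos 2 , compare , form₄ 3 4 4 2 4 0 0 0 0 0 8 0 0 8 0) ∷
    (pos 2 , compare , form₄ 7 4 8 4 10 0 0 0 0 8 0 0 0 8 8) ∷
    (pos 2 , compare , form₄ 3 8 4 2 4 0 0 0 0 8 8 0 0 8 0) ∷
    (neg1+ 1 , compare , form₄ 11 4 4 10 20 0 0 0 8 0 8 0 0 8 8) ∷
    (pos 2 , peel , form₄ 7 8 4 10 12 0 0 0 8 0 8 8 8 0 8) ∷
    (pos 2 , compare , form₄ 3 4 4 2 12 0 0 0 8 8 0 8 0 8 8) ∷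
    (neg1+ 1 , peel , form₄ 3 4 2 8 12 0 0 8 8 0 8 8 0 8 16) ∷
    (neg1+ 1 , peel , form₄ 7 14 4 10 12 0 0 0 8 8 8 8 8 0 8) ∷
    (pos 2 , compare , form₄ 9 12 8 6 10 0 8 0 0 0 8 8 0 0 8) ∷
    (pos 2 , parity , form₄ 7 0 6 10 12 2 0 0 0 0 0 0 8 8 8) ∷
    (pos 2 , peel , form₄ 3 6 2 8 12 0 0 8 8 8 0 8 0 8 16) ∷
    (pos 2 , compare , form₄ 3 4 8 2 6 0 8 0 0 0 8 8 0 0 8) ∷
    (pos 2 , parity , form₄ 1 0 2 4 6 2 0 0 0 0 0 0 8 8 8) ∷
    (pos 2 , compare , form₄ 7 10 6 0 12 0 0 8 0 8 0 8 0 8 0) ∷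
    (pos 2 , compare , form₄ 7 0 12 6 16 8 0 0 8 0 0 0 8 16 8) ∷
    (pos 2 , compare , form₄ 17 0 20 10 24 8 0 0 8 0 0 0 8 16 8) ∷
    (pos 2 , compare , form₄ 17 20 24 10 20 8 8 0 0 16 8 0 8 16 8) ∷
    (pos 2 , compare , form₄ 25 36 24 10 16 8 8 0 8 16 8 16 8 0 0) ∷
    (neg1+ 1 , parity , form₄ 31 30 10 24 36 8 0 8 8 8 8 16 0 8 16) ∷
    (pos 2 , compare , form₄ 5 12 4 2 8 0 0 0 0 8 8 0 0 8 0) ∷
    (neg1+ 1 , compare , form₄ 7 10 6 4 8 0 0 0 0 8 8 0 0 8 0) ∷
    (pos 2 , compare , form₄ 7 8 8 4 6 0 0 0 0 8 8 0 0 8 0) ∷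
    (pos 2 , compare , form₄ 15 12 12 6 8 0 0 0 0 8 8 0 0 8 0) ∷
    (neg1+ 1 , compare , form₄ 13 14 10 4 8 0 0 0 0 8 8 0 0 8 0) ∷
    (neg1+ 1 , compare , form₄ 5 8 6 2 4 0 0 0 0 0 8 0 0 8 0) ∷
    (pos 2 , compare , form₄ 3 2 2 6 6 0 0 0 0 0 0 8 8 0 0) ∷
    (neg1+ 3 , compare , form₄ 3 6 2 2 6 0 0 0 0 8 0 0 0 0 8) ∷
    (pos 2 , compare , form₄ 7 2 6 4 8 0 0 0 0 0 8 0 0 8 0) ∷
    (neg1+ 1 , compare , form₄ 9 4 8 2 8 0 0 0 0 0 8 0 0 8 0) ∷
    (neg1+ 1 , compare , form₄ 13 10 12 4 8 0 0 0 0 8 8 0 0 8 0) ∷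
    (pos 2 , compare , form₄ 11 12 10 2 8 0 0 0 0 8 8 0 0 8 0) ∷
    (pos 2 , compare , form₄ 9 2 8 4 8 0 0 0 0 0 8 0 0 8 0) ∷
    (pos 2 , compare , form₄ 5 4 8 2 4 0 0 0 0 0 8 0 0 8 0) ∷
    (neg1+ 1 , compare , form₄ 5 2 8 4 4 0 0 0 0 0 0 8 8 0 0) ∷
    (neg1+ 1 , compare , form₄ 5 8 4 4 10 0 0 0 0 8 0 0 0 8 8) ∷
    (pos 2 , compare , form₄ 9 4 16 2 8 0 8 0 0 0 8 0 0 8 0) ∷
    (neg1+ 1 , compare , form₄ 9 8 2 4 16 0 0 0 8 0 0 8 8 0 0) ∷
    (pos 2 , compare , form₄ 9 8 8 4 10 0 0 0 0 8 0 0 0 8 8) ∷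
    (neg1+ 1 , compare , form₄ 9 10 4 2 16 0 0 0 8 8 0 8 8 0 0) ∷
    (pos 2 , compare , form₄ 9 4 10 8 16 0 0 0 8 8 0 0 8 8 8) ∷
    (neg1+ 1 , peel , form₄ 5 4 4 4 10 0 0 0 0 0 8 0 0 8 8) ∷
    (neg1+ 1 , compare , form₃ 5 10 4 4 0 0 0 8 8 0) ∷
    (neg1+ 1 , parity , form₃ 15 22 10 12 8 0 0 8 8 8) ∷
    (pos 2 , peel , form₃ 1 12 2 4 32 0 0 16 16 8) ∷
    (neg1+ 3 , compare , form₄ 7 2 8 4 6 0 0 0 0 0 8 0 0 8 0) ∷
    (pos 2 , compare , form₄ 3 6 6 2 2 0 0 0 0 0 0 8 8 0 0) ∷
    (pos 2 , peel , form₄ 3 6 2 2 12 0 0 0 0 0 8 0 0 8 8) ∷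
    (neg1+ 3 , compare , form₄ 9 6 2 6 16 0 0 0 8 0 0 8 8 0 0) ∷
    (neg1+ 3 , compare , form₄ 15 6 6 8 24 0 0 0 8 0 8 0 0 8 8) ∷
    (neg1+ 3 , compare , form₄ 9 6 8 2 16 0 0 0 8 8 8 0 0 8 0) ∷
    (neg1+ 1 , parity , form₄ 9 14 2 4 16 8 0 0 8 8 8 8 8 0 0) ∷
    (pos 2 , peel , form₄ 1 0 2 4 12 8 0 0 32 0 0 16 8 16 16) ∷
    (pos 2 , peel , form₄ 15 8 10 12 44 8 0 0 32 0 0 16 8 16 16) ∷
    (pos 2 , compare , form₄ 15 8 12 10 44 8 0 0 32 0 0 16 8 16 16) ∷
    (neg1+ 1 , parity , form₄ 15 22 10 12 20 8 0 0 8 8 8 16 8 8 0) ∷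
    (neg1+ 1 , compare , form₄ 5 10 4 4 12 0 0 0 8 8 8 8 0 8 0) ∷
    (pos 2 , peel , form₄ 5 12 4 4 14 8 0 0 8 0 8 16 0 8 8) ∷
    (neg1+ 1 , compare , form₄ 13 12 8 4 22 0 0 0 8 8 0 8 0 8 8) ∷
    (pos 2 , compare , form₄ 13 16 4 8 22 8 0 0 8 0 8 8 0 8 8) ∷
    (neg1+ 3 , compare , form₄ 15 10 12 8 44 0 0 8 32 8 0 16 0 16 16) ∷
    (neg1+ 3 , compare , form₄ 25 8 30 10 60 8 8 0 32 0 0 16 8 32 16) ∷
    (pos 4 , compare , form₄ 41 22 54 10 24 0 16 0 8 16 8 0 8 16 0) ∷
    (pos 4 , compare , form₄ 25 22 38 10 30 0 16 0 8 16 8 16 8 16 8) ∷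
    (pos 4 , compare , form₄ 25 8 30 10 22 8 8 0 0 0 0 0 8 16 8) ∷
    (pos 4 , compare , form₄ 15 10 12 8 14 0 0 8 0 8 0 8 0 8 0) ∷
    (neg1+ 3 , compare , form₄ 47 28 18 22 76 0 0 0 32 8 8 16 8 16 16) ∷
    (neg1+ 3 , parity , form₄ 25 30 10 14 16 8 0 0 8 8 8 8 8 0 0) ∷
    (neg1+ 3 , peel , form₄ 15 10 6 16 22 0 0 8 8 8 0 8 0 8 8) ∷
    (neg1+ 1 , compare , form₄ 25 14 10 16 60 0 0 8 32 8 0 16 0 16 16) ∷
    (pos 2 , compare , form₄ 15 16 28 6 16 8 8 0 8 16 8 0 8 16 0) ∷
    (pos 2 , compare , form₄ 11 14 30 2 16 0 16 0 8 16 8 0 8 16 0) ∷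
    (neg1+ 1 , compare , form₄ 3 0 14 2 28 8 8 0 32 0 0 16 8 32 16) ∷
    (neg1+ 1 , compare , form₄ 1 2 4 0 12 0 0 8 32 8 0 16 0 16 16) ∷
    (pos 2 , compare , form₄ 3 14 14 2 14 0 16 0 8 16 8 16 8 16 8) ∷
    (pos 2 , compare , form₄ 3 0 14 2 14 8 8 0 0 0 0 0 8 16 8) ∷
    (pos 2 , compare , form₄ 1 2 4 0 6 0 0 8 0 8 0 8 0 8 0) ∷
    (neg1+ 1 , compare , form₄ 17 20 10 14 44 0 0 0 32 8 8 16 8 16 16) ∷
    (neg1+ 3 , parity , form₄ 17 22 10 14 20 8 0 0 0 8 8 8 8 8 8) ∷
    (neg1+ 1 , compare , form₄ 17 14 10 20 44 0 0 0 32 8 8 16 8 16 16) ∷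
    (pos 2 , compare , form₄ 7 16 12 6 12 8 8 0 0 16 8 16 8 0 8) ∷
    (pos 2 , compare , form₄ 7 22 6 6 12 8 8 0 0 16 16 8 0 8 8) ∷
    (pos 2 , compare , form₄ 1 6 0 4 6 0 8 0 8 0 8 16 0 0 8) ∷
    (pos 2 , compare , form₄ 1 6 6 0 4 8 8 8 0 16 16 8 0 8 0) ∷
    (neg1+ 1 , compare , form₄ 7 0 6 12 28 8 0 0 32 0 0 16 8 16 16) ∷
    (pos 2 , compare , form₄ 7 0 12 6 28 8 0 0 32 0 0 16 8 16 16) ∷
    (pos 4 , compare , form₄ 29 38 22 14 20 8 8 0 0 16 16 8 0 8 8) ∷
    (pos 4 , compare , form₄ 15 14 8 12 22 0 8 0 8 0 8 16 0 0 8) ∷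
    (pos 4 , compare , form₄ 15 22 22 8 12 8 8 8 0 16 16 8 0 8 0) ∷
    (neg1+ 3 , compare , form₄ 29 8 14 20 60 8 0 0 32 0 0 16 8 16 16) ∷
    (neg1+ 3 , parity , form₄ 15 22 6 16 28 8 0 8 8 8 8 16 0 8 16) ∷
    (pos 4 , compare , form₄ 29 8 20 14 60 8 0 0 32 0 0 16 8 16 16) ∷
    (neg1+ 3 , parity , form₄ 7 14 6 12 12 8 0 0 8 8 8 16 8 8 0) ∷
    (pos 4 , peel , form₄ 15 28 6 16 22 8 0 8 8 8 16 16 0 8 8) ∷
    (neg1+ 3 , compare , form₄ 37 14 16 32 36 0 0 8 8 8 0 8 8 8 16) ∷
    (neg1+ 3 , compare , form₄ 21 16 12 6 24 0 0 0 8 8 8 8 0 8 0) ∷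
    (pos 4 , compare , form₄ 5 8 4 4 6 8 0 0 0 0 8 0 0 8 0) ∷
    (neg1+ 1 , peel , form₄ 5 4 4 6 8 0 0 0 8 0 0 8 8 0 0) ∷
    (pos 2 , compare , form₄ 5 4 4 4 6 0 0 0 0 8 0 0 0 0 8) ∷
    (neg1+ 1 , compare , form₄ 5 6 4 4 4 0 0 0 0 0 8 0 0 8 0) ∷
    (pos 2 , compare , form₄ 7 4 8 2 6 0 0 0 0 0 8 0 0 8 0) ∷
    (neg1+ 3 , compare , form₄ 7 10 4 6 12 0 0 0 0 8 8 8 0 0 8) ∷
    (neg1+ 1 , compare , form₄ 7 8 4 6 10 0 0 0 0 0 8 0 0 8 8) ∷
    (pos 2 , compare , form₄ 7 8 2 6 12 0 0 0 0 0 8 0 0 8 8) ∷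
    (pos 2 , peel , form₄ 7 2 6 10 12 0 0 0 0 0 0 8 8 8 8) ∷
    (neg1+ 1 , compare , form₄ 7 2 4 10 12 0 0 0 0 0 0 8 8 0 8) ∷
    (pos 2 , compare , form₄ 9 10 8 14 16 0 0 8 8 8 8 8 8 8 8) ∷
    (neg1+ 1 , compare , form₄ 19 2 24 10 22 0 8 0 8 0 0 8 8 8 8) ∷
    (pos 2 , compare , form₄ 11 10 8 2 22 0 0 0 8 8 0 8 0 8 8) ∷
    (neg1+ 1 , compare , form₄ 9 2 16 8 14 0 8 0 8 0 0 8 8 8 8) ∷
    (pos 4 , compare , form₄ 5 6 12 4 4 0 8 0 0 8 0 8 8 0 0) ∷
    (neg1+ 3 , compare , form₄ 7 4 14 6 12 0 8 0 0 8 0 0 8 8 8) ∷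
    (pos 4 , compare , form₄ 7 12 6 12 14 8 0 0 8 8 0 16 8 8 8) ∷
    (neg1+ 3 , compare , form₄ 5 14 4 4 12 8 0 0 8 8 8 16 0 8 0) ∷
    (pos 2 , compare , form₄ 31 36 10 24 30 8 0 8 8 8 16 16 0 8 8) ∷
    (neg1+ 1 , compare , form₄ 9 14 8 2 16 8 0 0 8 8 8 8 0 8 0) ∷
    (neg1+ 1 , compare , form₄ 37 30 16 32 36 8 0 8 8 8 8 16 8 8 16) ∷
    (pos 2 , compare , form₄ 9 20 2 8 16 8 0 0 8 8 8 16 0 0 8) ∷
    []

  -- Relates two odd and two even squares of sum 2k to four odd squares of sum 4k. The fact behind
  -- it: (x + u)² + (x - u)² + (y + v)² + (y - v)² is twice x² + y² + u² + v², and of the sign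
  -- choices for a pair of odd numbers exactly half make them congruent modulo 4, that is, of the
  -- form x + u, x - u with x odd and u even.
  squareSteps : List Step
  squareSteps =
    (neg1+ 0 , peel , form₄ 3 0 2 2 4 2 2 2 2 0 0 0 0 0 0) ∷
    (neg1+ 2 , peel , form₄ 1 0 0 2 2 2 2 2 2 0 0 0 0 0 0) ∷
    (pos 1 , peel , form₃ 1 0 2 2 2 2 2 0 0 0) ∷
    (neg1+ 0 , compare , form₄ 1 1 1 1 1 1 1 1 1 0 0 0 0 0 0) ∷
    (pos 1 , peel , form₄ 1 1 1 1 2 1 1 1 2 0 0 2 0 0 0) ∷
    (neg1+ 1 , compare , form₄ 1 1 1 1 2 1 1 1 2 0 0 0 0 0 2) ∷
    (pos 2 , peel , form₄ 1 1 1 2 2 1 1 2 2 0 0 2 2 0 0) ∷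
    (neg1+ 0 , peel , form₃ 1 1 2 2 1 2 2 0 2 0) ∷
    (pos 1 , compare , form₃ 1 1 1 2 1 1 2 0 0 0) ∷
    (neg1+ 3 , parity , form₄ 1 1 1 2 2 1 1 2 2 0 0 2 2 0 0) ∷
    (neg1+ 3 , parity , form₄ 3 1 2 4 6 1 2 2 4 2 0 0 0 0 4) ∷
    (pos 4 , compare , form₄ 3 0 2 4 6 2 2 2 4 0 0 0 0 0 4) ∷
    (pos 4 , compare , form₄ 1 0 2 0 2 2 2 2 2 0 0 0 0 0 0) ∷
    (pos 4 , compare , form₄ 1 0 2 2 2 2 2 2 4 0 0 0 0 0 4) ∷
    (neg1+ 3 , parity , form₄ 1 1 2 2 2 1 2 2 4 2 0 0 0 0 4) ∷
    (pos 4 , parity , form₃ 1 1 2 2 1 2 2 0 2 0) ∷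
    (neg1+ 3 , compare , form₃ 1 0 2 2 2 2 2 0 0 0) ∷
    []

  -- Classes of binary forms and sums of three squares

  linear : ∀ {n} → List (ℤ × Quad n) → Combination
  linear []            = []
  linear ((c , q) ∷ t) = (c , _ , q) ∷ linear t

  Family : Set
  Family = List (ℤ × Quad 3)

  -- Q + s x² + l x and Q + s (x + 1)² + l (x + 1), with x in front.
  extend extend⁺ : ℕ → ℕ → Quad 3 → Quad 4
  extend  s l q = quad s l (0 ∷ 0 ∷ 0 ∷ []) q
  extend⁺ s l q = shift (extend s l q)

  extendAll : (Quad 3 → Quad 4) → Family → Combination
  extendAll f []            = []
  extendAll f ((c , q) ∷ t) = (c , 4 , f q) ∷ extendAll f t

  conv-family : ∀ {N} (f : Quad 3 → Quad 4) (e : ℕ → ℕ) → (∀ q x xs → eval (f q) (x ∷ xs) ≡ e x ℕ.+ eval q xs) →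
    ∀ t k → k < N → conv N e (λ _ → 1ℤ) (⟦ linear t ⟧ N) k ≡ ⟦ extendAll f t ⟧ N k
  conv-family {N} f e split []            k k<N =
    Σ-zero N (λ x → Σ-zero N (λ j → ℤₚ.*-zeroʳ (δ (e x ℕ.+ j) k)))
  conv-family {N} f e split ((c , q) ∷ t) k k<N = trans (conv-+ N e (λ _ → 1ℤ) _ _ k) (cong₂ _+_
    (trans (conv-* N e (λ _ → 1ℤ) c _ k) (cong (c *_) (sym (count-conv (f q) q e (split q) k k<N))))
    (conv-family f e split t k k<N))

  eval-extend : ∀ s l q x xs → eval (extend s l q) (x ∷ xs) ≡ term s l x ℕ.+ eval q xs
  eval-extend s l q x (a ∷ b ∷ c ∷ []) = refl

  eval-extend⁺ : ∀ s l q x xs → eval (extend⁺ s l q) (x ∷ xs) ≡ term s l (suc x) ℕ.+ eval q xs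
  eval-extend⁺ s l q x xs = trans (eval-shift (extend s l q) x xs) (eval-extend s l q (suc x) xs)

  ⟦++⟧ : ∀ s t N k → ⟦ s ++ t ⟧ N k ≡ ⟦ s ⟧ N k + ⟦ t ⟧ N k
  ⟦++⟧ []            t N k = sym (ℤₚ.+-identityˡ _)
  ⟦++⟧ ((c , p) ∷ s) t N k = trans (cong (c * # N p k +_) (⟦++⟧ s t N k)) (sym (ℤₚ.+-assoc (c * # N p k) (⟦ s ⟧ N k) (⟦ t ⟧ N k)))

  negate : Combination → Combination
  negate []            = []
  negate ((c , p) ∷ t) = (- c , p) ∷ negate t

  ⟦negate⟧ : ∀ t N k → ⟦ negate t ⟧ N k ≡ - ⟦ t ⟧ N k
  ⟦negate⟧ []            N k = refl
  ⟦negate⟧ ((c , p) ∷ t) N k = trans (cong (- c * # N p k +_) (⟦negate⟧ t N k)) (e c (# N p k) (⟦ t ⟧ N k))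
    where
    e : ∀ c x y → - c * x + - y ≡ - (c * x + y)
    e = solve-∀

  certified-≡ : ∀ ss s t → run ss (reduced (s ++ negate t)) ≡ [] → ∀ {N} k → k < N → ⟦ s ⟧ N k ≡ ⟦ t ⟧ N k
  certified-≡ ss s t eq {N} k k<N = ℤₚ.i-j≡0⇒i≡j _ _ (begin
    ⟦ s ⟧ N k - ⟦ t ⟧ N k        ≡⟨ cong (⟦ s ⟧ N k +_) (sym (⟦negate⟧ t N k)) ⟩
    ⟦ s ⟧ N k + ⟦ negate t ⟧ N k ≡⟨ sym (⟦++⟧ s (negate t) N k) ⟩
    ⟦ s ++ negate t ⟧ N k        ≡⟨ certified ss (s ++ negate t) eq k k<N ⟩
    0ℤ                           ∎)

  divisorForms fourSquareForms : Combination
  divisorForms    = (pos 1 , _ , rectangle) ∷ (pos 2 , _ , staircases) ∷ []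
  fourSquareForms = (pos 1 , _ , fourPronics) ∷ []

  ⟦fourSquareForms⟧ : ∀ {N} k → odd k ≡ true → k < N → ⟦ fourSquareForms ⟧ N k ≡ ⟦ divisorForms ⟧ N k
  ⟦fourSquareForms⟧ {N} k odd-k k<N = begin
    1ℤ * count N fourPronics k + 0ℤ ≡⟨ e₁ (count N fourPronics k) ⟩
    count N fourPronics k           ≡⟨ fourPronics≡divisorSum k odd-k k<N ⟩
    divisorSum N k                  ≡⟨ e₂ (count N rectangle k) (count N staircases k) ⟩
    ⟦ divisorForms ⟧ N k            ∎
    where
    e₁ : ∀ x → 1ℤ * x + 0ℤ ≡ x
    e₁ = solve-∀
    e₂ : ∀ x y → x + pos 2 * y ≡ 1ℤ * x + (pos 2 * y + 0ℤ)
    e₂ = solve-∀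

  -- a² + b² + c² on one side and ab + bc + ca on the other, for the residues of a, b, c modulo 2 or 4 that
  -- are named in each case; j is (n + 1)/4 or (n + 1)/2 or n/2.
  triple : (c l₀ l₁ l₂ m₀₁ m₀₂ m₁₂ : ℕ) → Quad 3
  triple c l₀ l₁ l₂ m₀₁ m₀₂ m₁₂ = quad 0 l₀ (m₀₁ ∷ m₀₂ ∷ []) (quad 0 l₁ (m₁₂ ∷ []) (quad 0 l₂ [] (con c)))

  diagonal : (c s₀ l₀ s₁ l₁ s₂ l₂ : ℕ) → Quad 3
  diagonal c s₀ l₀ s₁ l₁ s₂ l₂ = quad s₀ l₀ (0 ∷ 0 ∷ []) (quad s₁ l₁ (0 ∷ []) (quad s₂ l₂ [] (con c)))

  1× : ∀ {n} → List (Quad n) → List (ℤ × Quad n)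
  1× = map (λ q → 1ℤ , q)

  -- n = 8t + 3: a, b, c odd.
  classes₃ squares₃ : List (Quad 3)
  classes₃ = triple 1 2 2 2 4 4 4 ∷ triple 7 6 6 6 4 4 4 ∷ []
  squares₃ = diagonal 1 1 1 1 1 1 1 ∷ []

  -- n = 4t + 1: a, b odd and c ∈ ℤ even; one odd and two even squares of integers.
  classes₁ squares₁ : List (Quad 3)
  classes₁ = triple 1 2 2 2 8 4 4 ∷ triple 3 6 6 2 8 4 4 ∷ triple 5 6 6 6 8 4 4 ∷ triple 11 10 10 6 8 4 4 ∷ []
  squares₁ = diagonal 1 2 2 2 0 2 0 ∷ diagonal 3 2 2 2 4 2 0 ∷ diagonal 3 2 2 2 0 2 4 ∷ diagonal 5 2 2 2 4 2 4 ∷ []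

  -- n = 4t + 2: a, b even, b > 0, and c odd; two odd squares and one even square of an integer.
  classes₂ squares₂ : List (Quad 3)
  classes₂ = triple 1 6 2 2 8 4 4 ∷ triple 7 10 6 6 8 4 4 ∷ []
  squares₂ = diagonal 1 2 2 2 2 2 0 ∷ diagonal 3 2 2 2 2 2 4 ∷ []

  module _ {N k : ℕ} (odd-k : odd k ≡ true) (k<N : k < N) where

    -- Adding an odd square to n = 4j - 1 gives 4k, and the square side is then `fourPronics`
    -- itself.
    convolved₃ : ⟦ extendAll (extend 1 1) (1× classes₃) ⟧ N k ≡ ⟦ extendAll (extend 1 1) (1× squares₃) ⟧ N k
    convolved₃ = trans (certified-≡ oddClassSteps (extendAll (extend 1 1) (1× classes₃)) divisorForms refl k k<N)
      (sym (⟦fourSquareForms⟧ k odd-k k<N))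

    -- Here n = 2j - 1 plus an odd square is 2k, so the square side counts two odd and two even
    -- squares of sum 2k.
    convolved₁ : ⟦ extendAll (extend 2 2) (1× classes₁) ⟧ N k ≡ ⟦ extendAll (extend 2 2) (1× squares₁) ⟧ N k
    convolved₁ = trans (certified-≡ classSteps₁ (extendAll (extend 2 2) (1× classes₁)) divisorForms refl k k<N)
      (trans (sym (⟦fourSquareForms⟧ k odd-k k<N))
        (sym (certified-≡ squareSteps (extendAll (extend 2 2) (1× squares₁)) fourSquareForms refl k k<N)))

    convolved₂ : ⟦ extendAll (extend 2 0) (1× classes₂) ++ extendAll (extend⁺ 2 0) (1× classes₂) ⟧ N k ≡
                 ⟦ extendAll (extend 2 0) (1× squares₂) ++ extendAll (extend⁺ 2 0) (1× squares₂) ⟧ N k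
    convolved₂ = trans (certified-≡ classSteps₂ (extendAll (extend 2 0) (1× classes₂) ++ extendAll (extend⁺ 2 0) (1× classes₂)) divisorForms refl k k<N)
      (trans (sym (⟦fourSquareForms⟧ k odd-k k<N))
        (sym (certified-≡ squareSteps (extendAll (extend 2 0) (1× squares₂) ++ extendAll (extend⁺ 2 0) (1× squares₂)) fourSquareForms refl k k<N)))

  -- Removing the fourth square

  conv-0 : ∀ N e f k → conv N e (λ _ → 0ℤ) f k ≡ 0ℤ
  conv-0 N e f k = Σ-zero N (λ x → Σ-zero N (λ j →
    trans (cong (δ (e x ℕ.+ j) k *_) (ℤₚ.*-zeroˡ (f j))) (ℤₚ.*-zeroʳ (δ (e x ℕ.+ j) k))))

  -- Both convolutions together multiply by the series of q^e(x) in which x > 0 counts 1 + v times: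
  -- v = 0 for an odd square with positive root, v = 1 for an even square whose root has either
  -- sign. Its constant term is 1, so it can be divided out.
  conv-cancel : ∀ {N} e (v : ℤ) → e 0 ≡ 0 → (∀ x → 0 < e (suc x)) → (∀ x → odd (e x) ≡ false) → (f g : ℕ → ℤ) →
    (∀ k → odd k ≡ true → k < N → conv N e (λ _ → 1ℤ) f k + conv N (λ x → e (suc x)) (λ _ → v) f k ≡
                                  conv N e (λ _ → 1ℤ) g k + conv N (λ x → e (suc x)) (λ _ → v) g k) →
    ∀ k → odd k ≡ true → k < N → f k ≡ g k
  conv-cancel {N} e v e0 epos even f g eq k odd-k k<N = difference (f k) (g k)
    (conv-determines e (λ _ _ → 1ℤ) (λ _ _ → v) h e0 epos even (λ _ _ _ ()) hyp k odd-k k<N)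
    where
    e⁺ : ℕ → ℕ
    e⁺ x = e (suc x)
    h : ℕ → ℤ
    h j = f j + - 1ℤ * g j
    difference : ∀ a b → a + - 1ℤ * b ≡ 0ℤ → a ≡ b
    difference a b eq = trans (e₀ a b) (trans (cong (_+ b) eq) (ℤₚ.+-identityˡ b))
      where
      e₀ : ∀ a b → a ≡ a + - 1ℤ * b + b
      e₀ = solve-∀
    conv-h : ∀ e w k → conv N e w h k ≡ conv N e w f k + - 1ℤ * conv N e w g k
    conv-h e w k = trans (conv-+ N e w f (λ j → - 1ℤ * g j) k) (cong (conv N e w f k +_) (conv-* N e w (- 1ℤ) g k))
    balance : ∀ a b c d → a + b ≡ c + d → (a + - 1ℤ * c) + (b + - 1ℤ * d) ≡ 0ℤ
    balance a b c d eq = trans (e₁ a b c d) (trans (cong (_+ - 1ℤ * (c + d)) eq) (e₂ (c + d)))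
      where
      e₁ : ∀ a b c d → (a + - 1ℤ * c) + (b + - 1ℤ * d) ≡ (a + b) + - 1ℤ * (c + d)
      e₁ = solve-∀
      e₂ : ∀ x → x + - 1ℤ * x ≡ 0ℤ
      e₂ = solve-∀
    hyp : ∀ k → odd k ≡ true → k < N → conv N e (λ _ → 1ℤ) h k + conv N (λ x → e (suc x)) (λ _ → v) h k ≡ 0ℤ
    hyp k ok k<N = trans (cong₂ _+_ (conv-h e (λ _ → 1ℤ) k) (conv-h e⁺ (λ _ → v) k))
      (balance (conv N e (λ _ → 1ℤ) f k) (conv N e⁺ (λ _ → v) f k)
              (conv N e (λ _ → 1ℤ) g k) (conv N e⁺ (λ _ → v) g k) (eq k ok k<N))

  -- From equal counts to solutions

  Σ-nonneg : ∀ N {f : ℕ → ℤ} → (∀ x → 0ℤ ℤ.≤ f x) → 0ℤ ℤ.≤ Σ< N f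
  Σ-nonneg zero    p = ℤₚ.≤-refl
  Σ-nonneg (suc N) p = ℤₚ.+-mono-≤ (p 0) (Σ-nonneg N (λ x → p (suc x)))

  Σ-term : ∀ N {f : ℕ → ℤ} x → x < N → (∀ x → 0ℤ ℤ.≤ f x) → f x ℤ.≤ Σ< N f
  Σ-term (suc N) {f} zero    x<N p = subst (ℤ._≤ Σ< (suc N) f) (ℤₚ.+-identityʳ (f 0))
    (ℤₚ.+-monoʳ-≤ (f 0) (Σ-nonneg N (λ x → p (suc x))))
  Σ-term (suc N) {f} (suc x) (s≤s x<N) p = subst (ℤ._≤ Σ< (suc N) f) (ℤₚ.+-identityˡ (f (suc x)))
    (ℤₚ.+-mono-≤ (p 0) (Σ-term N x x<N (λ x → p (suc x))))

  box-nonneg : ∀ N n {f : Vec ℕ n → ℤ} → (∀ xs → 0ℤ ℤ.≤ f xs) → 0ℤ ℤ.≤ box N n f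
  box-nonneg N zero    p = p []
  box-nonneg N (suc n) p = Σ-nonneg N (λ x → box-nonneg N n (λ xs → p (x ∷ xs)))

  box-term : ∀ N {n} {f : Vec ℕ n → ℤ} xs → All (_< N) xs → (∀ xs → 0ℤ ℤ.≤ f xs) → f xs ℤ.≤ box N n f
  box-term N []       []         p = ℤₚ.≤-refl
  box-term N (x ∷ xs) (x<N ∷ <N) p = ℤₚ.≤-trans (box-term N xs <N (λ xs → p (x ∷ xs)))
    (Σ-term N x x<N (λ x → box-nonneg N _ (λ xs → p (x ∷ xs))))

  δ-nonneg : ∀ a b → 0ℤ ℤ.≤ δ a b
  δ-nonneg a b with a ≡ᵇ b
  ... | true  = +≤+ z≤n
  ... | false = +≤+ z≤n

  count-nonneg : ∀ N {n} (q : Quad n) k → 0ℤ ℤ.≤ count N q k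
  count-nonneg N q k = box-nonneg N _ (λ xs → δ-nonneg (eval q xs) k)

  count-positive : ∀ N {n} (q : Quad n) k xs → All (_< N) xs → eval q xs ≡ k → 1ℤ ℤ.≤ count N q k
  count-positive N q k xs <N eq = subst (ℤ._≤ count N q k) (trans (cong (λ v → δ v k) eq) (δ-refl k))
    (box-term N xs <N (λ xs → δ-nonneg (eval q xs) k))

  Σ-find : ∀ N {f : ℕ → ℤ} → Σ< N f ≢ 0ℤ → ∃[ x ] f x ≢ 0ℤ
  Σ-find zero        ne = ⊥-elim (ne refl)
  Σ-find (suc N) {f} ne with f 0 ℤ.≟ 0ℤ
  ... | no f0≢0  = 0 , f0≢0
  ... | yes f0≡0 with Σ-find N (λ eq → ne (cong₂ _+_ f0≡0 eq))
  ... | x , fx≢0 = suc x , fx≢0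

  box-find : ∀ N n {f : Vec ℕ n → ℤ} → box N n f ≢ 0ℤ → ∃[ xs ] f xs ≢ 0ℤ
  box-find N zero    ne = [] , ne
  box-find N (suc n) ne with Σ-find N ne
  ... | x , ne′ with box-find N n ne′
  ... | xs , ne″ = x ∷ xs , ne″

  count-find : ∀ N {n} (q : Quad n) k → count N q k ≢ 0ℤ → ∃[ xs ] eval q xs ≡ k
  count-find N q k ne with box-find N _ ne
  ... | xs , δ≢0 with eval q xs ℕ.≟ k
  ... | yes eq = xs , eq
  ... | no neq = ⊥-elim (δ≢0 (δ-≢ (eval q xs) k neq))

  Represents : ℕ → Quad 3 → Set
  Represents k q = ∃[ xs ] eval q xs ≡ k

  family-nonneg : ∀ N (qs : List (Quad 3)) k → 0ℤ ℤ.≤ ⟦ linear (1× qs) ⟧ N k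
  family-nonneg N []       k = ℤₚ.≤-refl
  family-nonneg N (q ∷ qs) k = ℤₚ.+-mono-≤ (subst (0ℤ ℤ.≤_) (sym (ℤₚ.*-identityˡ (count N q k))) (count-nonneg N q k)) (family-nonneg N qs k)

  family-find : ∀ N (qs : List (Quad 3)) k → ⟦ linear (1× qs) ⟧ N k ≢ 0ℤ → Any (Represents k) qs
  family-find N []       k ne = ⊥-elim (ne refl)
  family-find N (q ∷ qs) k ne with count N q k ℤ.≟ 0ℤ
  ... | no c≢0  = here (count-find N q k c≢0)
  ... | yes c≡0 = there (family-find N qs k (λ eq → ne (cong₂ _+_ (cong (1ℤ *_) c≡0) eq)))

  Positive : ℕ → ℕ → Quad 3 → Set
  Positive N k q = ∃[ xs ] (All (_< N) xs × eval q xs ≡ k)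

  family-positive : ∀ N (qs : List (Quad 3)) k → Any (Positive N k) qs → 1ℤ ℤ.≤ ⟦ linear (1× qs) ⟧ N k
  family-positive N (q ∷ qs) k (here (xs , <N , eq)) =
    ℤₚ.+-mono-≤ (subst (1ℤ ℤ.≤_) (sym (ℤₚ.*-identityˡ (count N q k))) (count-positive N q k xs <N eq)) (family-nonneg N qs k)
  family-positive N (q ∷ qs) k (there p) =
    ℤₚ.+-mono-≤ (subst (0ℤ ℤ.≤_) (sym (ℤₚ.*-identityˡ (count N q k))) (count-nonneg N q k)) (family-positive N qs k p)

  transfer : ∀ N (qs rs : List (Quad 3)) k → Any (Positive N k) qs →
    ⟦ linear (1× qs) ⟧ N k ≡ ⟦ linear (1× rs) ⟧ N k → Any (Represents k) rs
  transfer N qs rs k p same = family-find N rs k (λ rs≡0 → impossible (trans same rs≡0))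
    where
    impossible : ⟦ linear (1× qs) ⟧ N k ≢ 0ℤ
    impossible eq with subst (1ℤ ℤ.≤_) eq (family-positive N qs k p)
    ... | +≤+ ()

  odd-term : ∀ l x → odd l ≡ false → odd (term 2 l x) ≡ false
  odd-term l x even-l = trans (odd-* x (2 ℕ.* x ℕ.+ l ℕ.+ 0)) (trans (cong (odd x ∧_) inner) (∧-false (odd x)))
    where
    ∧-false : ∀ b → b ∧ false ≡ false
    ∧-false true  = refl
    ∧-false false = refl
    inner : odd (2 ℕ.* x ℕ.+ l ℕ.+ 0) ≡ false
    inner = trans (cong odd (ℕₚ.+-identityʳ (2 ℕ.* x ℕ.+ l))) (trans (odd-+ (2 ℕ.* x) l) (cong₂ _xor_ (odd-* 2 x) even-l))

  -- Two class forms suffice: for odd a, b, c the number (ab + bc + ca + 1)/4 is odd exactly when a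
  -- ≡ b ≡ c (mod 4), so the entries are all 4x + 1 or all 4x + 3.
  same₃ : ∀ {N} k → odd k ≡ true → k < N → ⟦ linear (1× classes₃) ⟧ N k ≡ ⟦ linear (1× squares₃) ⟧ N k
  same₃ {N} = conv-cancel pronic 0ℤ refl (λ x → ℕₚ.<-≤-trans (s≤s z≤n) (x≤pronic (suc x))) odd-pronic
    (⟦ linear (1× classes₃) ⟧ N) (⟦ linear (1× squares₃) ⟧ N)
    (λ k odd-k k<N → cong₂ _+_
      (trans (conv-family (extend 1 1) pronic (eval-extend 1 1) (1× classes₃) k k<N)
        (trans (convolved₃ odd-k k<N) (sym (conv-family (extend 1 1) pronic (eval-extend 1 1) (1× squares₃) k k<N))))
      (trans (conv-0 N (λ x → pronic (suc x)) (⟦ linear (1× classes₃) ⟧ N) k)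
        (sym (conv-0 N (λ x → pronic (suc x)) (⟦ linear (1× squares₃) ⟧ N) k))))

  -- With c even and a, b odd, ab + c(a + b) ≡ ab (mod 4), so n ≡ 1 forces a ≡ b (mod 4), with
  -- residue 1 or 3. Each residue occurs with c = 2z and again with c = 2z + 2, which counts a
  -- nonzero c for both signs.
  same₁ : ∀ {N} k → odd k ≡ true → k < N → ⟦ linear (1× classes₁) ⟧ N k ≡ ⟦ linear (1× squares₁) ⟧ N k
  same₁ {N} = conv-cancel (term 2 2) 0ℤ refl (λ x → s≤s z≤n) (λ x → odd-term 2 x refl)
    (⟦ linear (1× classes₁) ⟧ N) (⟦ linear (1× squares₁) ⟧ N)
    (λ k odd-k k<N → cong₂ _+_
      (trans (conv-family (extend 2 2) (term 2 2) (eval-extend 2 2) (1× classes₁) k k<N)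
        (trans (convolved₁ odd-k k<N) (sym (conv-family (extend 2 2) (term 2 2) (eval-extend 2 2) (1× squares₁) k k<N))))
      (trans (conv-0 N (λ x → term 2 2 (suc x)) (⟦ linear (1× classes₁) ⟧ N) k)
        (sym (conv-0 N (λ x → term 2 2 (suc x)) (⟦ linear (1× squares₁) ⟧ N) k))))

  -- With a, b even and c odd, n ≡ 2 (mod 4) forces a + b ≡ 2 (mod 4): the class forms have (a, b) =
  -- (4x, 4y + 2) or (4x + 2, 4y + 4), and c = 2z + 1. The added square (2x)² has x in ℤ, which is
  -- the case v = 1 of `conv-cancel`.
  same₂ : ∀ {N} k → odd k ≡ true → k < N → ⟦ linear (1× classes₂) ⟧ N k ≡ ⟦ linear (1× squares₂) ⟧ N k
  same₂ {N} = conv-cancel (term 2 0) 1ℤ refl (λ x → s≤s z≤n) (λ x → odd-term 0 x refl)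
    (⟦ linear (1× classes₂) ⟧ N) (⟦ linear (1× squares₂) ⟧ N)
    (λ k odd-k k<N → trans (both classes₂ k k<N) (trans (convolved₂ odd-k k<N) (sym (both squares₂ k k<N))))
    where
    both : ∀ qs k → k < N →
      conv N (term 2 0) (λ _ → 1ℤ) (⟦ linear (1× qs) ⟧ N) k + conv N (λ x → term 2 0 (suc x)) (λ _ → 1ℤ) (⟦ linear (1× qs) ⟧ N) k ≡
      ⟦ extendAll (extend 2 0) (1× qs) ++ extendAll (extend⁺ 2 0) (1× qs) ⟧ N k
    both qs k k<N = trans (cong₂ _+_
        (conv-family (extend 2 0) (term 2 0) (eval-extend 2 0) (1× qs) k k<N)
        (conv-family (extend⁺ 2 0) (λ x → term 2 0 (suc x)) (eval-extend⁺ 2 0) (1× qs) k k<N))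
      (sym (⟦++⟧ (extendAll (extend 2 0) (1× qs)) (extendAll (extend⁺ 2 0) (1× qs)) N k))

  private
    t<N : ∀ t → t < suc (side t)
    t<N t = s≤s (ℕₚ.≤-trans (n≤double t) (ℕₚ.n≤1+n _))

    0<N : ∀ t → 0 < suc (side t)
    0<N t = s≤s z≤n

    k<N : ∀ t → side t < suc (side t)
    k<N t = ℕₚ.≤-refl

    odd-side : ∀ t → odd (side t) ≡ true
    odd-side t = cong not (odd-double t)

    witness : ∀ l₀ l₂ m₀₁ m₀₂ m₁₂ t → eval (triple 1 l₀ 2 l₂ m₀₁ m₀₂ m₁₂) (0 ∷ t ∷ 0 ∷ []) ≡ side t
    witness l₀ l₂ m₀₁ m₀₂ m₁₂ t = trans (cong (λ z → t ℕ.* (2 ℕ.+ z) ℕ.+ 1) (trans (ℕₚ.+-identityʳ _) (ℕₚ.*-zeroʳ m₁₂)))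
      (trans (e t) (cong suc (sym (double≡2* t))))
      where
      e : ∀ t → t ℕ.* (2 ℕ.+ 0) ℕ.+ 1 ≡ suc (2 ℕ.* t)
      e = solve-∀ℕ

  infix 8 _²
  _² : ℕ → ℕ
  x ² = x ℕ.* x

  private
    cancel-1 : ∀ {a b} → a ℕ.+ 1 ≡ b ℕ.+ 1 → a ≡ b
    cancel-1 {a} {b} = ℕₚ.+-cancelʳ-≡ 1 a b

  abstract
    -- The class (a, b, c) = (1, 4t + 1, 1) is always present.
    threeOddSquares : ∀ t → ∃[ x ] ∃[ y ] ∃[ z ] (8 ℕ.* t ℕ.+ 3 ≡ side x ² ℕ.+ side y ² ℕ.+ side z ²)
    threeOddSquares t = pick (transfer (suc (side t)) classes₃ squares₃ (side t)
        (here (0 ∷ t ∷ 0 ∷ [] , 0<N t ∷ t<N t ∷ 0<N t ∷ [] , witness 2 2 4 4 4 t)) (same₃ (side t) (odd-side t) (k<N t)))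
      where
      e₁ : ∀ t → 8 ℕ.* t ℕ.+ 3 ℕ.+ 1 ≡ 4 ℕ.* suc (2 ℕ.* t)
      e₁ = solve-∀ℕ
      e₂ : ∀ x y z → 4 ℕ.* (x ℕ.+ (y ℕ.+ (z ℕ.+ 1))) ≡ suc (4 ℕ.* x) ℕ.+ suc (4 ℕ.* y) ℕ.+ suc (4 ℕ.* z) ℕ.+ 1
      e₂ = solve-∀ℕ
      pick : Any (Represents (side t)) squares₃ → ∃[ x ] ∃[ y ] ∃[ z ] (8 ℕ.* t ℕ.+ 3 ≡ side x ² ℕ.+ side y ² ℕ.+ side z ²)
      pick (here (x ∷ y ∷ z ∷ [] , eq)) = x , y , z , cancel-1 (begin
        8 ℕ.* t ℕ.+ 3 ℕ.+ 1                                       ≡⟨ e₁ t ⟩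
        4 ℕ.* suc (2 ℕ.* t)                                       ≡⟨ cong (4 ℕ.*_) (trans (cong suc (sym (double≡2* t))) (sym eq)) ⟩
        4 ℕ.* (pronic x ℕ.+ (pronic y ℕ.+ (pronic z ℕ.+ 1)))      ≡⟨ e₂ (pronic x) (pronic y) (pronic z) ⟩
        suc (4 ℕ.* pronic x) ℕ.+ suc (4 ℕ.* pronic y) ℕ.+ suc (4 ℕ.* pronic z) ℕ.+ 1
          ≡⟨ cong (ℕ._+ 1) (sym (cong₂ ℕ._+_ (cong₂ ℕ._+_ (side² x) (side² y)) (side² z))) ⟩
        side x ² ℕ.+ side y ² ℕ.+ side z ² ℕ.+ 1                  ∎)

    -- The obvious class is (a, b, c) = (1, 4t + 1, 0). The four cases of `pick` say whether each
    -- even root comes from the form for a root that may be zero or for a positive one.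
    oddEvenEvenSquares : ∀ t → ∃[ x ] ∃[ y ] ∃[ z ] (4 ℕ.* t ℕ.+ 1 ≡ side x ² ℕ.+ (2 ℕ.* y) ² ℕ.+ (2 ℕ.* z) ²)
    oddEvenEvenSquares t = pick (transfer (suc (side t)) classes₁ squares₁ (side t)
        (here (0 ∷ t ∷ 0 ∷ [] , 0<N t ∷ t<N t ∷ 0<N t ∷ [] , witness 2 2 8 4 4 t)) (same₁ (side t) (odd-side t) (k<N t)))
      where
      finish : ∀ x y z → 2 ℕ.* pronic x ℕ.+ 1 ℕ.+ 2 ℕ.* y ² ℕ.+ 2 ℕ.* z ² ≡ side t →
        ∃[ x ] ∃[ y ] ∃[ z ] (4 ℕ.* t ℕ.+ 1 ≡ side x ² ℕ.+ (2 ℕ.* y) ² ℕ.+ (2 ℕ.* z) ²)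
      finish x y z eq = x , y , z , cancel-1 (begin
        4 ℕ.* t ℕ.+ 1 ℕ.+ 1     ≡⟨ e₁ t ⟩
        2 ℕ.* suc (2 ℕ.* t)     ≡⟨ cong (2 ℕ.*_) (trans (cong suc (sym (double≡2* t))) (sym eq)) ⟩
        2 ℕ.* (2 ℕ.* pronic x ℕ.+ 1 ℕ.+ 2 ℕ.* y ² ℕ.+ 2 ℕ.* z ²) ≡⟨ e₂ (pronic x) y z ⟩
        suc (4 ℕ.* pronic x) ℕ.+ (2 ℕ.* y) ² ℕ.+ (2 ℕ.* z) ² ℕ.+ 1
          ≡⟨ cong (λ s → s ℕ.+ (2 ℕ.* y) ² ℕ.+ (2 ℕ.* z) ² ℕ.+ 1) (sym (side² x)) ⟩
        side x ² ℕ.+ (2 ℕ.* y) ² ℕ.+ (2 ℕ.* z) ² ℕ.+ 1 ∎)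
        where
        e₁ : ∀ t → 4 ℕ.* t ℕ.+ 1 ℕ.+ 1 ≡ 2 ℕ.* suc (2 ℕ.* t)
        e₁ = solve-∀ℕ
        e₂ : ∀ x y z → 2 ℕ.* (2 ℕ.* x ℕ.+ 1 ℕ.+ 2 ℕ.* (y ℕ.* y) ℕ.+ 2 ℕ.* (z ℕ.* z)) ≡
          suc (4 ℕ.* x) ℕ.+ 2 ℕ.* y ℕ.* (2 ℕ.* y) ℕ.+ 2 ℕ.* z ℕ.* (2 ℕ.* z) ℕ.+ 1
        e₂ = solve-∀ℕ
      pick : Any (Represents (side t)) squares₁ → ∃[ x ] ∃[ y ] ∃[ z ] (4 ℕ.* t ℕ.+ 1 ≡ side x ² ℕ.+ (2 ℕ.* y) ² ℕ.+ (2 ℕ.* z) ²)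
      pick (here (x ∷ y ∷ z ∷ [] , eq)) = finish x y z (trans (e x y z) eq)
        where
        e : ∀ x y z → 2 ℕ.* (x ℕ.* (1 ℕ.* x ℕ.+ 1 ℕ.+ 0)) ℕ.+ 1 ℕ.+ 2 ℕ.* (y ℕ.* y) ℕ.+ 2 ℕ.* (z ℕ.* z) ≡
          x ℕ.* (2 ℕ.* x ℕ.+ 2 ℕ.+ 0) ℕ.+ (y ℕ.* (2 ℕ.* y ℕ.+ 0 ℕ.+ 0) ℕ.+ (z ℕ.* (2 ℕ.* z ℕ.+ 0 ℕ.+ 0) ℕ.+ 1))
        e = solve-∀ℕ
      pick (there (here (x ∷ y ∷ z ∷ [] , eq))) = finish x (suc y) z (trans (e x y z) eq)
        where
        e : ∀ x y z → 2 ℕ.* (x ℕ.* (1 ℕ.* x ℕ.+ 1 ℕ.+ 0)) ℕ.+ 1 ℕ.+ 2 ℕ.* (suc y ℕ.* suc y) ℕ.+ 2 ℕ.* (z ℕ.* z) ≡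
          x ℕ.* (2 ℕ.* x ℕ.+ 2 ℕ.+ 0) ℕ.+ (y ℕ.* (2 ℕ.* y ℕ.+ 4 ℕ.+ 0) ℕ.+ (z ℕ.* (2 ℕ.* z ℕ.+ 0 ℕ.+ 0) ℕ.+ 3))
        e = solve-∀ℕ
      pick (there (there (here (x ∷ y ∷ z ∷ [] , eq)))) = finish x y (suc z) (trans (e x y z) eq)
        where
        e : ∀ x y z → 2 ℕ.* (x ℕ.* (1 ℕ.* x ℕ.+ 1 ℕ.+ 0)) ℕ.+ 1 ℕ.+ 2 ℕ.* (y ℕ.* y) ℕ.+ 2 ℕ.* (suc z ℕ.* suc z) ≡
          x ℕ.* (2 ℕ.* x ℕ.+ 2 ℕ.+ 0) ℕ.+ (y ℕ.* (2 ℕ.* y ℕ.+ 0 ℕ.+ 0) ℕ.+ (z ℕ.* (2 ℕ.* z ℕ.+ 4 ℕ.+ 0) ℕ.+ 3))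
        e = solve-∀ℕ
      pick (there (there (there (here (x ∷ y ∷ z ∷ [] , eq))))) = finish x (suc y) (suc z) (trans (e x y z) eq)
        where
        e : ∀ x y z → 2 ℕ.* (x ℕ.* (1 ℕ.* x ℕ.+ 1 ℕ.+ 0)) ℕ.+ 1 ℕ.+ 2 ℕ.* (suc y ℕ.* suc y) ℕ.+ 2 ℕ.* (suc z ℕ.* suc z) ≡
          x ℕ.* (2 ℕ.* x ℕ.+ 2 ℕ.+ 0) ℕ.+ (y ℕ.* (2 ℕ.* y ℕ.+ 4 ℕ.+ 0) ℕ.+ (z ℕ.* (2 ℕ.* z ℕ.+ 4 ℕ.+ 0) ℕ.+ 5))
        e = solve-∀ℕ

    -- The obvious class is (a, b, c) = (0, 4t + 2, 1).
    oddOddEvenSquares : ∀ t → ∃[ x ] ∃[ y ] ∃[ z ] (4 ℕ.* t ℕ.+ 2 ≡ side x ² ℕ.+ side y ² ℕ.+ (2 ℕ.* z) ²)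
    oddOddEvenSquares t = pick (transfer (suc (side t)) classes₂ squares₂ (side t)
        (here (0 ∷ t ∷ 0 ∷ [] , 0<N t ∷ t<N t ∷ 0<N t ∷ [] , witness 6 2 8 4 4 t)) (same₂ (side t) (odd-side t) (k<N t)))
      where
      finish : ∀ x y z → 2 ℕ.* pronic x ℕ.+ 2 ℕ.* pronic y ℕ.+ 1 ℕ.+ 2 ℕ.* z ² ≡ side t →
        ∃[ x ] ∃[ y ] ∃[ z ] (4 ℕ.* t ℕ.+ 2 ≡ side x ² ℕ.+ side y ² ℕ.+ (2 ℕ.* z) ²)
      finish x y z eq = x , y , z , (begin
        4 ℕ.* t ℕ.+ 2           ≡⟨ e₁ t ⟩
        2 ℕ.* suc (2 ℕ.* t)     ≡⟨ cong (2 ℕ.*_) (trans (cong suc (sym (double≡2* t))) (sym eq)) ⟩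
        2 ℕ.* (2 ℕ.* pronic x ℕ.+ 2 ℕ.* pronic y ℕ.+ 1 ℕ.+ 2 ℕ.* z ²) ≡⟨ e₂ (pronic x) (pronic y) z ⟩
        suc (4 ℕ.* pronic x) ℕ.+ suc (4 ℕ.* pronic y) ℕ.+ (2 ℕ.* z) ²
          ≡⟨ cong₂ (λ a b → a ℕ.+ b ℕ.+ (2 ℕ.* z) ²) (sym (side² x)) (sym (side² y)) ⟩
        side x ² ℕ.+ side y ² ℕ.+ (2 ℕ.* z) ² ∎)
        where
        e₁ : ∀ t → 4 ℕ.* t ℕ.+ 2 ≡ 2 ℕ.* suc (2 ℕ.* t)
        e₁ = solve-∀ℕ
        e₂ : ∀ x y z → 2 ℕ.* (2 ℕ.* x ℕ.+ 2 ℕ.* y ℕ.+ 1 ℕ.+ 2 ℕ.* (z ℕ.* z)) ≡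
          suc (4 ℕ.* x) ℕ.+ suc (4 ℕ.* y) ℕ.+ 2 ℕ.* z ℕ.* (2 ℕ.* z)
        e₂ = solve-∀ℕ
      pick : Any (Represents (side t)) squares₂ → ∃[ x ] ∃[ y ] ∃[ z ] (4 ℕ.* t ℕ.+ 2 ≡ side x ² ℕ.+ side y ² ℕ.+ (2 ℕ.* z) ²)
      pick (here (x ∷ y ∷ z ∷ [] , eq)) = finish x y z (trans (e x y z) eq)
        where
        e : ∀ x y z → 2 ℕ.* (x ℕ.* (1 ℕ.* x ℕ.+ 1 ℕ.+ 0)) ℕ.+ 2 ℕ.* (y ℕ.* (1 ℕ.* y ℕ.+ 1 ℕ.+ 0)) ℕ.+ 1 ℕ.+ 2 ℕ.* (z ℕ.* z) ≡
          x ℕ.* (2 ℕ.* x ℕ.+ 2 ℕ.+ 0) ℕ.+ (y ℕ.* (2 ℕ.* y ℕ.+ 2 ℕ.+ 0) ℕ.+ (z ℕ.* (2 ℕ.* z ℕ.+ 0 ℕ.+ 0) ℕ.+ 1))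
        e = solve-∀ℕ
      pick (there (here (x ∷ y ∷ z ∷ [] , eq))) = finish x y (suc z) (trans (e x y z) eq)
        where
        e : ∀ x y z → 2 ℕ.* (x ℕ.* (1 ℕ.* x ℕ.+ 1 ℕ.+ 0)) ℕ.+ 2 ℕ.* (y ℕ.* (1 ℕ.* y ℕ.+ 1 ℕ.+ 0)) ℕ.+ 1 ℕ.+ 2 ℕ.* (suc z ℕ.* suc z) ≡
          x ℕ.* (2 ℕ.* x ℕ.+ 2 ℕ.+ 0) ℕ.+ (y ℕ.* (2 ℕ.* y ℕ.+ 2 ℕ.+ 0) ℕ.+ (z ℕ.* (2 ℕ.* z ℕ.+ 4 ℕ.+ 0) ℕ.+ 3))
        e = solve-∀ℕ

  -- Four squares with a prescribed sum

  square≡ : ∀ i → i * i ≡ pos (∣ i ∣ ℕ.* ∣ i ∣)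
  square≡ (pos n)    = sym (ℤₚ.pos-* n n)
  square≡ (neg1+ n)  = refl

  -- 3a = 3s² + (b − s)² + (t − u)² + (t − v)² + (u − v)² ≥ 3 + (b + 1)² if s ≤ −1.
  ¬negative : ∀ a b k t u v → neg1+ k + t + u + v ≡ pos b → neg1+ k * neg1+ k + t * t + u * u + v * v ≡ pos a →
    3 ℕ.* a < b ℕ.* b ℕ.+ 2 ℕ.* b ℕ.+ 4 → ⊥
  ¬negative a b k t u v sum squares bound = ℕₚ.<⇒≱ bound (ℕₚ.≤-trans (ℕₚ.m≤m+n _ rest) (ℕₚ.≤-reflexive (sym (ℤₚ.+-injective equality))))
    where
    sq : ℤ → ℕ
    sq i = ∣ i ∣ ℕ.* ∣ i ∣
    rest : ℕ
    rest = 4 ℕ.* (k ℕ.* k ℕ.+ 2 ℕ.* k) ℕ.+ 2 ℕ.* (b ℕ.* k) ℕ.+ sq (t - u) ℕ.+ sq (t - v) ℕ.+ sq (u - v)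
    s b′ : ℤ
    s = - (1ℤ + pos k)
    b′ = s + t + u + v
    e : ∀ k t u v → pos 3 * (- (1ℤ + k) * - (1ℤ + k) + t * t + u * u + v * v) ≡
      ((- (1ℤ + k) + t + u + v) * (- (1ℤ + k) + t + u + v) + pos 2 * (- (1ℤ + k) + t + u + v) + pos 4) +
      (pos 4 * (k * k + pos 2 * k) + pos 2 * ((- (1ℤ + k) + t + u + v) * k) + (t - u) * (t - u) + (t - v) * (t - v) + (u - v) * (u - v))
    e = solve-∀
    equality : pos (3 ℕ.* a) ≡ pos ((b ℕ.* b ℕ.+ 2 ℕ.* b ℕ.+ 4) ℕ.+ rest)
    equality = begin
      pos (3 ℕ.* a)   ≡⟨ ℤₚ.pos-* 3 a ⟩
      pos 3 * pos a   ≡⟨ cong (pos 3 *_) (sym squares) ⟩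
      pos 3 * (s * s + t * t + u * u + v * v) ≡⟨ e (pos k) t u v ⟩
      (b′ * b′ + pos 2 * b′ + pos 4) + (pos 4 * (pos k * pos k + pos 2 * pos k) + pos 2 * (b′ * pos k) + (t - u) * (t - u) + (t - v) * (t - v) + (u - v) * (u - v))
        ≡⟨ cong (λ z → (z * z + pos 2 * z + pos 4) + (pos 4 * (pos k * pos k + pos 2 * pos k) + pos 2 * (z * pos k) + (t - u) * (t - u) + (t - v) * (t - v) + (u - v) * (u - v))) sum ⟩
      (pos b * pos b + pos 2 * pos b + pos 4) + (pos 4 * (pos k * pos k + pos 2 * pos k) + pos 2 * (pos b * pos k) + (t - u) * (t - u) + (t - v) * (t - v) + (u - v) * (u - v))
        ≡⟨ cong₂ _+_
            (cong₂ (λ x y → x + y + pos 4) (sym (ℤₚ.pos-* b b)) (sym (ℤₚ.pos-* 2 b)))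
            (cong₂ _+_ (cong₂ _+_ (cong₂ _+_ (cong₂ _+_
               (trans (cong (pos 4 *_) (cong₂ _+_ (sym (ℤₚ.pos-* k k)) (sym (ℤₚ.pos-* 2 k)))) (sym (ℤₚ.pos-* 4 (k ℕ.* k ℕ.+ 2 ℕ.* k))))
               (trans (cong (pos 2 *_) (sym (ℤₚ.pos-* b k))) (sym (ℤₚ.pos-* 2 (b ℕ.* k)))))
               (square≡ (t - u))) (square≡ (t - v))) (square≡ (u - v))) ⟩
      pos ((b ℕ.* b ℕ.+ 2 ℕ.* b ℕ.+ 4) ℕ.+ rest) ∎

  FourSquares : ℕ → ℕ → Set
  FourSquares a b = ∃[ s ] ∃[ t ] ∃[ u ] ∃[ v ]
    (s ℕ.+ t ℕ.+ u ℕ.+ v ≡ b × s ℕ.* s ℕ.+ t ℕ.* t ℕ.+ u ℕ.* u ℕ.+ v ℕ.* v ≡ a)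

  naturals : ∀ a b s t u v → s + t + u + v ≡ pos b → s * s + t * t + u * u + v * v ≡ pos a →
    3 ℕ.* a < b ℕ.* b ℕ.+ 2 ℕ.* b ℕ.+ 4 → FourSquares a b
  naturals a b (neg1+ s) t u v p q r = ⊥-elim (¬negative a b s t u v p q r)
  naturals a b (pos s) (neg1+ t) u v p q r =
    ⊥-elim (¬negative a b t (pos s) u v (trans (e₁ (pos s) (neg1+ t) u v) p) (trans (e₁ (pos s * pos s) (neg1+ t * neg1+ t) (u * u) (v * v)) q) r)
    where
    e₁ : ∀ s t u v → t + s + u + v ≡ s + t + u + v
    e₁ = solve-∀
  naturals a b (pos s) (pos t) (neg1+ u) v p q r =
    ⊥-elim (¬negative a b u (pos s) (pos t) v (trans (e₁ (pos s) (pos t) (neg1+ u) v) p) (trans (e₁ (pos s * pos s) (pos t * pos t) (neg1+ u * neg1+ u) (v * v)) q) r)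
    where
    e₁ : ∀ s t u v → u + s + t + v ≡ s + t + u + v
    e₁ = solve-∀
  naturals a b (pos s) (pos t) (pos u) (neg1+ v) p q r =
    ⊥-elim (¬negative a b v (pos s) (pos t) (pos u) (trans (e₁ (pos s) (pos t) (pos u) (neg1+ v)) p) (trans (e₁ (pos s * pos s) (pos t * pos t) (pos u * pos u) (neg1+ v * neg1+ v)) q) r)
    where
    e₁ : ∀ s t u v → v + s + t + u ≡ s + t + u + v
    e₁ = solve-∀
  naturals a b (pos s) (pos t) (pos u) (pos v) p q r = s , t , u , v , ℤₚ.+-injective p ,
    ℤₚ.+-injective (trans (cong₂ _+_ (cong₂ _+_ (cong₂ _+_ (ℤₚ.pos-* s s) (ℤₚ.pos-* t t)) (ℤₚ.pos-* u u)) (ℤₚ.pos-* v v)) q)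

  private
    side≡ : ∀ n → pos (side n) ≡ 1ℤ + pos 2 * pos n
    side≡ n = trans (cong (λ d → pos (suc d)) (double≡2* n)) (cong (1ℤ +_) (ℤₚ.pos-* 2 n))
    sq : ∀ n → pos (side n ²) ≡ (1ℤ + pos 2 * pos n) * (1ℤ + pos 2 * pos n)
    sq n = trans (ℤₚ.pos-* (side n) (side n)) (cong₂ _*_ (side≡ n) (side≡ n))
    dbl : ∀ n → pos ((2 ℕ.* n) ²) ≡ (pos 2 * pos n) * (pos 2 * pos n)
    dbl n = trans (ℤₚ.pos-* (2 ℕ.* n) (2 ℕ.* n)) (cong₂ _*_ (ℤₚ.pos-* 2 n) (ℤₚ.pos-* 2 n))

  -- Cauchy's lemma: a three-square representation of 4a − b² yields the four squares.
  cauchy-odd : ∀ a β x y z → 4 ℕ.* a ≡ side β ² ℕ.+ (side x ² ℕ.+ side y ² ℕ.+ side z ²) →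
    3 ℕ.* a < side β ℕ.* side β ℕ.+ 2 ℕ.* side β ℕ.+ 4 → FourSquares a (side β)
  cauchy-odd a β x y z eq bound = cases (halve (β ℕ.+ x ℕ.+ y ℕ.+ z))
    where
    eqℤ : pos 4 * pos a ≡ (1ℤ + pos 2 * pos β) * (1ℤ + pos 2 * pos β) + ((1ℤ + pos 2 * pos x) * (1ℤ + pos 2 * pos x) +
       (1ℤ + pos 2 * pos y) * (1ℤ + pos 2 * pos y) + (1ℤ + pos 2 * pos z) * (1ℤ + pos 2 * pos z))
    eqℤ = trans (sym (ℤₚ.pos-* 4 a)) (trans (cong pos eq) (cong₂ _+_ (sq β) (cong₂ _+_ (cong₂ _+_ (sq x) (sq y)) (sq z))))
    cases : ∃[ k ] (β ℕ.+ x ℕ.+ y ℕ.+ z ≡ double k ⊎ β ℕ.+ x ℕ.+ y ℕ.+ z ≡ suc (double k)) → FourSquares a (side β)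
    -- With X, Y, Z the three odd roots, the four numbers are (b ± X ± Y ± Z)/4 with an even number
    -- of minus signs; b + X + Y + Z = 2(β + x + y + z) + 4 is divisible by 4 in this case.
    cases (k , inj₁ even) = naturals a (side β) (pos k + 1ℤ) (pos k - pos y - pos z) (pos k - pos x - pos z) (pos k - pos x - pos y)
      (trans (trans (e₁ (pos k) (pos x) (pos y) (pos z)) (cong (λ b → 1ℤ + pos 2 * b) β≡)) (sym (side≡ β)))
      (ℤₚ.*-cancelˡ-≡ (pos 4) _ _ (trans (trans (e₂ (pos k) (pos x) (pos y) (pos z))
         (cong (λ b → (1ℤ + pos 2 * b) * (1ℤ + pos 2 * b) + ((1ℤ + pos 2 * pos x) * (1ℤ + pos 2 * pos x) +
       (1ℤ + pos 2 * pos y) * (1ℤ + pos 2 * pos y) + (1ℤ + pos 2 * pos z) * (1ℤ + pos 2 * pos z))) β≡)) (sym eqℤ)))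
      bound
      where
      β≡ : pos 2 * pos k - pos x - pos y - pos z ≡ pos β
      β≡ = trans (cong (λ n → n - pos x - pos y - pos z) (trans (sym (ℤₚ.pos-* 2 k)) (cong pos (trans (sym (double≡2* k)) (sym even)))))
                 (e (pos β) (pos x) (pos y) (pos z))
        where
        e : ∀ b x y z → b + x + y + z - x - y - z ≡ b
        e = solve-∀
      e₁ : ∀ k x y z → (k + 1ℤ) + (k - y - z) + (k - x - z) + (k - x - y) ≡ 1ℤ + pos 2 * (pos 2 * k - x - y - z)
      e₁ = solve-∀
      e₂ : ∀ k x y z → pos 4 * ((k + 1ℤ) * (k + 1ℤ) + (k - y - z) * (k - y - z) + (k - x - z) * (k - x - z) + (k - x - y) * (k - x - y)) ≡
        (1ℤ + pos 2 * (pos 2 * k - x - y - z)) * (1ℤ + pos 2 * (pos 2 * k - x - y - z)) +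
        ((1ℤ + pos 2 * x) * (1ℤ + pos 2 * x) + (1ℤ + pos 2 * y) * (1ℤ + pos 2 * y) + (1ℤ + pos 2 * z) * (1ℤ + pos 2 * z))
      e₂ = solve-∀
    -- Reversing the sign of Z changes the sum by 2 modulo 4, so now the combinations with an odd
    -- number of minus signs are divisible by 4.
    cases (k , inj₂ odd) = naturals a (side β) (pos k + 1ℤ - pos z) (pos k + 1ℤ - pos y) (pos k + 1ℤ - pos x) (pos k - pos x - pos y - pos z)
      (trans (trans (e₁ (pos k) (pos x) (pos y) (pos z)) (cong (λ b → 1ℤ + pos 2 * b) β≡)) (sym (side≡ β)))
      (ℤₚ.*-cancelˡ-≡ (pos 4) _ _ (trans (trans (e₂ (pos k) (pos x) (pos y) (pos z))
         (cong (λ b → (1ℤ + pos 2 * b) * (1ℤ + pos 2 * b) + ((1ℤ + pos 2 * pos x) * (1ℤ + pos 2 * pos x) +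
       (1ℤ + pos 2 * pos y) * (1ℤ + pos 2 * pos y) + (1ℤ + pos 2 * pos z) * (1ℤ + pos 2 * pos z))) β≡)) (sym eqℤ)))
      bound
      where
      β≡ : 1ℤ + pos 2 * pos k - pos x - pos y - pos z ≡ pos β
      β≡ = trans (cong (λ n → 1ℤ + n - pos x - pos y - pos z) (trans (sym (ℤₚ.pos-* 2 k)) (cong pos (sym (double≡2* k)))))
                 (trans (cong (λ n → pos n - pos x - pos y - pos z) (sym odd)) (e (pos β) (pos x) (pos y) (pos z)))
        where
        e : ∀ b x y z → b + x + y + z - x - y - z ≡ b
        e = solve-∀
      e₁ : ∀ k x y z → (k + 1ℤ - z) + (k + 1ℤ - y) + (k + 1ℤ - x) + (k - x - y - z) ≡ 1ℤ + pos 2 * (1ℤ + pos 2 * k - x - y - z)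
      e₁ = solve-∀
      e₂ : ∀ k x y z → pos 4 * ((k + 1ℤ - z) * (k + 1ℤ - z) + (k + 1ℤ - y) * (k + 1ℤ - y) + (k + 1ℤ - x) * (k + 1ℤ - x) + (k - x - y - z) * (k - x - y - z)) ≡
        (1ℤ + pos 2 * (1ℤ + pos 2 * k - x - y - z)) * (1ℤ + pos 2 * (1ℤ + pos 2 * k - x - y - z)) +
        ((1ℤ + pos 2 * x) * (1ℤ + pos 2 * x) + (1ℤ + pos 2 * y) * (1ℤ + pos 2 * y) + (1ℤ + pos 2 * z) * (1ℤ + pos 2 * z))
      e₂ = solve-∀

  -- For even b it is enough to halve: the numbers are (b/2 ± X ± Y ± Z)/2 with an even number of
  -- minus signs, and they are integers because exactly two of b/2, X, Y, Z are odd. In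
  -- `cauchy-even₁` these are b/2 and X, here X and Y.
  cauchy-even₀ : ∀ γ x y z → let a = (2 ℕ.* γ) ² ℕ.+ (side x ² ℕ.+ side y ² ℕ.+ (2 ℕ.* z) ²); b = 4 ℕ.* γ in
    3 ℕ.* a < b ℕ.* b ℕ.+ 2 ℕ.* b ℕ.+ 4 → FourSquares a b
  cauchy-even₀ γ x y z = naturals _ _ (g + X + Y + Z + 1ℤ) (g + X - Y - Z) (g - X + Y - Z) (g - X - Y + Z - 1ℤ)
    (trans (e₁ g X Y Z) (sym (ℤₚ.pos-* 4 γ)))
    (trans (e₂ g X Y Z) (sym (cong₂ _+_ (dbl γ) (cong₂ _+_ (cong₂ _+_ (sq x) (sq y)) (dbl z)))))
    where
    g X Y Z : ℤ
    g = pos γ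
    X = pos x
    Y = pos y
    Z = pos z
    e₁ : ∀ g x y z → (g + x + y + z + 1ℤ) + (g + x - y - z) + (g - x + y - z) + (g - x - y + z - 1ℤ) ≡ pos 4 * g
    e₁ = solve-∀
    e₂ : ∀ g x y z → (g + x + y + z + 1ℤ) * (g + x + y + z + 1ℤ) + (g + x - y - z) * (g + x - y - z) + (g - x + y - z) * (g - x + y - z) + (g - x - y + z - 1ℤ) * (g - x - y + z - 1ℤ) ≡
      (pos 2 * g) * (pos 2 * g) + ((1ℤ + pos 2 * x) * (1ℤ + pos 2 * x) + (1ℤ + pos 2 * y) * (1ℤ + pos 2 * y) + (pos 2 * z) * (pos 2 * z))
    e₂ = solve-∀

  cauchy-even₁ : ∀ γ x y z → let a = side γ ² ℕ.+ (side x ² ℕ.+ (2 ℕ.* y) ² ℕ.+ (2 ℕ.* z) ²); b = 4 ℕ.* γ ℕ.+ 2 in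
    3 ℕ.* a < b ℕ.* b ℕ.+ 2 ℕ.* b ℕ.+ 4 → FourSquares a b
  cauchy-even₁ γ x y z = naturals _ _ (g + X + Y + Z + 1ℤ) (g + X - Y - Z + 1ℤ) (g - X + Y - Z) (g - X - Y + Z)
    (trans (e₁ g X Y Z) (cong (_+ pos 2) (sym (ℤₚ.pos-* 4 γ))))
    (trans (e₂ g X Y Z) (sym (cong₂ _+_ (sq γ) (cong₂ _+_ (cong₂ _+_ (sq x) (dbl y)) (dbl z)))))
    where
    g X Y Z : ℤ
    g = pos γ
    X = pos x
    Y = pos y
    Z = pos z
    e₁ : ∀ g x y z → (g + x + y + z + 1ℤ) + (g + x - y - z + 1ℤ) + (g - x + y - z) + (g - x - y + z) ≡ pos 4 * g + pos 2
    e₁ = solve-∀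
    e₂ : ∀ g x y z → (g + x + y + z + 1ℤ) * (g + x + y + z + 1ℤ) + (g + x - y - z + 1ℤ) * (g + x - y - z + 1ℤ) + (g - x + y - z) * (g - x + y - z) + (g - x - y + z) * (g - x - y + z) ≡
      (1ℤ + pos 2 * g) * (1ℤ + pos 2 * g) + ((1ℤ + pos 2 * x) * (1ℤ + pos 2 * x) + (pos 2 * y) * (pos 2 * y) + (pos 2 * z) * (pos 2 * z))
    e₂ = solve-∀

open ThreeSquares using (double; double≡2*; odd; odd-double; halve; side; side²; pronic; pronic≡; _²;
  threeOddSquares; oddEvenEvenSquares; oddOddEvenSquares; FourSquares; cauchy-odd; cauchy-even₀; cauchy-even₁)
open import Defs
open import Data.Nat using (ℕ; zero; suc; _+_; _*_; _∸_; _^_; _≤_; _<_; z≤n; s≤s; _<?_; _≤?_; NonZero; >-nonZero)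
open import Data.Nat.Divisibility using (_∣_; divides; ∣m+n∣m⇒∣n; n∣m*n; m∣m*n; ∣⇒≤; ∣-trans)
open import Data.Nat.DivMod using (_/_; _%_; m≡m%n+[m/n]*n; m%n<n)
open import Data.Nat.Properties
open import Data.Nat.Tactic.RingSolver using (solve-∀)
open import Data.Fin using (toℕ; fromℕ<)
open import Data.Fin.Properties using (pigeonhole; toℕ-fromℕ<)
open import Data.Bool using (Bool; true; false; not)
open import Data.Empty using (⊥; ⊥-elim)
open import Data.Product using (∃-syntax; _×_; _,_)
open import Data.Sum using (_⊎_; inj₁; inj₂)
open import Relation.Nullary using (¬_; yes; no)
open import Relation.Binary.PropositionalEquality

-- Part (i)

2choose2 : ∀ n → 2 * choose2 n + n ≡ n * n
2choose2 zero    = refl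
2choose2 (suc n) = trans (e (choose2 n) n) (trans (cong (λ s → s + 2 * n + 1) (2choose2 n)) (e′ n))
  where
  e : ∀ c n → 2 * (c + n) + suc n ≡ 2 * c + n + 2 * n + 1
  e = solve-∀
  e′ : ∀ n → n * n + 2 * n + 1 ≡ suc n * suc n
  e′ = solve-∀

polygonal-+2 : ∀ m x → polygonal (m + 2) x ≡ m * choose2 x + x
polygonal-+2 m x = cong (λ k → k * choose2 x + x) (m+n∸n≡m m 2)

pronic-even : ∀ n → pronic n ≡ 2 * choose2 (suc n)
pronic-even n = trans (pronic≡ n) (+-cancelʳ-≡ (suc n) _ _ (trans (e n) (sym (2choose2 (suc n)))))
  where
  e : ∀ n → n * suc n + suc n ≡ suc n * suc n
  e = solve-∀

-- Writing a = b + 2h keeps (m/2)(a - b) + b in ℕ: the sum of the binomials is h, whatever the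
-- parity of m.
sumOfFour : ∀ m h b → FourSquares (b + 2 * h) b → SumOfFour (m + 2) (b + h * m)
sumOfFour m h b (s , t , u , v , sum , squares) = s , t , u , v , (begin
  polygonal (m + 2) s + polygonal (m + 2) t + polygonal (m + 2) u + polygonal (m + 2) v
    ≡⟨ cong₂ _+_ (cong₂ _+_ (cong₂ _+_ (polygonal-+2 m s) (polygonal-+2 m t)) (polygonal-+2 m u)) (polygonal-+2 m v) ⟩
  (m * choose2 s + s) + (m * choose2 t + t) + (m * choose2 u + u) + (m * choose2 v + v)
    ≡⟨ e m (choose2 s) (choose2 t) (choose2 u) (choose2 v) s t u v ⟩
  (s + t + u + v) + C * m
    ≡⟨ cong₂ (λ x y → x + y * m) sum C≡h ⟩
  b + h * m ∎)
  where
  open ≡-Reasoning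
  C : ℕ
  C = choose2 s + choose2 t + choose2 u + choose2 v
  e : ∀ m a b c d s t u v → (m * a + s) + (m * b + t) + (m * c + u) + (m * d + v) ≡ (s + t + u + v) + (a + b + c + d) * m
  e = solve-∀
  e′ : ∀ a b c d s t u v → (s + t + u + v) + 2 * (a + b + c + d) ≡ (2 * a + s) + (2 * b + t) + (2 * c + u) + (2 * d + v)
  e′ = solve-∀
  C≡h : C ≡ h
  C≡h = *-cancelˡ-≡ C h 2 (+-cancelˡ-≡ b _ _ (begin
    b + 2 * C                   ≡⟨ cong (_+ 2 * C) (sym sum) ⟩
    (s + t + u + v) + 2 * C     ≡⟨ e′ (choose2 s) (choose2 t) (choose2 u) (choose2 v) s t u v ⟩
    (2 * choose2 s + s) + (2 * choose2 t + t) + (2 * choose2 u + u) + (2 * choose2 v + v)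
      ≡⟨ cong₂ _+_ (cong₂ _+_ (cong₂ _+_ (2choose2 s) (2choose2 t)) (2choose2 u)) (2choose2 v) ⟩
    s * s + t * t + u * u + v * v ≡⟨ squares ⟩
    b + 2 * h ∎))

-- The first inequality makes 4a - b² a natural number, the second excludes negative xᵢ.
Within : ℕ → ℕ → Set
Within a b = b * b ≤ 4 * a × 3 * a < b * b + 2 * b + 4

-- An odd b has b² = 8T + 1 with T triangular, so 4a - b² = 8(α - T) + 3 is a sum of three odd
-- squares.
odd-case : ∀ α β → Within (suc (2 * α)) (side β) → FourSquares (suc (2 * α)) (side β)
odd-case α β (lower , upper) = go (m≤n⇒∃[o]m+o≡n T≤α)
  where
  T : ℕ
  T = choose2 (suc β)
  side²≡ : side β ² ≡ suc (8 * T)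
  side²≡ = trans (side² β) (cong suc (trans (cong (4 *_) (pronic-even β)) (sym (*-assoc 4 2 T))))
  T≤α : T ≤ α
  T≤α = ≤-pred (*-cancelˡ-< 8 T (suc α) (≤-trans (≤-reflexive (sym side²≡)) (≤-trans lower
    (≤-trans (m≤m+n _ 4) (≤-reflexive (e α))))))
    where
    e : ∀ α → 4 * suc (2 * α) + 4 ≡ 8 * suc α
    e = solve-∀
  go : ∃[ t ] (T + t ≡ α) → FourSquares (suc (2 * α)) (side β)
  go (t , refl) with threeOddSquares t
  ... | x , y , z , eq = cauchy-odd (suc (2 * (T + t))) β x y z (trans (e T t) (cong₂ _+_ (sym side²≡) eq)) upper
    where
    e : ∀ T t → 4 * suc (2 * (T + t)) ≡ suc (8 * T) + (8 * t + 3)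
    e = solve-∀

-- Modulo 4, a - β² is 2 for even β and 1 for odd β, and both residues are available.
even-case : ∀ α β → Within (4 * α + 2) (2 * β) → FourSquares (4 * α + 2) (2 * β)
even-case α β (lower , upper) with halve β
... | γ , inj₁ refl = go (m≤n⇒∃[o]m+o≡n γ²≤α)
  where
  b≡ : 2 * double γ ≡ 4 * γ
  b≡ = trans (cong (2 *_) (double≡2* γ)) (sym (*-assoc 2 2 γ))
  γ²≤α : γ * γ ≤ α
  γ²≤α = ≤-pred (*-cancelˡ-< 16 (γ * γ) (suc α) (≤-<-trans (≤-trans (≤-reflexive (trans (e γ) (sym (cong (λ b → b * b) b≡)))) lower)
    (<-≤-trans (m<m+n (4 * (4 * α + 2)) (s≤s z≤n)) (≤-reflexive (e′ α)))))
    where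
    e : ∀ γ → 16 * (γ * γ) ≡ 4 * γ * (4 * γ)
    e = solve-∀
    e′ : ∀ α → 4 * (4 * α + 2) + 8 ≡ 16 * suc α
    e′ = solve-∀
  go : ∃[ t ] (γ * γ + t ≡ α) → FourSquares (4 * α + 2) (2 * double γ)
  go (t , refl) with oddOddEvenSquares t
  ... | x , y , z , eq = subst₂ FourSquares (sym a≡) (sym b≡)
          (cauchy-even₀ γ x y z (subst₂ (λ a b → 3 * a < b * b + 2 * b + 4) a≡ b≡ upper))
    where
    e : ∀ γ t → 4 * (γ * γ + t) + 2 ≡ 2 * γ * (2 * γ) + (4 * t + 2)
    e = solve-∀
    a≡ : 4 * (γ * γ + t) + 2 ≡ (2 * γ) ² + (side x ² + side y ² + (2 * z) ²)
    a≡ = trans (e γ t) (cong ((2 * γ) ² +_) eq)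
... | γ , inj₂ refl = go (m≤n⇒∃[o]m+o≡n p≤α)
  where
  b≡ : 2 * side γ ≡ 4 * γ + 2
  b≡ = trans (cong (λ d → 2 * suc d) (double≡2* γ)) (e γ)
    where
    e : ∀ γ → 2 * suc (2 * γ) ≡ 4 * γ + 2
    e = solve-∀
  p≤α : pronic γ ≤ α
  p≤α = ≤-pred (*-cancelˡ-< 16 (pronic γ) (suc α) (≤-<-trans (≤-trans (≤-trans (m≤m+n (16 * pronic γ) 4)
    (≤-reflexive (trans (trans (e (pronic γ)) (cong (4 *_) (sym (side² γ)))) (e″ (side γ))))) lower)
    (<-≤-trans (m<m+n (4 * (4 * α + 2)) (s≤s z≤n)) (≤-reflexive (e′ α)))))
    where
    e : ∀ p → 16 * p + 4 ≡ 4 * suc (4 * p)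
    e = solve-∀
    e″ : ∀ s → 4 * (s * s) ≡ 2 * s * (2 * s)
    e″ = solve-∀
    e′ : ∀ α → 4 * (4 * α + 2) + 8 ≡ 16 * suc α
    e′ = solve-∀
  go : ∃[ t ] (pronic γ + t ≡ α) → FourSquares (4 * α + 2) (2 * side γ)
  go (t , refl) with oddEvenEvenSquares t
  ... | x , y , z , eq = subst₂ FourSquares (sym a≡) (sym b≡)
          (cauchy-even₁ γ x y z (subst₂ (λ a b → 3 * a < b * b + 2 * b + 4) a≡ b≡ upper))
    where
    e : ∀ p t → 4 * (p + t) + 2 ≡ suc (4 * p) + (4 * t + 1)
    e = solve-∀
    a≡ : 4 * (pronic γ + t) + 2 ≡ side γ ² + (side x ² + (2 * y) ² + (2 * z) ²)
    a≡ = trans (e (pronic γ) t) (cong₂ _+_ (sym (side² γ)) eq)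

-- The window for b

boundary : (f : ℕ → ℕ) (k n : ℕ) → f 0 ≤ k → k < f n → ∃[ c ] (f c ≤ k × k < f (suc c))
boundary f k zero    lo hi = ⊥-elim (<⇒≱ hi lo)
boundary f k (suc n) lo hi with k <? f n
... | yes p = boundary f k n lo p
... | no ¬p = n , ≮⇒≥ ¬p , hi

-- The lower end of the window, where 3a < b² + 2b + 4 is tight: 28 is what makes (√8 − √6)√28 > 2.
window-end : ∀ m g k → 48 * (m * m) ≤ g * g → let d = 8 * m + g; b = suc (6 * m + g) + k in
  3 * (d * d) + 4 * b ≤ 4 * (b * b) + 16
window-end m g k 48m²≤g² = begin
  3 * ((8 * m + g) * (8 * m + g)) + 4 * (suc (6 * m + g) + k)
    ≡⟨ e₁ m g k ⟩
  48 * (m * m) + rest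
    ≤⟨ +-monoˡ-≤ rest 48m²≤g² ⟩
  g * g + rest
    ≤⟨ m≤m+n (g * g + rest) slack ⟩
  g * g + rest + slack
    ≡⟨ e₂ m g k ⟩
  4 * ((suc (6 * m + g) + k) * (suc (6 * m + g) + k)) + 16 ∎
  where
  open ≤-Reasoning
  rest slack : ℕ
  rest = 144 * (m * m) + 48 * (m * g) + 3 * (g * g) + 4 * (suc (6 * m + g) + k)
  slack = 4 * (suc (6 * m + g) + k * suc (6 * m + g + (6 * m + g)) + k * k) + 12
  e₁ : ∀ m g k → 3 * ((8 * m + g) * (8 * m + g)) + 4 * (suc (6 * m + g) + k) ≡
    48 * (m * m) + (144 * (m * m) + 48 * (m * g) + 3 * (g * g) + 4 * (suc (6 * m + g) + k))
  e₁ = solve-∀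
  e₂ : ∀ m g k → g * g + (144 * (m * m) + 48 * (m * g) + 3 * (g * g) + 4 * (suc (6 * m + g) + k)) +
    (4 * (suc (6 * m + g) + k * suc (6 * m + g + (6 * m + g)) + k * k) + 12) ≡
    4 * ((suc (6 * m + g) + k) * (suc (6 * m + g) + k)) + 16
  e₂ = solve-∀

module _ {m N c : ℕ} (4≤m : 4 ≤ m) (large : 28 * m ^ 3 ≤ N)
         (lo : m * (c * c) ≤ 8 * N) (hi : 8 * N < m * (suc c * suc c)) where

  open ≤-Reasoning

  private
    instance
      m≢0 : NonZero m
      m≢0 = >-nonZero (≤-trans (s≤s z≤n) 4≤m)

    d : ℕ
    d = suc c

    224m²<d² : 224 * (m * m) < d * d
    224m²<d² = *-cancelˡ-< m _ _ (begin-strict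
      m * (224 * (m * m)) ≡⟨ e m ⟩
      8 * (28 * m ^ 3)    ≤⟨ *-monoʳ-≤ 8 large ⟩
      8 * N               <⟨ hi ⟩
      m * (d * d)         ∎)
      where
      e : ∀ m → m * (224 * (m * m)) ≡ 8 * (28 * (m * (m * (m * 1))))
      e = solve-∀

    8m≤d : 8 * m ≤ d
    8m≤d = ≮⇒≥ (λ d<8m → <⇒≱ 224m²<d² (begin
      d * d               ≤⟨ *-mono-≤ (<⇒≤ d<8m) (<⇒≤ d<8m) ⟩
      8 * m * (8 * m)     ≡⟨ e m ⟩
      64 * (m * m)        ≤⟨ *-monoˡ-≤ (m * m) {64} {224} (m≤m+n 64 160) ⟩
      224 * (m * m)       ∎))
      where
      e : ∀ m → 8 * m * (8 * m) ≡ 64 * (m * m)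
      e = solve-∀

    -- The offset 8m is chosen so that the cross terms 48mg of 3(8m + g)² and 4(6m + g)² agree;
    -- comparing these squares leaves exactly this inequality. It comes from d² > 8 · 28m² = 224m²:
    -- for g < 7m, g² ≥ (224 - 64 - 112)m², and otherwise g² ≥ 49m².
    48m²≤ : ∀ g → 8 * m + g ≡ d → 48 * (m * m) ≤ g * g
    48m²≤ g eq with 7 * m ≤? g
    ... | yes 7m≤g = begin
      48 * (m * m)    ≤⟨ *-monoˡ-≤ (m * m) {48} {49} (n≤1+n 48) ⟩
      49 * (m * m)    ≡⟨ e m ⟩
      7 * m * (7 * m) ≤⟨ *-mono-≤ 7m≤g 7m≤g ⟩
      g * g           ∎
      where
      e : ∀ m → 49 * (m * m) ≡ 7 * m * (7 * m)
      e = solve-∀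
    ... | no 7m≰g = +-cancelˡ-≤ (176 * (m * m)) _ _ (begin
      176 * (m * m) + 48 * (m * m)         ≡⟨ e₁ m ⟩
      224 * (m * m)                        ≤⟨ <⇒≤ 224m²<d² ⟩
      d * d                                ≡⟨ cong (λ d → d * d) (sym eq) ⟩
      (8 * m + g) * (8 * m + g)            ≡⟨ e₂ m g ⟩
      64 * (m * m) + 16 * (m * g) + g * g  ≤⟨ +-monoˡ-≤ (g * g) (+-monoʳ-≤ (64 * (m * m)) (*-monoʳ-≤ 16 (*-monoʳ-≤ m (<⇒≤ (≰⇒> 7m≰g))))) ⟩
      64 * (m * m) + 16 * (m * (7 * m)) + g * g ≡⟨ cong (_+ g * g) (e₃ m) ⟩
      176 * (m * m) + g * g                ∎)
      where
      e₁ : ∀ m → 176 * (m * m) + 48 * (m * m) ≡ 224 * (m * m)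
      e₁ = solve-∀
      e₂ : ∀ m g → (8 * m + g) * (8 * m + g) ≡ 64 * (m * m) + 16 * (m * g) + g * g
      e₂ = solve-∀
      e₃ : ∀ m → 64 * (m * m) + 16 * (m * (7 * m)) ≡ 176 * (m * m)
      e₃ = solve-∀

    3d²+4b≤ : ∀ b → suc d ≤ b + 2 * m → 3 * (d * d) + 4 * b ≤ 4 * (b * b) + 16
    3d²+4b≤ b d<b+2m = subst₂ (λ d b → 3 * (d * d) + 4 * b ≤ 4 * (b * b) + 16) 8m+g≡d b₀+k≡b
        (window-end m g k (48m²≤ g 8m+g≡d))
      where
      g k : ℕ
      g = d ∸ 8 * m
      k = b ∸ suc (6 * m + g)
      8m+g≡d : 8 * m + g ≡ d
      8m+g≡d = m+[n∸m]≡n 8m≤d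
      e : ∀ m g → suc (6 * m + g) + 2 * m ≡ suc (8 * m + g)
      e = solve-∀
      b₀+k≡b : suc (6 * m + g) + k ≡ b
      b₀+k≡b = m+[n∸m]≡n (+-cancelʳ-≤ (2 * m) _ _ (≤-trans (≤-reflexive (trans (e m g) (cong suc 8m+g≡d))) d<b+2m))

  -- Multiplied by m, 4a becomes 4mb + 8N - 8b, so both inequalities compare b with the square root
  -- of 8N/m, which lies between c and d = c + 1. The window d + 1 - 2m ≤ b ≤ d has 2m elements.
  within : ∀ b h → b ≤ suc c → suc (suc c) ≤ b + 2 * m → N ≡ b + h * m → Within (b + 2 * h) b
  within b h b≤d d<b+2m refl = lower (m≤n⇒m<n∨m≡n b≤d) , upper
    where
    a : ℕ
    a = b + 2 * h
    scaled : ∀ m b h → m * (4 * (b + 2 * h)) + 8 * b ≡ 4 * m * b + 8 * (b + h * m)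
    scaled = solve-∀
    lower′ : m * (b * b) + 8 * b ≤ 4 * m * b + 8 * N → b * b ≤ 4 * a
    lower′ p = *-cancelˡ-≤ m (+-cancelʳ-≤ (8 * b) _ _ (≤-trans p (≤-reflexive (sym (scaled m b h)))))
    lower : b < suc c ⊎ b ≡ suc c → b * b ≤ 4 * a
    lower (inj₁ (s≤s b≤c)) = lower′ (begin
      m * (b * b) + 8 * b      ≤⟨ +-mono-≤ (*-monoʳ-≤ m (*-mono-≤ b≤c b≤c)) (*-monoˡ-≤ b (≤-trans (*-monoʳ-≤ 2 4≤m) (*-monoˡ-≤ m {2} {4} (m≤m+n 2 2)))) ⟩
      m * (c * c) + 4 * m * b  ≤⟨ +-monoˡ-≤ (4 * m * b) lo ⟩
      8 * N + 4 * m * b        ≡⟨ +-comm (8 * N) (4 * m * b) ⟩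
      4 * m * b + 8 * N        ∎)
    -- At b = c + 1 the hypothesis `lo` falls short by m(2c + 1); the surplus 4mb - 8b covers this
    -- once m ≥ 4.
    lower (inj₂ b≡d) with m≤n⇒∃[o]m+o≡n 4≤m
    ... | μ , m≡ = lower′ (begin
      m * (b * b) + 8 * b                       ≡⟨ cong₂ (λ m b → m * (b * b) + 8 * b) (sym m≡) b≡d ⟩
      (4 + μ) * (suc c * suc c) + 8 * suc c     ≤⟨ m≤m+n _ (4 + μ * (2 * c + 3)) ⟩
      (4 + μ) * (suc c * suc c) + 8 * suc c + (4 + μ * (2 * c + 3)) ≡⟨ e μ c ⟩
      4 * (4 + μ) * suc c + (4 + μ) * (c * c)   ≡⟨ cong₂ (λ m b → 4 * m * b + m * (c * c)) m≡ (sym b≡d) ⟩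
      4 * m * b + m * (c * c)                   ≤⟨ +-monoʳ-≤ (4 * m * b) lo ⟩
      4 * m * b + 8 * N                         ∎)
      where
      e : ∀ μ c → (4 + μ) * (suc c * suc c) + 8 * suc c + (4 + μ * (2 * c + 3)) ≡ 4 * (4 + μ) * suc c + (4 + μ) * (c * c)
      e = solve-∀
    upper : 3 * a < b * b + 2 * b + 4
    upper = *-cancelˡ-< (4 * m) _ _ (begin-strict
      4 * m * (3 * a)                        ≤⟨ m≤m+n _ (24 * b) ⟩
      4 * m * (3 * a) + 24 * b               ≡⟨ e₁ m b h ⟩
      12 * (m * b) + 3 * (8 * N)             <⟨ +-monoʳ-< (12 * (m * b)) (*-monoʳ-< 3 hi) ⟩
      12 * (m * b) + 3 * (m * (d * d))       ≡⟨ e₂ m b (d * d) ⟩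
      8 * (m * b) + m * (3 * (d * d) + 4 * b) ≤⟨ +-monoʳ-≤ (8 * (m * b)) (*-monoʳ-≤ m (3d²+4b≤ b d<b+2m)) ⟩
      8 * (m * b) + m * (4 * (b * b) + 16)   ≡⟨ e₃ m b ⟩
      4 * m * (b * b + 2 * b + 4)            ∎)
      where
      e₁ : ∀ m b h → 4 * m * (3 * (b + 2 * h)) + 24 * b ≡ 12 * (m * b) + 3 * (8 * (b + h * m))
      e₁ = solve-∀
      e₂ : ∀ m b D → 12 * (m * b) + 3 * (m * D) ≡ 8 * (m * b) + m * (3 * D + 4 * b)
      e₂ = solve-∀
      e₃ : ∀ m b → 8 * (m * b) + m * (4 * (b * b) + 16) ≡ 4 * m * (b * b + 2 * b + 4)
      e₃ = solve-∀

  2m≤d : 2 * m ≤ suc c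
  2m≤d = ≤-trans (*-monoˡ-≤ m {2} {8} (m≤m+n 2 6)) 8m≤d

  -- Keeps the whole window at or below N, so that (N - b)/m is a natural number for b in the right
  -- class.
  c<N : c < N
  c<N = ≰⇒> (λ N≤c → <⇒≱ {8} {4 * N} (<-≤-trans (m≤m+n 9 103) (*-monoʳ-≤ 4 28≤N)) (*-cancelʳ-≤ (4 * N) 8 N {{>-nonZero (≤-trans (s≤s z≤n) 28≤N)}} (begin
    4 * N * N     ≡⟨ *-assoc 4 N N ⟩
    4 * (N * N)   ≤⟨ *-mono-≤ 4≤m (*-mono-≤ N≤c N≤c) ⟩
    m * (c * c)   ≤⟨ lo ⟩
    8 * N         ∎)))
    where
    28≤N : 28 ≤ N
    28≤N = ≤-trans (*-monoʳ-≤ 28 (m^n>0 m 3)) large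

double≢side : ∀ a b → double a ≢ side b
double≢side a b eq with trans (sym (odd-double a)) (trans (cong odd eq) (cong not (odd-double b)))
... | ()

double-+ : ∀ a b → double (a + b) ≡ double a + double b
double-+ zero    b = refl
double-+ (suc a) b = cong (λ n → suc (suc n)) (double-+ a b)

every-large : ∀ q N → let m = 4 * suc q in 28 * m ^ 3 ≤ N → SumOfFour (m + 2) N
-- The c obtained is the integer part of the square root of 8N/m; 8N + 1 is a crude upper limit for
-- the search.
every-large q N large = search (boundary (λ n → m * (n * n)) (8 * N) (suc (8 * N)) (≤-trans (≤-reflexive (*-zeroʳ m)) z≤n)
    (≤-trans (m≤m*n (suc (8 * N)) (suc (8 * N))) (m≤n*m (suc (8 * N) * suc (8 * N)) m)))
  where
  m Q : ℕ
  m = 4 * suc q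
  Q = suc q
  4≤m : 4 ≤ m
  4≤m = ≤-trans (m≤m*n 4 (suc q)) ≤-refl
  search : ∃[ c ] (m * (c * c) ≤ 8 * N × 8 * N < m * (suc c * suc c)) → SumOfFour (m + 2) N
  search (c , lo , hi) = parity (halve N) (halve b)
    where
    L r h b : ℕ
    -- `L` is the lower end of the window and b its least element congruent to N modulo m; since the
    -- window has 2m elements, b + m belongs to it too.
    L = suc (suc c) ∸ 2 * m
    r = (N ∸ L) % m
    h = (N ∸ L) / m
    b = L + r
    L+2m : L + 2 * m ≡ suc (suc c)
    L+2m = m∸n+n≡m (≤-trans (2m≤d 4≤m large lo hi) (n≤1+n (suc c)))
    c<N′ : c < N
    c<N′ = c<N 4≤m large lo hi
    L≤N : L ≤ N
    L≤N = ≤-trans (≤-pred (≤-trans (≤-trans (≤-reflexive (+-comm 1 L)) (+-monoʳ-≤ L {1} {2 * m} (s≤s z≤n))) (≤-reflexive L+2m))) c<N′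
    N≡ : N ≡ b + h * m
    N≡ = trans (sym (m+[n∸m]≡n L≤N)) (trans (cong (L +_) (m≡m%n+[m/n]*n (N ∸ L) m)) (sym (+-assoc L r (h * m))))
    r<m : r < m
    r<m = m%n<n (N ∸ L) m
    b+m≤d : b + m ≤ suc c
    b+m≤d = ≤-pred (begin
      suc (L + r + m)   ≡⟨ e L r m ⟩
      L + (suc r + m)   ≤⟨ +-monoʳ-≤ L (+-monoˡ-≤ m r<m) ⟩
      L + (m + m)       ≡⟨ cong (L +_) (e′ m) ⟩
      L + 2 * m         ≡⟨ L+2m ⟩
      suc (suc c)       ∎)
      where
      open ≤-Reasoning
      e : ∀ L r m → suc (L + r + m) ≡ L + (suc r + m)
      e = solve-∀
      e′ : ∀ m → m + m ≡ 2 * m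
      e′ = solve-∀
    d<b+2m : suc (suc c) ≤ b + 2 * m
    d<b+2m = ≤-trans (≤-reflexive (sym L+2m)) (+-monoˡ-≤ (2 * m) (m≤m+n L r))
    found : ∀ b′ h′ → N ≡ b′ + h′ * m → FourSquares (b′ + 2 * h′) b′ → SumOfFour (m + 2) N
    found b′ h′ eq fs = subst (SumOfFour (m + 2)) (sym eq) (sumOfFour m h′ b′ fs)
    hm≡ : ∀ h → h * m ≡ double (2 * (h * Q))
    hm≡ h = trans (e h Q) (sym (double≡2* (2 * (h * Q))))
      where
      e : ∀ h Q → h * (4 * Q) ≡ 2 * (2 * (h * Q))
      e = solve-∀
    within-b : Within (b + 2 * h) b
    within-b = within 4≤m large lo hi b h (≤-trans (m≤m+n b m) b+m≤d) d<b+2m N≡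
    -- As m is even, b has the parity of N. If N is odd then so are b and a = b + 2h, and 4a - b² ≡
    -- 3 (mod 8).
    parity : ∃[ n ] (N ≡ double n ⊎ N ≡ side n) → ∃[ β ] (b ≡ double β ⊎ b ≡ side β) → SumOfFour (m + 2) N
    parity (n , inj₁ N≡2n) (β , inj₂ b≡) = ⊥-elim (double≢side n (β + 2 * (h * Q))
      (trans (sym N≡2n) (trans N≡ (trans (cong₂ _+_ b≡ (hm≡ h)) (cong suc (sym (double-+ β (2 * (h * Q)))))))))
    parity (n , inj₂ N≡2n+1) (β , inj₁ b≡) = ⊥-elim (double≢side (β + 2 * (h * Q)) n
      (trans (double-+ β (2 * (h * Q))) (trans (sym (cong₂ _+_ b≡ (hm≡ h))) (trans (sym N≡) N≡2n+1))))
    parity (n , inj₂ _) (β , inj₂ b≡) = found b h N≡ (subst₂ FourSquares (sym a≡) (sym b≡)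
        (odd-case (β + h) β (subst₂ Within a≡ b≡ within-b)))
      where
      e : ∀ β h → suc (2 * β) + 2 * h ≡ suc (2 * (β + h))
      e = solve-∀
      a≡ : b + 2 * h ≡ suc (2 * (β + h))
      a≡ = trans (cong (_+ 2 * h) (trans b≡ (cong suc (double≡2* β)))) (e β h)
    parity (n , inj₁ _) (β , inj₁ b≡2β) = residue (halve (β + h))
      where
      b≡ : b ≡ 2 * β
      b≡ = trans b≡2β (double≡2* β)
      residue : ∃[ α ] (β + h ≡ double α ⊎ β + h ≡ side α) → SumOfFour (m + 2) N
      residue (α , inj₂ β+h) = found b h N≡ (subst₂ FourSquares (sym a≡) (sym b≡) (even-case α β (subst₂ Within a≡ b≡ within-b)))
        where
        e : ∀ α → 2 * suc (2 * α) ≡ 4 * α + 2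
        e = solve-∀
        a≡ : b + 2 * h ≡ 4 * α + 2
        a≡ = trans (cong (_+ 2 * h) b≡) (trans (sym (*-distribˡ-+ 2 β h))
               (trans (cong (2 *_) (trans β+h (cong suc (double≡2* α)))) (e α)))
      -- Here 4 divides a. Replacing (b, h) by (b + m, h - 1) keeps N and adds m - 2 to a, which
      -- makes a ≡ 2 (mod 4).
      residue (α , inj₁ β+h) = next h refl α β+h
        where
        next : ∀ h₁ → h ≡ h₁ → ∀ α → β + h ≡ double α → SumOfFour (m + 2) N
        next zero    h≡0 α β+h = ⊥-elim (<⇒≱ c<N′ (≤-pred (≤-trans (≤-trans (≤-reflexive (cong suc (trans N≡ (trans (cong (λ h → b + h * m) h≡0) (+-identityʳ b)))))
          (≤-trans (≤-reflexive (+-comm 1 b)) (+-monoʳ-≤ b {1} {m} (s≤s z≤n)))) b+m≤d)))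
        next (suc h₁) h≡ zero    β+h with trans (sym (+-suc β h₁)) (trans (cong (β +_) (sym h≡)) β+h)
        ... | ()
        next (suc h₁) h≡ (suc α) β+h = found (b + m) h₁ N≡′ (subst₂ FourSquares (sym a≡) (sym b′≡)
            (even-case (α + Q) (β + 2 * Q) (subst₂ Within a≡ b′≡ within-b+m)))
          where
          N≡′ : N ≡ b + m + h₁ * m
          N≡′ = trans N≡ (trans (cong (λ h → b + h * m) h≡) (sym (+-assoc b m (h₁ * m))))
          within-b+m : Within (b + m + 2 * h₁) (b + m)
          within-b+m = within 4≤m large lo hi (b + m) h₁ b+m≤d (≤-trans d<b+2m (+-monoˡ-≤ (2 * m) (m≤m+n b m))) N≡′
          e₁ : ∀ β Q → 2 * β + 4 * Q ≡ 2 * (β + 2 * Q)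
          e₁ = solve-∀
          b′≡ : b + m ≡ 2 * (β + 2 * Q)
          b′≡ = trans (cong (_+ m) b≡) (e₁ β Q)
          β+h₁ : β + h₁ ≡ suc (2 * α)
          β+h₁ = suc-injective (trans (sym (+-suc β h₁)) (trans (cong (β +_) (sym h≡)) (trans β+h (cong (λ n → suc (suc n)) (double≡2* α)))))
          e₂ : ∀ β Q h → 2 * (β + 2 * Q) + 2 * h ≡ 2 * (β + h) + 4 * Q
          e₂ = solve-∀
          e₃ : ∀ α Q → 2 * suc (2 * α) + 4 * Q ≡ 4 * (α + Q) + 2
          e₃ = solve-∀
          a≡ : b + m + 2 * h₁ ≡ 4 * (α + Q) + 2
          a≡ = trans (cong (_+ 2 * h₁) b′≡) (trans (e₂ β Q h₁) (trans (cong (λ x → 2 * x + 4 * Q) β+h₁) (e₃ α Q)))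

-- Part (ii): with l = 2q + 1 and m = 4q, l·p_{m+4}(x) + q² = (lx − q)².
module Exceptions (q′ : ℕ) where

  q l : ℕ
  q = suc q′
  l = suc (2 * q)

  -- Only x = 0 makes lx - q negative; otherwise the value starts at l - q = q + 1.
  ∣lx-q∣ : ℕ → ℕ
  ∣lx-q∣ zero    = q
  ∣lx-q∣ (suc w) = l * w + suc q

  complete-square : ∀ x → l * polygonal (4 * q + 4) x + q * q ≡ ∣lx-q∣ x * ∣lx-q∣ x
  complete-square zero    = cong (_+ q * q) (trans (cong (λ z → l * (z + 0)) (*-zeroʳ (4 * q + 4 ∸ 2))) (*-zeroʳ l))
  complete-square (suc w) = trans (cong (λ k → l * (k * choose2 (suc w) + suc w) + q * q) k≡)
    (trans (e₁ q (choose2 w) w) (trans (cong (λ s → l * (suc (2 * q) * (s + w) + suc w) + q * q) (2choose2 w)) (e₂ q w)))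
    where
    k≡ : 4 * q + 4 ∸ 2 ≡ 2 * suc (2 * q)
    k≡ = trans (cong (_∸ 2) (e q)) (m+n∸n≡m (2 * suc (2 * q)) 2)
      where
      e : ∀ q → 4 * q + 4 ≡ 2 * suc (2 * q) + 2
      e = solve-∀
    e₁ : ∀ q c w → suc (2 * q) * (2 * suc (2 * q) * (c + w) + suc w) + q * q ≡
      suc (2 * q) * (suc (2 * q) * ((2 * c + w) + w) + suc w) + q * q
    e₁ = solve-∀
    e₂ : ∀ q w → suc (2 * q) * (suc (2 * q) * ((w * w) + w) + suc w) + q * q ≡
      (suc (2 * q) * w + suc q) * (suc (2 * q) * w + suc q)
    e₂ = solve-∀

  -- The inverse of 2 modulo l is q + 1, since 2(q + 1) = l + 1.
  l∣2x⇒l∣x : ∀ x → l ∣ 2 * x → l ∣ x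
  l∣2x⇒l∣x x l∣2x = ∣m+n∣m⇒∣n (subst (l ∣_) (e q x) (∣-trans l∣2x (n∣m*n (suc q)))) (m∣m*n x)
    where
    e : ∀ q x → suc q * (2 * x) ≡ suc (2 * q) * x + x
    e = solve-∀

  l∣2^ix⇒l∣x : ∀ i x → l ∣ 2 ^ i * x → l ∣ x
  l∣2^ix⇒l∣x zero    x p = subst (l ∣_) (*-identityˡ x) p
  l∣2^ix⇒l∣x (suc i) x p = l∣2^ix⇒l∣x i x (l∣2x⇒l∣x (2 ^ i * x) (subst (l ∣_) (*-assoc 2 (2 ^ i) x) p))

  -- Among the l + 1 powers 2^0, ..., 2^l two agree modulo l, and the smaller one can be cancelled
  -- because l is odd. The remaining power is at least 2, which gives E > 0.
  order : ∃[ r ] ∃[ E ] (2 ^ r ≡ 1 + l * E × 0 < E)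
  order with pigeonhole {m = l} {n = suc l} ≤-refl (λ i → fromℕ< (m%n<n (2 ^ toℕ i) l))
  ... | i , j , i<j , same with m≤n⇒∃[o]m+o≡n i<j
  ... | k , eq = suc k , power (2 ^ suc k) refl
    where
    a : ℕ
    a = toℕ i
    same% : 2 ^ a % l ≡ 2 ^ toℕ j % l
    same% = trans (sym (toℕ-fromℕ< _)) (trans (cong toℕ same) (toℕ-fromℕ< _))
    2^j : 2 ^ toℕ j ≡ 2 ^ a * 2 ^ suc k
    2^j = trans (cong (2 ^_) (trans (sym eq) (sym (+-suc a k)))) (^-distribˡ-+-* 2 a (suc k))
    power : ∀ x → 2 ^ suc k ≡ x → ∃[ E ] (x ≡ 1 + l * E × 0 < E)
    power zero          x≡ = ⊥-elim (<⇒≢ (m^n>0 2 (suc k)) (sym x≡))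
    power (suc zero)    x≡ = ⊥-elim (<⇒≢ (≤-trans (s≤s (s≤s z≤n)) (*-monoʳ-≤ 2 (m^n>0 2 k))) (sym x≡))
    power (suc (suc y)) x≡ with l∣2^ix⇒l∣x a (suc y) (∣m+n∣m⇒∣n {m = 2 ^ a / l * l} (subst (l ∣_) (sym total) (n∣m*n (2 ^ toℕ j / l))) (n∣m*n (2 ^ a / l)))
      where
      total : 2 ^ a / l * l + 2 ^ a * suc y ≡ 2 ^ toℕ j / l * l
      total = +-cancelˡ-≡ (2 ^ a % l) _ _ (begin
        2 ^ a % l + (2 ^ a / l * l + 2 ^ a * suc y) ≡⟨ sym (+-assoc (2 ^ a % l) (2 ^ a / l * l) (2 ^ a * suc y)) ⟩
        2 ^ a % l + 2 ^ a / l * l + 2 ^ a * suc y   ≡⟨ cong (_+ 2 ^ a * suc y) (sym (m≡m%n+[m/n]*n (2 ^ a) l)) ⟩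
        2 ^ a + 2 ^ a * suc y                       ≡⟨ sym (*-suc (2 ^ a) (suc y)) ⟩
        2 ^ a * suc (suc y)                         ≡⟨ trans (cong (2 ^ a *_) (sym x≡)) (sym 2^j) ⟩
        2 ^ toℕ j                                   ≡⟨ m≡m%n+[m/n]*n (2 ^ toℕ j) l ⟩
        2 ^ toℕ j % l + 2 ^ toℕ j / l * l           ≡⟨ cong (_+ 2 ^ toℕ j / l * l) (sym same%) ⟩
        2 ^ a % l + 2 ^ toℕ j / l * l               ∎)
        where open ≡-Reasoning
    ... | divides zero    ()
    ... | divides (suc E) y≡ = suc E , cong suc (trans y≡ (*-comm (suc E) l)) , s≤s z≤n

  -- Squaring 1 + lE gives 1 + l(2E + lE²), so the congruence persists while E grows; this yields
  -- infinitely many exceptions.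
  large-order : ∀ B → ∃[ r ] ∃[ E ] (2 ^ r ≡ 1 + l * E × B < E)
  large-order zero    = order
  large-order (suc B) with large-order B
  ... | r , E , eq , B<E = r + r , E + (E + l * (E * E)) ,
      trans (^-distribˡ-+-* 2 r r) (trans (cong₂ _*_ eq eq) (e l E)) ,
      ≤-<-trans B<E (m<m+n E (≤-trans (≤-trans (s≤s z≤n) B<E) (m≤m+n E _)))
    where
    e : ∀ l E → (1 + l * E) * (1 + l * E) ≡ 1 + l * (E + (E + l * (E * E)))
    e = solve-∀

-- Descent by powers of 2

bit : Bool → ℕ
bit true  = 1
bit false = 0

bits : ∀ x → ∃[ p ] ∃[ k ] (x ≡ bit p + 2 * k)
bits x with halve x
... | k , inj₁ eq = false , k , trans eq (double≡2* k)
... | k , inj₂ eq = true , k , trans eq (cong suc (double≡2* k))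

-- Squares are 0 or 1 modulo 4, and 1 modulo 8 when odd.
sum≡0[8]⇒even : ∀ a b c d X → a * a + b * b + c * c + d * d ≡ 8 * X →
  ∃[ a′ ] ∃[ b′ ] ∃[ c′ ] ∃[ d′ ] (a ≡ 2 * a′ × b ≡ 2 * b′ × c ≡ 2 * c′ × d ≡ 2 * d′)
sum≡0[8]⇒even a b c d X eq with bits a | bits b | bits c | bits d
... | p₁ , a′ , a≡ | p₂ , b′ , b≡ | p₃ , c′ , c≡ | p₄ , d′ , d≡ = cases p₁ p₂ p₃ p₄ a≡ b≡ c≡ d≡ (4∣bits p₁ p₂ p₃ p₄ a≡ b≡ c≡ d≡)
  where
  Goal : Set
  Goal = ∃[ a′ ] ∃[ b′ ] ∃[ c′ ] ∃[ d′ ] (a ≡ 2 * a′ × b ≡ 2 * b′ × c ≡ 2 * c′ × d ≡ 2 * d′)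
  bit² : ∀ p k → (bit p + 2 * k) * (bit p + 2 * k) ≡ bit p + 4 * (k * k + bit p * k)
  bit² true  = e
    where
    e : ∀ k → (1 + 2 * k) * (1 + 2 * k) ≡ 1 + 4 * (k * k + 1 * k)
    e = solve-∀
  bit² false = e
    where
    e : ∀ k → (0 + 2 * k) * (0 + 2 * k) ≡ 0 + 4 * (k * k + 0 * k)
    e = solve-∀
  4∣bits : ∀ p₁ p₂ p₃ p₄ → a ≡ bit p₁ + 2 * a′ → b ≡ bit p₂ + 2 * b′ → c ≡ bit p₃ + 2 * c′ → d ≡ bit p₄ + 2 * d′ →
    4 ∣ bit p₁ + bit p₂ + bit p₃ + bit p₄
  4∣bits p₁ p₂ p₃ p₄ refl refl refl refl = ∣m+n∣m⇒∣n (subst (4 ∣_) (sym rearranged) (divides (2 * X) (*-comm′ X))) (m∣m*n Y)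
    where
    Y : ℕ
    Y = (a′ * a′ + bit p₁ * a′) + (b′ * b′ + bit p₂ * b′) + (c′ * c′ + bit p₃ * c′) + (d′ * d′ + bit p₄ * d′)
    *-comm′ : ∀ X → 8 * X ≡ 2 * X * 4
    *-comm′ = solve-∀
    e : ∀ p q r s w x y z → 4 * (w + x + y + z) + (p + q + r + s) ≡ (p + 4 * w) + (q + 4 * x) + (r + 4 * y) + (s + 4 * z)
    e = solve-∀
    rearranged : 4 * Y + (bit p₁ + bit p₂ + bit p₃ + bit p₄) ≡ 8 * X
    rearranged = trans (e (bit p₁) (bit p₂) (bit p₃) (bit p₄)
        (a′ * a′ + bit p₁ * a′) (b′ * b′ + bit p₂ * b′) (c′ * c′ + bit p₃ * c′) (d′ * d′ + bit p₄ * d′))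
      (trans (sym (cong₂ _+_ (cong₂ _+_ (cong₂ _+_ (bit² p₁ a′) (bit² p₂ b′)) (bit² p₃ c′)) (bit² p₄ d′))) eq)
  small : ∀ {s} → 4 ∣ suc s → suc s < 4 → Goal
  small 4∣s s<4 = ⊥-elim (<⇒≱ s<4 (∣⇒≤ 4∣s))
  1<4 : 1 < 4
  1<4 = s≤s (s≤s z≤n)
  2<4 : 2 < 4
  2<4 = s≤s (s≤s (s≤s z≤n))
  3<4 : 3 < 4
  3<4 = s≤s (s≤s (s≤s (s≤s z≤n)))
  cases : ∀ p₁ p₂ p₃ p₄ → a ≡ bit p₁ + 2 * a′ → b ≡ bit p₂ + 2 * b′ → c ≡ bit p₃ + 2 * c′ → d ≡ bit p₄ + 2 * d′ →
    4 ∣ bit p₁ + bit p₂ + bit p₃ + bit p₄ → Goal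
  cases false false false false a≡ b≡ c≡ d≡ _ = a′ , b′ , c′ , d′ , a≡ , b≡ , c≡ , d≡
  cases true true true true refl refl refl refl _ = ⊥-elim (<⇒≱ {4} {8} (m≤m+n 5 3) (∣⇒≤ (∣m+n∣m⇒∣n (subst (8 ∣_) (sym total) (m∣m*n X)) (m∣m*n T))))
    where
    T : ℕ
    T = choose2 (suc a′) + choose2 (suc b′) + choose2 (suc c′) + choose2 (suc d′)
    sq : ∀ k → suc (2 * k) * suc (2 * k) ≡ suc (8 * choose2 (suc k))
    sq k = trans (cong (λ n → suc n * suc n) (sym (double≡2* k))) (trans (side² k) (cong suc (trans (cong (4 *_) (pronic-even k)) (sym (*-assoc 4 2 (choose2 (suc k)))))))
    e : ∀ w x y z → 8 * (w + x + y + z) + 4 ≡ suc (8 * w) + suc (8 * x) + suc (8 * y) + suc (8 * z)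
    e = solve-∀
    total : 8 * T + 4 ≡ 8 * X
    total = trans (e (choose2 (suc a′)) (choose2 (suc b′)) (choose2 (suc c′)) (choose2 (suc d′)))
      (trans (sym (cong₂ _+_ (cong₂ _+_ (cong₂ _+_ (sq a′) (sq b′)) (sq c′)) (sq d′))) eq)
  cases true  false false false _ _ _ _ p = small p 1<4
  cases false true  false false _ _ _ _ p = small p 1<4
  cases false false true  false _ _ _ _ p = small p 1<4
  cases false false false true  _ _ _ _ p = small p 1<4
  cases true  true  false false _ _ _ _ p = small p 2<4
  cases true  false true  false _ _ _ _ p = small p 2<4
  cases true  false false true  _ _ _ _ p = small p 2<4
  cases false true  true  false _ _ _ _ p = small p 2<4
  cases false true  false true  _ _ _ _ p = small p 2<4
  cases false false true  true  _ _ _ _ p = small p 2<4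
  cases false true  true  true  _ _ _ _ p = small p 3<4
  cases true  false true  true  _ _ _ _ p = small p 3<4
  cases true  true  false true  _ _ _ _ p = small p 3<4
  cases true  true  true  false _ _ _ _ p = small p 3<4

-- The factor 2 in 2κ leaves a factor 8, not just 4, at every stage; it excludes four odd squares,
-- whose sum is 4 modulo 8.
descent : ∀ κ r a b c d → a * a + b * b + c * c + d * d ≡ 2 * κ * (2 ^ r * 2 ^ r) →
  ∃[ a′ ] ∃[ b′ ] ∃[ c′ ] ∃[ d′ ] ((a ≡ 2 ^ r * a′ × b ≡ 2 ^ r * b′ × c ≡ 2 ^ r * c′ × d ≡ 2 ^ r * d′) ×
    a′ * a′ + b′ * b′ + c′ * c′ + d′ * d′ ≡ 2 * κ)
descent κ zero    a b c d eq = a , b , c , d ,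
  (sym (*-identityˡ a) , sym (*-identityˡ b) , sym (*-identityˡ c) , sym (*-identityˡ d)) , trans eq (*-identityʳ (2 * κ))
descent κ (suc r) a b c d eq with sum≡0[8]⇒even a b c d (κ * (2 ^ r * 2 ^ r)) (trans eq (e κ (2 ^ r)))
  where
  e : ∀ κ x → 2 * κ * (2 * x * (2 * x)) ≡ 8 * (κ * (x * x))
  e = solve-∀
... | a′ , b′ , c′ , d′ , refl , refl , refl , refl with descent κ r a′ b′ c′ d′ (*-cancelˡ-≡ _ _ 4 (trans (e a′ b′ c′ d′) (trans eq (e′ κ (2 ^ r)))))
  where
  e : ∀ a b c d → 4 * (a * a + b * b + c * c + d * d) ≡ 2 * a * (2 * a) + 2 * b * (2 * b) + 2 * c * (2 * c) + 2 * d * (2 * d)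
  e = solve-∀
  e′ : ∀ κ x → 2 * κ * (2 * x * (2 * x)) ≡ 4 * (2 * κ * (x * x))
  e′ = solve-∀
... | a″ , b″ , c″ , d″ , (refl , refl , refl , refl) , eq″ = a″ , b″ , c″ , d″ ,
  (up a″ , up b″ , up c″ , up d″) , eq″
  where
  up : ∀ x → 2 * (2 ^ r * x) ≡ 2 ^ suc r * x
  up x = sym (*-assoc 2 (2 ^ r) x)

module _ (q′ : ℕ) where
  open Exceptions q′

  -- If 2^r ≡ 1 modulo l then lx − q = 2^r y forces y ≡ q + 1 modulo l.
  quotient-large : ∀ r E x y → 2 ^ r ≡ 1 + l * E → 0 < E → ∣lx-q∣ x ≡ 2 ^ r * y → suc q ≤ y
  quotient-large r E x y pow E>0 eq = ≮⇒≥ (λ y≤q → go x y (≤-pred y≤q) (trans eq (trans (cong (_* y) pow) (e l E y))))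
    where
    e : ∀ l E y → (1 + l * E) * y ≡ y + l * (E * y)
    e = solve-∀
    go : ∀ x y → y ≤ q → ∣lx-q∣ x ≡ y + l * (E * y) → ⊥
    -- At x = 0 the value is q with 0 < q < l < 2^r, so it is not a multiple of 2^r.
    go zero    zero    y≤q eq with trans eq (trans (cong (l *_) (*-zeroʳ E)) (*-zeroʳ l))
    ... | ()
    go zero    (suc y) y≤q eq = <⇒≢ (≤-trans (≤-trans (s≤s (m≤m+n q (q + 0))) (≤-trans (≤-reflexive (sym (*-identityʳ l)))
        (*-monoʳ-≤ l (*-mono-≤ E>0 (s≤s z≤n))))) (m≤n+m (l * (E * suc y)) (suc y))) eq
    -- Modulo l the equation reads y ≡ q + 1, so l divides q + 1 - y, which for y ≤ q lies strictly
    -- between 0 and l.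
    go (suc w) y y≤q eq with m≤n⇒∃[o]m+o≡n y≤q
    ... | o , y+o≡q = <⇒≱ {suc o} {l} (s≤s (≤-trans (≤-trans (s≤s (m≤n+m o y)) (≤-reflexive (cong suc y+o≡q))) (m<m+n q (s≤s z≤n)))) (∣⇒≤ {suc o} {l}
          (∣m+n∣m⇒∣n (subst (l ∣_) (sym (+-cancelˡ-≡ y _ _ (trans (e′ y (l * w) o) (trans (cong (λ z → l * w + suc z) y+o≡q) eq)))) (m∣m*n (E * y))) (m∣m*n w)))
      where
      e′ : ∀ y W o → y + (W + suc o) ≡ W + suc (y + o)
      e′ = solve-∀

  exceptional : ∀ B → ∃[ N ] (B < N × 0 < N × ¬ SumOfFour (4 * q + 4) N)
  exceptional B with large-order B
  ... | r , E , pow , B<E = N , ≤-trans B<E E≤N , s≤s z≤n , impossible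
    where
    N κ : ℕ
    -- Solves lN + (l - 1)² = (l² + 1)·4^r with 4^r = 1 + l(2E + lE²); the term 2 is (l² + 1 - (l -
    -- 1)²)/l. Below, 2κ = l² + 1.
    N = 2 + (l * l + 1) * (2 * E + l * (E * E))
    κ = 2 * (q * q) + 2 * q + 1
    E≤N : E ≤ N
    E≤N = ≤-trans (≤-trans (m≤m+n E _) (m≤m+n (2 * E) (l * (E * E)))) (≤-trans (m≤n*m _ (l * l + 1)) (m≤n+m _ 2))
    scaled : l * N + 4 * (q * q) ≡ 2 * κ * (2 ^ r * 2 ^ r)
    scaled = trans (e q E) (cong (λ x → 2 * κ * (x * x)) (sym pow))
      where
      e : ∀ q E → suc (2 * q) * (2 + (suc (2 * q) * suc (2 * q) + 1) * (2 * E + suc (2 * q) * (E * E))) + 4 * (q * q) ≡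
        2 * (2 * (q * q) + 2 * q + 1) * ((1 + suc (2 * q) * E) * (1 + suc (2 * q) * E))
      e = solve-∀
    e₁ : ∀ l q a b c d → (l * a + q * q) + (l * b + q * q) + (l * c + q * q) + (l * d + q * q) ≡ l * (a + b + c + d) + 4 * (q * q)
    e₁ = solve-∀
    e₂ : ∀ q → 2 * (2 * (q * q) + 2 * q + 1) + (4 * q + 2) ≡ suc q * suc q + suc q * suc q + suc q * suc q + suc q * suc q
    e₂ = solve-∀
    p : ℕ → ℕ
    p = polygonal (4 * q + 4)
    squares : ∀ x₁ x₂ x₃ x₄ → p x₁ + p x₂ + p x₃ + p x₄ ≡ N →
      ∣lx-q∣ x₁ * ∣lx-q∣ x₁ + ∣lx-q∣ x₂ * ∣lx-q∣ x₂ + ∣lx-q∣ x₃ * ∣lx-q∣ x₃ + ∣lx-q∣ x₄ * ∣lx-q∣ x₄ ≡ 2 * κ * (2 ^ r * 2 ^ r)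
    squares x₁ x₂ x₃ x₄ eq =
      trans (sym (cong₂ _+_ (cong₂ _+_ (cong₂ _+_ (complete-square x₁) (complete-square x₂)) (complete-square x₃)) (complete-square x₄)))
        (trans (e₁ l q (p x₁) (p x₂) (p x₃) (p x₄)) (trans (cong (λ n → l * n + 4 * (q * q)) eq) scaled))
    sq : ∀ x y → ∣lx-q∣ x ≡ 2 ^ r * y → suc q * suc q ≤ y * y
    sq x y eq = *-mono-≤ large large
      where
      large : suc q ≤ y
      large = quotient-large r E x y pow (≤-trans (s≤s z≤n) B<E) eq
    too-large : ∀ x₁ x₂ x₃ x₄ → ∃[ y₁ ] ∃[ y₂ ] ∃[ y₃ ] ∃[ y₄ ]
      ((∣lx-q∣ x₁ ≡ 2 ^ r * y₁ × ∣lx-q∣ x₂ ≡ 2 ^ r * y₂ × ∣lx-q∣ x₃ ≡ 2 ^ r * y₃ × ∣lx-q∣ x₄ ≡ 2 ^ r * y₄) ×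
        y₁ * y₁ + y₂ * y₂ + y₃ * y₃ + y₄ * y₄ ≡ 2 * κ) → ⊥
    -- Four quotients of at least q + 1 have squares of sum at least 4(q + 1)², which exceeds l² + 1
    -- = 4q² + 4q + 2 by 4q + 2.
    too-large x₁ x₂ x₃ x₄ (y₁ , y₂ , y₃ , y₄ , (eq₁ , eq₂ , eq₃ , eq₄) , sum) = <⇒≱ (m<m+n (2 * κ) {4 * q + 2} (s≤s z≤n)) (begin
      2 * κ + (4 * q + 2) ≡⟨ e₂ q ⟩
      suc q * suc q + suc q * suc q + suc q * suc q + suc q * suc q
        ≤⟨ +-mono-≤ (+-mono-≤ (+-mono-≤ (sq x₁ y₁ eq₁) (sq x₂ y₂ eq₂)) (sq x₃ y₃ eq₃)) (sq x₄ y₄ eq₄) ⟩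
      y₁ * y₁ + y₂ * y₂ + y₃ * y₃ + y₄ * y₄ ≡⟨ sum ⟩
      2 * κ ∎)
      where open ≤-Reasoning
    impossible : ¬ SumOfFour (4 * q + 4) N
    impossible (x₁ , x₂ , x₃ , x₄ , eq) = too-large x₁ x₂ x₃ x₄
      (descent κ r (∣lx-q∣ x₁) (∣lx-q∣ x₂) (∣lx-q∣ x₃) (∣lx-q∣ x₄) (squares x₁ x₂ x₃ x₄ eq))

theorem1p1 : (m : ℕ) → 0 < m → 4 ∣ m →
    ((N : ℕ) → 28 * m ^ 3 ≤ N → SumOfFour (m + 2) N)
    × ((B : ℕ) → ∃[ N ] (B < N × 0 < N × ¬ SumOfFour (m + 4) N))
theorem1p1 m () (divides zero refl)
theorem1p1 m 0<m (divides (suc q) m≡) = subst Both (trans (*-comm 4 (suc q)) (sym m≡)) (every-large q , exceptional q)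
  where
  Both : ℕ → Set
  Both m = ((N : ℕ) → 28 * m ^ 3 ≤ N → SumOfFour (m + 2) N)
    × ((B : ℕ) → ∃[ N ] (B < N × 0 < N × ¬ SumOfFour (m + 4) N))
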